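{- Let $q$ be a prime power and $g\ge0$ an integer, both fixed. For $n\ge1$ let $c_n$ be a regular elliptic element of $\mathrm{GL}_n(\mathbb{F}_q)$, and let $N_g(n)$ be the number of pairs $(u,v)\in\mathrm{GL}_n(\mathbb{F}_q)^2$ with $u\cdot v=c_n$ and $n-\dim\ker(u-1)-\dim\ker(v-1)=g$ (genus-$g$ factorizations into two factors). Then as $n\to\infty$, \[ N_g(n)=\Theta\!\left(\frac{q^{(n+g)^2/2}}{|\mathrm{GL}_g(\mathbb{F}_q)|}\right), \] where the implicit constants depend on $q$ but not on $g$.
   Context: Choosing an $\mathbb{F}_q$-basis of $\mathbb{F}_{q^n}$ identifies $\mathbb{F}_{q^n}^\times$ with a subgroup of $\mathrm{GL}_n(\mathbb{F}_q)$ (an element acts by multiplication). A regular elliptic element of $\mathrm{GL}_n(\mathbb{F}_q)$ is the image under such an inclusion of an element $\sigma\in\mathbb{F}_{q^n}$ with $\mathbb{F}_q[\sigma]=\mathbb{F}_{q^n}$. $|\mathrm{GL}_0(\mathbb{F}_q)|=1$. -}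

module Defs where

open import Level using (0ℓ)
open import Data.Nat as ℕ using (ℕ; zero; suc; _^_)
open import Data.Fin using (Fin; zero; suc)
open import Data.Fin.Properties using (all?; any?)
import Data.Fin as Fin
open import Data.List using (List; []; _∷_; [_]; map; concatMap; filter; length)
open import Data.List.Relation.Unary.Any using (Any)
import Data.List.Relation.Unary.Any
import Data.List.Relation.Unary.All
import Data.List
open import Data.List.Relation.Unary.AllPairs using (AllPairs)
open import Data.Product using (Σ; ∃; _×_; _,_; proj₁; proj₂)
open import Relation.Nullary using (¬_; Dec; yes; no; does)
open import Relation.Nullary.Decidable using (_×-dec_; _→-dec_)
open import Relation.Binary using (Decidable)
open import Relation.Binary.PropositionalEquality using (_≡_)
open import Algebra.Bundles using (CommutativeRing)
open import Data.Bool using (if_then_else_)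
open import Data.Vec.Functional using (Vector) renaming (_∷_ to _∷ᶠ_)

record FiniteField (q : ℕ) : Set₁ where
  field
    commRing : CommutativeRing 0ℓ 0ℓ
  open CommutativeRing commRing public
  field
    0≉1      : ¬ (0# ≈ 1#)
    inverse  : ∀ x → ¬ (x ≈ 0#) → ∃ λ y → (x * y) ≈ 1#
    _≟_      : Decidable _≈_
    elems    : List Carrier
    complete : ∀ x → Any (x ≈_) elems
    distinct : AllPairs (λ a b → ¬ (a ≈ b)) elems
    size     : length elems ≡ q

allFuns : ∀ {A : Set} → List A → (n : ℕ) → List (Vector A n)
allFuns xs zero    = (λ ()) ∷ []
allFuns xs (suc n) = concatMap (λ x → map (λ f → x ∷ᶠ f) (allFuns xs n)) xs

module LinAlg {q : ℕ} (K : FiniteField q) where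
  open FiniteField K using (Carrier; _≈_; _+_; _*_; _-_; 0#; 1#; _≟_; elems)

  Σ[_] : ∀ {n} → (Fin n → Carrier) → Carrier
  Σ[_] {zero}  f = 0#
  Σ[_] {suc n} f = f zero + Σ[ (λ i → f (suc i)) ]

  Vec : ℕ → Set
  Vec n = Fin n → Carrier

  Mat : ℕ → Set
  Mat n = Fin n → Fin n → Carrier

  _⊗_ : ∀ {n} → Mat n → Mat n → Mat n
  (A ⊗ B) i j = Σ[ (λ k → A i k * B k j) ]

  _·ᵥ_ : ∀ {n} → Mat n → Vec n → Vec n
  (A ·ᵥ x) i = Σ[ (λ k → A i k * x k) ]

  I : ∀ {n} → Mat n
  I i j = if does (i Fin.≟ j) then 1# else 0#

  _−I : ∀ {n} → Mat n → Mat n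
  (A −I) i j = A i j - I i j

  _≈ᵥ_ : ∀ {n} → Vec n → Vec n → Set
  x ≈ᵥ y = ∀ i → x i ≈ y i

  _≈ᵥ?_ : ∀ {n} → (x y : Vec n) → Dec (x ≈ᵥ y)
  x ≈ᵥ? y = all? (λ i → x i ≟ y i)

  _≈ₘ_ : ∀ {n} → Mat n → Mat n → Set
  A ≈ₘ B = ∀ i j → A i j ≈ B i j

  _≈ₘ?_ : ∀ {n} → (A B : Mat n) → Dec (A ≈ₘ B)
  A ≈ₘ? B = all? (λ i → all? (λ j → A i j ≟ B i j))

  0ᵥ : ∀ {n} → Vec n
  0ᵥ _ = 0#

  allVecs : (n : ℕ) → List (Vec n)
  allVecs n = allFuns elems n

  allMats : (n : ℕ) → List (Mat n)
  allMats n = allFuns (allVecs n) n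

  Invertible : ∀ {n} → Mat n → Set
  Invertible {n} A = Any (λ B → (A ⊗ B) ≈ₘ I × (B ⊗ A) ≈ₘ I) (allMats n)

  invertible? : ∀ {n} (A : Mat n) → Dec (Invertible A)
  invertible? {n} A =
    Data.List.Relation.Unary.Any.any? (λ B → ((A ⊗ B) ≈ₘ? I) ×-dec ((B ⊗ A) ≈ₘ? I)) (allMats n)

  ∣GL∣ : ℕ → ℕ
  ∣GL∣ n = length (filter invertible? (allMats n))

  lincomb : ∀ {n d} → Vec d → (Fin d → Vec n) → Vec n
  lincomb a f i = Σ[ (λ k → a k * f k i) ]

  Independent : ∀ {n d} → (Fin d → Vec n) → Set
  Independent {n} {d} f =
    Data.List.Relation.Unary.All.All (λ a → lincomb a f ≈ᵥ 0ᵥ → a ≈ᵥ 0ᵥ) (allVecs d)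

  independent? : ∀ {n d} (f : Fin d → Vec n) → Dec (Independent f)
  independent? {n} {d} f =
    Data.List.Relation.Unary.All.all? (λ a → (lincomb a f ≈ᵥ? 0ᵥ) →-dec (a ≈ᵥ? 0ᵥ)) (allVecs d)

  kerList : ∀ {n} → Mat n → List (Vec n)
  kerList {n} A = filter (λ x → (A ·ᵥ x) ≈ᵥ? 0ᵥ) (allVecs n)

  HasIndep : ∀ {n} → Mat n → ℕ → Set
  HasIndep A d = Any Independent (allFuns (kerList A) d)

  hasIndep? : ∀ {n} (A : Mat n) (d : ℕ) → Dec (HasIndep A d)
  hasIndep? A d = Data.List.Relation.Unary.Any.any? independent? (allFuns (kerList A) d)

  dimKer : ∀ {n} → Mat n → ℕ
  dimKer {n} A = go n
    where
    go : ℕ → ℕ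
    go zero    = zero
    go (suc d) = if does (hasIndep? A (suc d)) then suc d else go d

  GenusCond : ∀ {n} → ℕ → Mat n → Mat n → Set
  GenusCond {n} g u v = g ℕ.+ dimKer (u −I) ℕ.+ dimKer (v −I) ≡ n

  N : ∀ {n} → ℕ → Mat n → ℕ
  N {n} g c = length (filter P? (Data.List.cartesianProduct (allMats n) (allMats n)))
    where
    P? : (p : Mat n × Mat n) → Dec ((Invertible (proj₁ p) × Invertible (proj₂ p))
                                     × ((proj₁ p ⊗ proj₂ p) ≈ₘ c × GenusCond g (proj₁ p) (proj₂ p)))
    P? (u , v) = (invertible? u ×-dec invertible? v)
                 ×-dec (((u ⊗ v) ≈ₘ? c) ×-dec ((g ℕ.+ dimKer (u −I) ℕ.+ dimKer (v −I)) ℕ.≟ n))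

-- Regular elliptic elements.
-- c ∈ GL_n(F_q) is regular elliptic if there is a field L with q^n
-- elements, a field embedding ι : F_q → L, an F_q-basis b of L and
-- σ ∈ L with F_q[σ] = L, such that c is the matrix of multiplication
-- by σ in the basis b (column j = coordinates of σ · b_j).

module _ {q : ℕ} (K : FiniteField q) where
  private module K = FiniteField K
  open LinAlg K

  combL : ∀ {m n} (L : FiniteField m) → (K.Carrier → FiniteField.Carrier L)
          → Vec n → (Fin n → FiniteField.Carrier L) → FiniteField.Carrier L
  combL L ι a b = LinAlg.Σ[_] L (λ i → ι (a i) L.* b i)
    where module L = FiniteField L

  evalPoly : ∀ {m} (L : FiniteField m) → (K.Carrier → FiniteField.Carrier L)
             → List K.Carrier → FiniteField.Carrier L → FiniteField.Carrier L
  evalPoly L ι []       s = FiniteField.0# L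
  evalPoly L ι (a ∷ as) s = ι a L.+ (s L.* evalPoly L ι as s)
    where module L = FiniteField L

  record RegularElliptic (n : ℕ) (c : Mat n) : Set₁ where
    field
      L : FiniteField (q ^ n)
    private module L = FiniteField L
    field
      ι      : K.Carrier → L.Carrier
      ι-cong : ∀ {x y} → x K.≈ y → ι x L.≈ ι y
      ι-0    : ι K.0# L.≈ L.0#
      ι-1    : ι K.1# L.≈ L.1#
      ι-+    : ∀ x y → ι (x K.+ y) L.≈ (ι x L.+ ι y)
      ι-*    : ∀ x y → ι (x K.* y) L.≈ (ι x L.* ι y)
      b           : Fin n → L.Carrier
      b-indep     : ∀ a → combL L ι a b L.≈ L.0# → ∀ i → a i K.≈ K.0#
      b-span      : ∀ y → ∃ λ a → combL L ι a b L.≈ y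
      σ           : L.Carrier
      σ-generates : ∀ y → ∃ λ (p : List K.Carrier) → evalPoly L ι p σ L.≈ y
      c-matrix    : ∀ j → (σ L.* b j) L.≈ combL L ι (λ i → c i j) b

{-# OPTIONS --safe #-}
-- A factorization u v = c is determined by v, and u fixes v x exactly when v x = c x. So the task is to count
-- the v ∈ GLₙ with dim ker (v − 1) + dim ker (v − c) = n − g. Of c it only matters that c and c − 1 are injective.
-- Put a = dim ker (v − 1), b = dim ker (v − c). Such a v together with bases ws of ker (v − 1) and zs of
-- ker (v − c) and g further vectors es is the same as the tuple (zs , ws , es , v es) of n + g vectors. All
-- tuples are an upper bound. For a lower bound the vectors are chosen one at a time, each outside a few subspaces,
-- which a fixed positive proportion of all q^(n(n+g)) tuples survives. Hence about q^(n² − a² − b²) matrices v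
-- have the given a and b, up to constant factors. The sum over a + b = n − g is dominated by the middle terms,
-- which give q^(n² − (n−g)²/2), and this is q^((n+g)²/2) / q^(g²), where |GL_g| is q^(g²) up to constants.

module Submission where

open import Defs
open import Data.Nat using (ℕ; zero; suc; _+_; _*_; _^_; _∸_; _≤_; _<_; _≤?_; z≤n; s≤s; s≤s⁻¹; ⌊_/2⌋; ⌈_/2⌉; >-nonZero)
open import Data.Nat.Properties hiding (_≟_; suc-injective)
import Data.Nat.Properties as ℕₚ
open import Data.Nat.Properties using () renaming (suc-injective to suc-injectiveℕ)
open import Data.Nat.Tactic.RingSolver using (solve-∀)
open import Data.Bool using (true; false; if_then_else_)
open import Data.Unit using (⊤; tt)
open import Data.Empty using (⊥-elim)
open import Data.Fin using (Fin; zero; suc; splitAt; join; combine; remQuot; inject≤)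
open import Data.Fin.Properties using (all?; any?; suc-injective; injective⇒≤; splitAt-join; remQuot-combine; combine-remQuot; inject≤-injective; join-splitAt)
open import Data.List using (List; []; _∷_; _++_; map; concatMap; filter; length; lookup; cartesianProduct; tabulate)
open import Data.List.Properties using (length-map; length-tabulate; length-++; map-++; map-∘; filter-accept; filter-reject; length-filter; map-id; ++-assoc; ++-identityʳ)
open import Data.List.Relation.Unary.Any as Any using (Any; here; there)
open import Data.List.Relation.Unary.All as All using (All; []; _∷_)
open import Data.List.Relation.Unary.AllPairs as AllPairs using (AllPairs; []; _∷_)
open import Data.List.Relation.Binary.Pointwise as Pointwise using (Pointwise; []; _∷_)
open import Data.List.Membership.Propositional.Properties using (∈-lookup)
import Data.List.Relation.Unary.Any.Properties as Anyₚ
import Data.List.Relation.Unary.All.Properties as Allₚ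
import Data.List.Relation.Unary.AllPairs.Properties as AllPairsₚ
open import Data.Product using (∃; Σ; _×_; _,_; proj₁; proj₂)
open import Data.Sum using (_⊎_; inj₁; inj₂; [_,_])
open import Data.Vec.Functional using (Vector) renaming (_∷_ to _∷ᶠ_)
open import Function using (_∘_; id)
open import Relation.Binary.Definitions using (tri<; tri≈; tri>)
open import Relation.Binary.Structures using (IsEquivalence)
open import Relation.Binary.PropositionalEquality using (_≡_; refl; sym; trans; cong; cong₂; subst; setoid; module ≡-Reasoning)
open import Relation.Nullary using (¬_; Dec; yes; no; does)
open import Relation.Nullary.Decidable using (map′; _×-dec_; _⊎-dec_; decidable-stable)
import Algebra.Properties.Ring
import Algebra.Solver.Ring.NaturalCoefficients.Default

-- The constants may depend neither on g nor on n, so the losses of the single choices have to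
-- multiply up to a bounded factor. A choice made when k remain may therefore lose only a factor (1
-- - q⁻ᵏ)³, and ∏ (1 - q⁻ᵏ) ≥ 1/4 holds for every q ≥ 2. The case q = 2 shapes the lower bound:
-- towards the end two forbidden subspaces may both have index 2, and a union bound would leave
-- nothing. There are two remedies. Two subspaces of equal size are avoided at least as often as if
-- this were two independent events. And for the pairs (e , v e), the conditions that keep the two
-- kernels from growing forbid sets that are small once n ≥ 3 g + 3, which is the origin of n₀. A
-- matrix is built as its graph, the span of pairs (x , v x). Invertibility and the exact size of
-- both kernels then become independence of the images of generators of the graph under four linear
-- maps, a condition that can be maintained while the generators are chosen one by one. Dimensions
-- of kernels enter through their cardinalities q^dim. Since (n + g)² / 2 need not be an integer,
-- the final estimates are squared.

-- Cardinality bounds up to an equivalence relation.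

module Counting where

  -- Vectors and matrices are functions over a setoid, so sizes are compared up to `_~_`. A lower
  -- bound is a family injective up to `_~_`, an upper bound is a `Cover`, and `atLeast≤cover` turns
  -- the two into an inequality of numbers.
  record AtLeast {A : Set} (_~_ : A → A → Set) (m : ℕ) (P : A → Set) : Set where
    constructor atLeast
    field
      element    : Fin m → A
      element-∈  : ∀ i → P (element i)
      element-inj : ∀ i j → element i ~ element j → i ≡ j

  -- The representatives may lie outside `P`; thus a cover passes to any subset with its size
  -- unchanged.
  record Cover {A : Set} (_~_ : A → A → Set) (k : ℕ) (P : A → Set) : Set where
    constructor cover
    field
      element : Fin k → A
      covers  : ∀ x → P x → ∃ λ i → x ~ element i

  record Exact {A : Set} (_~_ : A → A → Set) (m : ℕ) (P : A → Set) : Set where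
    constructor exact
    field
      element     : Fin m → A
      element-∈   : ∀ i → P (element i)
      element-inj : ∀ i j → element i ~ element j → i ≡ j
      covers      : ∀ x → P x → ∃ λ i → x ~ element i

  private variable
    A B : Set
    _~_ _≋_ : A → A → Set
    P P′ : A → Set
    Q : B → Set
    k l m n : ℕ

  exact⇒atLeast : Exact _~_ m P → AtLeast _~_ m P
  exact⇒atLeast (exact f sat inj _) = atLeast f sat inj

  exact⇒cover : Exact _~_ m P → Cover _~_ m P
  exact⇒cover (exact f _ _ cov) = cover f cov

  atLeast-⊆ : (∀ x → P x → P′ x) → AtLeast _~_ m P → AtLeast _~_ m P′
  atLeast-⊆ P⊆P′ (atLeast f sat inj) = atLeast f (λ i → P⊆P′ _ (sat i)) inj

  cover-⊆ : (∀ x → P′ x → P x) → Cover _~_ k P → Cover _~_ k P′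
  cover-⊆ P′⊆P (cover f cov) = cover f λ x p → cov x (P′⊆P x p)

  atLeast-≤ : k ≤ m → AtLeast _~_ m P → AtLeast _~_ k P
  atLeast-≤ k≤m (atLeast f sat inj) =
    atLeast (λ i → f (inject≤ i k≤m)) (λ i → sat _)
    λ i j e → inject≤-injective k≤m k≤m i j (inj _ _ e)

  atLeast-map : (φ : ∀ x → P x → B) → (∀ x p → Q (φ x p)) →
    (∀ x y p p′ → φ x p ≋ φ y p′ → x ~ y) →
    AtLeast _~_ m P → AtLeast _≋_ m Q
  atLeast-map φ φ-sat φ-inj (atLeast f sat inj) =
    atLeast (λ i → φ (f i) (sat i)) (λ i → φ-sat _ _) λ i j e → inj i j (φ-inj _ _ _ _ e)

  cover-map : (φ : A → B) → (∀ {x y} → x ~ y → φ x ≋ φ y) → (∀ {x y z} → x ≋ y → y ≋ z → x ≋ z) →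
    (∀ y → Q y → ∃ λ x → P x × (y ≋ φ x)) →
    Cover _~_ k P → Cover _≋_ k Q
  cover-map φ φ-cong trans≋ onto (cover f cov) = cover (λ i → φ (f i)) λ y qy →
    let x , px , y≋φx = onto y qy
        i , x~fi = cov x px
    in i , trans≋ y≋φx (φ-cong x~fi)

  atLeast≤cover : IsEquivalence _~_ → AtLeast _~_ m P → Cover _~_ k P → m ≤ k
  atLeast≤cover eq (atLeast f sat inj) (cover g cov) =
    injective⇒≤ {f = λ i → proj₁ (cov (f i) (sat i))} λ {i} {j} e →
      inj i j (E.trans (proj₂ (cov (f i) (sat i)))
                       (E.trans (E.reflexive (cong g e)) (E.sym (proj₂ (cov (f j) (sat j))))))
    where module E = IsEquivalence eq

  module _ {A B : Set} {_~_ : A → A → Set} {_≋_ : B → B → Set} where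

    _⊗~_ : A × B → A × B → Set
    (x , y) ⊗~ (x′ , y′) = (x ~ x′) × (y ≋ y′)

    atLeast-Σ : {P : A → Set} {R : A → B → Set} →
      AtLeast _~_ m P → (∀ x → P x → AtLeast _≋_ k (R x)) →
      AtLeast _⊗~_ (m * k) (λ (x , y) → P x × R x y)
    atLeast-Σ {m = m} {k = k} {P = P} {R = R} (atLeast f sat inj) h =
      atLeast pair (λ i → sat _ , AtLeast.element-∈ (h _ _) _) pair-inj
      where
      g : Fin m → Fin k → B
      g i = AtLeast.element (h (f i) (sat i))
      pair : Fin (m * k) → A × B
      pair i = let a , b = remQuot {m} k i in f a , g a b
      g-inj : ∀ a a′ b b′ → f a ~ f a′ → g a b ≋ g a′ b′ → (a ≡ a′) × (b ≡ b′)
      g-inj a a′ b b′ e e′ with inj a a′ e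
      ... | refl = refl , AtLeast.element-inj (h _ _) b b′ e′
      pair-inj : ∀ i j → pair i ⊗~ pair j → i ≡ j
      pair-inj i j (e , e′) =
        let a , b = g-inj _ _ _ _ e e′
        in trans (sym (combine-remQuot {m} k i)) (trans (cong₂ combine a b) (combine-remQuot {m} k j))

    -- Fibres are covered over the representatives only, and these may violate `P`. That `R`
    -- respects `_~_` carries a pair over to the representative of its first component.
    cover-Σ : {P : A → Set} {R : A → B → Set} → (∀ {x y z} → x ≋ y → y ≋ z → x ≋ z) →
      (∀ {x x′ y} → x ~ x′ → R x y → R x′ y) →
      (c : Cover _~_ m P) → (∀ i → Cover _≋_ k (R (Cover.element c i))) →
      Cover _⊗~_ (m * k) (λ (x , y) → P x × R x y)
    cover-Σ {m = m} {k = k} {P = P} {R = R} trans≋ R-resp (cover f cov) h = cover pair λ (x , y) (px , rxy) →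
        let i , x~fi = cov x px
            j , y~ = Cover.covers (h i) y (R-resp x~fi rxy)
        in combine i j , subst (λ (a , b) → (x ~ f a) × (y ≋ Cover.element (h a) b)) (sym (remQuot-combine i j)) (x~fi , y~)
      where
      pair : Fin (m * k) → A × B
      pair i = let a , b = remQuot {m} k i in f a , Cover.element (h a) b

  cover-× : IsEquivalence _≋_ → Cover _~_ k P → Cover _≋_ l Q →
    Cover (_⊗~_ {_~_ = _~_} {_≋_ = _≋_}) (k * l) (λ (x , y) → P x × Q y)
  cover-× eq c d = cover-Σ (IsEquivalence.trans eq) (λ _ q → q) c (λ _ → d)

  cover-∪ : Cover _~_ k P → Cover _~_ l P′ → Cover _~_ (k + l) (λ x → P x ⊎ P′ x)
  cover-∪ {_~_ = _~_} {k = k} {P = P} {l = l} {P′ = P′} (cover f cov) (cover f′ cov′) = cover h h-cov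
    where
    h = λ i → [ f , f′ ] (splitAt k {l} i)
    at : ∀ x (s : Fin k ⊎ Fin l) → x ~ [ f , f′ ] s → ∃ λ i → x ~ h i
    at x s e = join k l s , subst (λ s → x ~ [ f , f′ ] s) (sym (splitAt-join k l s)) e
    h-cov : ∀ x → P x ⊎ P′ x → ∃ λ i → x ~ h i
    h-cov x (inj₁ p) = let i , e = cov x p in at x (inj₁ i) e
    h-cov x (inj₂ p) = let i , e = cov′ x p in at x (inj₂ i) e

  atLeast-∪ : (∀ {x y} → x ~ y → y ~ x) → (∀ x y → P x → P′ y → ¬ (x ~ y)) →
    AtLeast _~_ k P → AtLeast _~_ l P′ → AtLeast _~_ (k + l) (λ x → P x ⊎ P′ x)
  atLeast-∪ {_~_ = _~_} {P = P} {P′ = P′} {k = k} {l = l} sym~ disjoint (atLeast f sat inj) (atLeast f′ sat′ inj′) =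
    atLeast (λ i → h (splitAt k {l} i)) (λ i → h-sat (splitAt k i))
    λ i j e → trans (sym (join-splitAt k l i)) (trans (cong (join k l) (h-inj (splitAt k i) (splitAt k j) e)) (join-splitAt k l j))
    where
    h = [ f , f′ ]
    h-sat : ∀ s → P (h s) ⊎ P′ (h s)
    h-sat (inj₁ i) = inj₁ (sat i)
    h-sat (inj₂ i) = inj₂ (sat′ i)
    h-inj : ∀ s t → h s ~ h t → s ≡ t
    h-inj (inj₁ i) (inj₁ j) e = cong inj₁ (inj i j e)
    h-inj (inj₁ i) (inj₂ j) e = ⊥-elim (disjoint _ _ (sat i) (sat′ j) e)
    h-inj (inj₂ i) (inj₁ j) e = ⊥-elim (disjoint _ _ (sat j) (sat′ i) (sym~ e))
    h-inj (inj₂ i) (inj₂ j) e = cong inj₂ (inj′ i j e)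

  pointwise-isEquivalence : IsEquivalence _~_ → IsEquivalence (Pointwise _~_)
  pointwise-isEquivalence E = record
    { refl = Pointwise.refl (IsEquivalence.refl E) ; sym = Pointwise.symmetric (IsEquivalence.sym E)
    ; trans = Pointwise.transitive (IsEquivalence.trans E) }

  ⊗-isEquivalence : IsEquivalence _~_ → IsEquivalence _≋_ → IsEquivalence (_⊗~_ {_~_ = _~_} {_≋_ = _≋_})
  ⊗-isEquivalence E F = record
    { refl = IsEquivalence.refl E , IsEquivalence.refl F
    ; sym = λ (e , f) → IsEquivalence.sym E e , IsEquivalence.sym F f
    ; trans = λ (e , f) (e′ , f′) → IsEquivalence.trans E e e′ , IsEquivalence.trans F f f′ }

  exactFin-keep : {D : Fin (suc m) → Set} → D zero → Exact _≡_ k (λ i → D (suc i)) → Exact _≡_ (suc k) D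
  exactFin-keep {m = m} {k = k} {D} d0 (exact f sat inj cov) = exact g g-sat g-inj g-cov
    where
    g : Fin (suc k) → Fin (suc m)
    g zero    = zero
    g (suc i) = suc (f i)
    g-sat : ∀ i → D (g i)
    g-sat zero    = d0
    g-sat (suc i) = sat i
    g-inj : ∀ i j → g i ≡ g j → i ≡ j
    g-inj zero    zero    e = refl
    g-inj (suc i) (suc j) e = cong suc (inj i j (suc-injective e))
    g-cov : ∀ x → D x → ∃ λ i → x ≡ g i
    g-cov zero    _ = zero , refl
    g-cov (suc x) d = let i , e = cov x d in suc i , cong suc e

  exactFin-skip : {D : Fin (suc m) → Set} → ¬ D zero → Exact _≡_ k (λ i → D (suc i)) → Exact _≡_ k D
  exactFin-skip {D = D} ¬d0 (exact f sat inj cov) =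
    exact (λ i → suc (f i)) sat (λ i j e → inj i j (suc-injective e)) g-cov
    where
    g-cov : ∀ x → D x → ∃ λ i → x ≡ suc (f i)
    g-cov zero    d = ⊥-elim (¬d0 d)
    g-cov (suc x) d = let i , e = cov x d in i , cong suc e

  exactFin-split : ∀ m (D : Fin m → Set) → (∀ i → Dec (D i)) →
    ∃ λ s → ∃ λ t → (s + t ≡ m) × Exact _≡_ s D × Exact _≡_ t (λ i → ¬ D i)
  exactFin-split zero D D? =
    0 , 0 , refl , exact (λ ()) (λ ()) (λ ()) (λ ()) , exact (λ ()) (λ ()) (λ ()) (λ ())
  exactFin-split (suc m) D D? with exactFin-split m (λ i → D (suc i)) (λ i → D? (suc i)) | D? zero
  ... | s , t , e , E , E′ | yes d0 =
    suc s , t , cong suc e , exactFin-keep d0 E , exactFin-skip (λ ¬d0 → ¬d0 d0) E′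
  ... | s , t , e , E , E′ | no ¬d0 =
    s , suc t , trans (+-suc s t) (cong suc e) , exactFin-skip ¬d0 E , exactFin-keep ¬d0 E′

  exact-split : {S : A → Set} → IsEquivalence _~_ → (∀ x → Dec (S x)) → (∀ {x y} → x ~ y → S x → S y) →
    Exact _~_ m P →
    ∃ λ s → ∃ λ t → (s + t ≡ m) × Exact _~_ s (λ x → P x × S x) × Exact _~_ t (λ x → P x × ¬ S x)
  exact-split {A = A} {_~_ = _~_} {m = m} {P = P} {S = S} eq S? S-resp (exact f sat inj cov) =
    let s , t , e , E , E′ = exactFin-split m (λ i → S (f i)) (λ i → S? (f i))
    in s , t , e , compose S S-resp E , compose (λ x → ¬ S x) (λ x~y ¬sx sy → ¬sx (S-resp (E.sym x~y) sy)) E′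
    where
    module E = IsEquivalence eq
    compose : ∀ {s} (S : A → Set) → (∀ {x y} → x ~ y → S x → S y) →
      Exact _≡_ s (λ i → S (f i)) → Exact _~_ s (λ x → P x × S x)
    compose S S-resp (exact g gsat ginj gcov) =
      exact (λ i → f (g i)) (λ i → sat _ , gsat i) (λ i j e → ginj i j (inj _ _ e))
      λ x (px , sx) → let i , x~ = cov x px
                          j , i≡ = gcov i (S-resp x~ sx)
                      in j , E.trans x~ (E.reflexive (cong f i≡))

  atLeast-split : {S : A → Set} → (∀ x → Dec (S x)) → AtLeast _~_ m P →
    ∃ λ s → ∃ λ t → (s + t ≡ m) × AtLeast _~_ s (λ x → P x × S x) × AtLeast _~_ t (λ x → P x × ¬ S x)
  atLeast-split {S = S} S? (atLeast f sat inj) =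
    let s , t , e , exact g g∈ g-inj _ , exact h h∈ h-inj _ = exactFin-split _ (λ i → S (f i)) (λ i → S? (f i))
    in s , t , e ,
       atLeast (λ i → f (g i)) (λ i → sat _ , g∈ i) (λ i j e → g-inj i j (inj _ _ e)) ,
       atLeast (λ i → f (h i)) (λ i → sat _ , h∈ i) (λ i j e → h-inj i j (inj _ _ e))

  -- The part of the family inside `S` injects into the cover, so it has at most `k` members.
  atLeast-∖ : {S : A → Set} → IsEquivalence _~_ → (∀ x → Dec (S x)) → AtLeast _~_ m P → Cover _~_ k S →
    ∃ λ t → AtLeast _~_ t (λ x → P x × ¬ S x) × m ≤ t + k
  atLeast-∖ {k = k} eq S? many c =
    let s , t , s+t≡m , in-S , out-S = atLeast-split S? many
    in t , out-S , ≤-trans (≤-reflexive (trans (sym s+t≡m) (+-comm s t)))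
         (+-monoʳ-≤ t (atLeast≤cover eq (atLeast-⊆ (λ _ → proj₂) in-S) c))

  -- A count fixed in advance, because `atLeast-Σ` wants one fibre size for all base points.
  atLeast-∸ : {S : A → Set} → IsEquivalence _~_ → (∀ x → Dec (S x)) → AtLeast _~_ m P → Cover _~_ k S →
    AtLeast _~_ (m ∸ k) (λ x → P x × ¬ S x)
  atLeast-∸ {m = m} {k = k} eq S? many c = let t , good , large = atLeast-∖ eq S? many c in
    atLeast-≤ (m≤n+o⇒m∸n≤o m k (≤-trans large (≤-reflexive (+-comm t k)))) good

  lookup-injective : (∀ {x y} → x ~ y → y ~ x) → (xs : List A) → AllPairs (λ x y → ¬ (x ~ y)) xs →
    ∀ i j → lookup xs i ~ lookup xs j → i ≡ j
  lookup-injective sym~ (x ∷ xs) (px ∷ pxs) zero    zero    e = refl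
  lookup-injective sym~ (x ∷ xs) (px ∷ pxs) zero    (suc j) e = ⊥-elim (All.lookup px (∈-lookup j) e)
  lookup-injective sym~ (x ∷ xs) (px ∷ pxs) (suc i) zero    e = ⊥-elim (All.lookup px (∈-lookup i) (sym~ e))
  lookup-injective sym~ (x ∷ xs) (px ∷ pxs) (suc i) (suc j) e = cong suc (lookup-injective sym~ xs pxs i j e)

  list-atLeast : (∀ {x y} → x ~ y → y ~ x) → (xs : List A) → AllPairs (λ x y → ¬ (x ~ y)) xs →
    All P xs → AtLeast _~_ (length xs) P
  list-atLeast sym~ xs distinct sat =
    atLeast (lookup xs) (λ i → All.lookup sat (∈-lookup i)) (lookup-injective sym~ xs distinct)

  list-cover : (xs : List A) → (∀ x → P x → Any (x ~_) xs) → Cover _~_ (length xs) P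
  list-cover xs complete = cover (lookup xs) λ x px → Any.index (complete x px) , Anyₚ.lookup-index (complete x px)

  list-exact : (∀ {x y} → x ~ y → y ~ x) → (xs : List A) → AllPairs (λ x y → ¬ (x ~ y)) xs →
    All P xs → (∀ x → P x → Any (x ~_) xs) → Exact _~_ (length xs) P
  list-exact sym~ xs distinct sat complete = exact (lookup xs)
    (λ i → All.lookup sat (∈-lookup i)) (lookup-injective sym~ xs distinct)
    (λ x px → Any.index (complete x px) , Anyₚ.lookup-index (complete x px))

  allFuns-length : (xs : List A) → ∀ d → length (allFuns xs d) ≡ length xs ^ d
  allFuns-length xs zero    = refl
  allFuns-length xs (suc d) = trans (go xs) (cong (length xs *_) (allFuns-length xs d))
    where
    go : ∀ ys → length (concatMap (λ x → map (λ f → x ∷ᶠ f) (allFuns xs d)) ys) ≡ length ys * length (allFuns xs d)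
    go []       = refl
    go (y ∷ ys) = trans (length-++ (map (y ∷ᶠ_) (allFuns xs d)))
                        (cong₂ _+_ (length-map _ (allFuns xs d)) (go ys))

  allFuns-complete : (xs : List A) → (∀ x → P x → Any (x ~_) xs) →
    ∀ d (f : Vector A d) → (∀ i → P (f i)) → Any (λ g → ∀ i → f i ~ g i) (allFuns xs d)
  allFuns-complete xs complete zero    f Pf = here λ ()
  allFuns-complete {P = P} xs complete (suc d) f Pf =
    Anyₚ.concatMap⁺ _ (Any.map (λ e → Anyₚ.map⁺ (Any.map (λ es → λ { zero → e ; (suc i) → es i })
      (allFuns-complete xs complete d (λ i → f (suc i)) (λ i → Pf (suc i))))) (complete (f zero) (Pf zero)))

  allFuns-sat : (xs : List A) → All P xs → ∀ d → All (λ f → ∀ i → P (f i)) (allFuns xs d)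
  allFuns-sat xs Pxs zero    = (λ ()) ∷ []
  allFuns-sat {P = P} xs Pxs (suc d) = Allₚ.concat⁺ (Allₚ.map⁺ (All.map
    (λ {x} Px → Allₚ.map⁺ (All.map (λ Pf → λ { zero → Px ; (suc i) → Pf i }) (allFuns-sat xs Pxs d))) Pxs))

  allFuns-distinct : (xs : List A) → AllPairs (λ x y → ¬ (x ~ y)) xs →
    ∀ d → AllPairs (λ f g → ¬ (∀ i → f i ~ g i)) (allFuns xs d)
  allFuns-distinct xs distinct zero    = [] ∷ []
  allFuns-distinct {A = A} {_~_ = _~_} xs distinct (suc d) = go xs distinct
    where
    rest = allFuns xs d
    go : ∀ ys → AllPairs (λ x y → ¬ (x ~ y)) ys →
      AllPairs (λ f g → ¬ (∀ i → f i ~ g i)) (concatMap (λ x → map (λ f → x ∷ᶠ f) rest) ys)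
    go [] [] = []
    go (y ∷ ys) (py ∷ pys) = AllPairsₚ.++⁺
      (AllPairsₚ.map⁺ (AllPairs.map (λ f≉g e → f≉g (λ i → e (suc i))) (allFuns-distinct xs distinct d)))
      (go ys pys)
      (Allₚ.map⁺ (All.universal (λ f → Allₚ.concat⁺ (Allₚ.map⁺ (All.map
        (λ y≁z → Allₚ.map⁺ (All.universal (λ g e → y≁z (e zero)) rest)) py))) rest))

  filter-complete : {D : A → Set} (D? : ∀ x → Dec (D x)) {xs : List A} → (∀ {x y} → x ~ y → D x → D y) →
    ∀ {x} → D x → Any (x ~_) xs → Any (x ~_) (filter D? xs)
  filter-complete D? {y ∷ xs} resp Dx (here e) with D? y
  ... | yes _  = here e
  ... | no ¬Dy = ⊥-elim (¬Dy (resp e Dx))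
  filter-complete D? {y ∷ xs} resp Dx (there a) with D? y
  ... | yes _ = there (filter-complete D? resp Dx a)
  ... | no _  = filter-complete D? resp Dx a

  cartesianProduct-distinct : (xs : List A) (ys : List B) →
    AllPairs (λ x y → ¬ (x ~ y)) xs → AllPairs (λ x y → ¬ (x ≋ y)) ys →
    AllPairs (λ p p′ → ¬ ((proj₁ p ~ proj₁ p′) × (proj₂ p ≋ proj₂ p′))) (cartesianProduct xs ys)
  cartesianProduct-distinct [] ys [] dys = []
  cartesianProduct-distinct (x ∷ xs) ys (px ∷ dxs) dys = AllPairsₚ.++⁺
    (AllPairsₚ.map⁺ (AllPairs.map (λ y≉ e → y≉ (proj₂ e)) dys))
    (cartesianProduct-distinct xs ys dxs dys)
    (Allₚ.map⁺ (All.universal (λ y → Allₚ.cartesianProduct⁺ (setoid _) (setoid _) xs ys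
       (λ x∈ _ e → All.lookup px x∈ (proj₁ e))) ys))

  cover-lists : Cover _~_ k P → ∀ d → Cover (Pointwise _~_) (k ^ d) (λ xs → length xs ≡ d × All P xs)
  cover-lists c zero = cover (λ _ → []) λ { [] _ → zero , [] }
  cover-lists {_~_ = _~_} {k = k} {P = P} c@(cover f cov) (suc d) = cover h h-cov
    where
    g = Cover.element (cover-lists c d)
    h : Fin (k * k ^ d) → List _
    h i = let a , b = remQuot {k} (k ^ d) i in f a ∷ g b
    h-cov : ∀ xs → length xs ≡ suc d × All P xs → ∃ λ i → Pointwise _~_ xs (h i)
    h-cov (x ∷ xs) (e , px ∷ pxs) =
      let i , x~ = cov x px
          j , xs~ = Cover.covers (cover-lists c d) xs (suc-injectiveℕ e , pxs)
      in combine i j , subst (λ (a , b) → Pointwise _~_ (x ∷ xs) (f a ∷ g b)) (sym (remQuot-combine i j)) (x~ ∷ xs~)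

  sumTo : (ℕ → ℕ) → ℕ → ℕ
  sumTo f zero    = f zero
  sumTo f (suc s) = sumTo f s + f (suc s)

  sumTo-mono : ∀ {f g} s → (∀ a → f a ≤ g a) → sumTo f s ≤ sumTo g s
  sumTo-mono zero    f≤g = f≤g zero
  sumTo-mono (suc s) f≤g = +-mono-≤ (sumTo-mono s f≤g) (f≤g (suc s))

  sumTo-strict : ∀ {f g} s a → a ≤ s → (∀ a → f a ≤ g a) → f a < g a → sumTo f s < sumTo g s
  sumTo-strict zero    zero z≤n f≤g lt = lt
  sumTo-strict (suc s) a a≤ f≤g lt with m≤n⇒m<n∨m≡n a≤
  ... | inj₁ (s≤s a≤s) = +-mono-<-≤ (sumTo-strict s a a≤s f≤g lt) (f≤g (suc s))
  ... | inj₂ refl      = +-mono-≤-< (sumTo-mono s f≤g) lt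

  sumTo-shift : ∀ f s → sumTo f (suc s) ≡ f 0 + sumTo (f ∘ suc) s
  sumTo-shift f zero    = refl
  sumTo-shift f (suc s) = trans (cong (_+ f (suc (suc s))) (sumTo-shift f s)) (+-assoc (f 0) _ _)

  sumTo-* : ∀ f c s → sumTo (λ a → f a * c) s ≡ sumTo f s * c
  sumTo-* f c zero    = refl
  sumTo-* f c (suc s) = trans (cong (_+ f (suc s) * c) (sumTo-* f c s)) (sym (*-distribʳ-+ c (sumTo f s) (f (suc s))))

  withKey : (A → ℕ) → ℕ → List A → List A
  withKey key a = filter (λ x → key x ℕₚ.≟ a)

  length-by-key : (key : A → ℕ) → ∀ {s} (xs : List A) → All (λ x → key x ≤ s) xs →
    length xs ≤ sumTo (λ a → length (withKey key a xs)) s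
  length-by-key key [] [] = z≤n
  length-by-key key {s} (x ∷ xs) (x≤s ∷ xs≤s) =
    ≤-<-trans (length-by-key key xs xs≤s) (sumTo-strict s (key x) x≤s weak strict)
    where
    weak : ∀ a → length (withKey key a xs) ≤ length (withKey key a (x ∷ xs))
    weak a with key x ℕₚ.≟ a
    ... | yes e = ≤-trans (n≤1+n _) (≤-reflexive (sym (cong length (filter-accept (λ x → key x ℕₚ.≟ a) e))))
    ... | no ¬e = ≤-reflexive (sym (cong length (filter-reject (λ x → key x ℕₚ.≟ a) ¬e)))
    strict : length (withKey key (key x) xs) < length (withKey key (key x) (x ∷ xs))
    strict = ≤-reflexive (sym (cong length (filter-accept (λ y → key y ℕₚ.≟ key x) refl)))

open Counting

-- Abstract because unification would otherwise unfold 64³ into a unary numeral.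
abstract
  loss : ℕ
  loss = 64 * 64 * 64

  loss>0 : 0 < loss
  loss>0 = s≤s z≤n

  loss-* : ∀ x → 64 * 64 * 64 * x ≡ loss * x
  loss-* x = refl

square-^ : ∀ x k → (x * x) ^ k ≡ x ^ k * x ^ k
square-^ x zero    = refl
square-^ x (suc k) = trans (cong (x * x *_) (square-^ x k)) (eq x (x ^ k))
  where
  eq : ∀ x y → x * x * (y * y) ≡ x * y * (x * y)
  eq = solve-∀

-- Products of 1 - q⁻ᵏ, counting by successive choices, and the sum over a + b = s.

module Sequences {q : ℕ} (2≤q : 2 ≤ q) where

  pow⁻ : ℕ → ℕ
  pow⁻ k = q ^ k ∸ 1

  q^>0 : ∀ k → 0 < q ^ k
  q^>0 k = m^n>0 q {{>-nonZero (≤-trans (s≤s z≤n) 2≤q)}} k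

  suc-pow⁻ : ∀ k → suc (pow⁻ k) ≡ q ^ k
  suc-pow⁻ k = m+[n∸m]≡n (q^>0 k)

  2^≤q^ : ∀ k → 2 ^ k ≤ q ^ k
  2^≤q^ k = ^-monoˡ-≤ k 2≤q

  1≤pow⁻ : ∀ k → 1 ≤ pow⁻ (suc k)
  1≤pow⁻ k = s≤s⁻¹ (≤-trans (≤-trans (*-monoʳ-≤ 2 (m^n>0 2 k)) (2^≤q^ (suc k))) (≤-reflexive (sym (suc-pow⁻ (suc k)))))

  ∏q^ ∏pow⁻ : ℕ → ℕ
  ∏q^ zero    = 1
  ∏q^ (suc k) = q ^ suc k * ∏q^ k
  ∏pow⁻ zero    = 1
  ∏pow⁻ (suc k) = pow⁻ (suc k) * ∏pow⁻ k

  ∏q^>0 : ∀ k → 0 < ∏q^ k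
  ∏q^>0 zero    = s≤s z≤n
  ∏q^>0 (suc k) = *-mono-< (q^>0 (suc k)) (∏q^>0 k)

  -- ∏ (1 − q⁻ʲ) over 1 ≤ j ≤ k + 1 is at least 1/4 + 2^(−k−2).
  ∏-bound : ∀ k → ∏q^ (suc k) * (2 ^ suc k + 2) ≤ 2 ^ (3 + k) * ∏pow⁻ (suc k)
  ∏-bound zero = begin
    q ^ 1 * 1 * 4         ≡⟨ cong (λ x → x * 1 * 4) (sym (suc-pow⁻ 1)) ⟩
    suc (pow⁻ 1) * 1 * 4  ≡⟨ eq₁ (pow⁻ 1) ⟩
    4 + 4 * pow⁻ 1        ≤⟨ +-monoˡ-≤ _ (*-monoʳ-≤ 4 (1≤pow⁻ 0)) ⟩
    4 * pow⁻ 1 + 4 * pow⁻ 1 ≡⟨ eq₂ (pow⁻ 1) ⟩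
    8 * (pow⁻ 1 * 1)      ∎
    where
    open ≤-Reasoning
    eq₁ : ∀ x → suc x * 1 * 4 ≡ 4 + 4 * x
    eq₁ = solve-∀
    eq₂ : ∀ x → 4 * x + 4 * x ≡ 8 * (x * 1)
    eq₂ = solve-∀
  ∏-bound (suc k) = begin
    q ^ (2 + k) * a * (2 * p + 2)      ≡⟨ cong (λ x → x * a * (2 * p + 2)) (sym (suc-pow⁻ (2 + k))) ⟩
    suc r * a * (2 * p + 2)            ≡⟨ eq₁ r a p ⟩
    a * (2 * p * r + 2 * r + (2 * p + 2)) ≤⟨ *-monoʳ-≤ a (+-monoʳ-≤ (2 * p * r + 2 * r) 2p+2≤2r) ⟩
    a * (2 * p * r + 2 * r + 2 * r)    ≡⟨ eq₂ r a p ⟩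
    2 * r * (a * (p + 2))              ≤⟨ *-monoʳ-≤ (2 * r) (∏-bound k) ⟩
    2 * r * (2 ^ (3 + k) * b)          ≡⟨ eq₃ r (2 ^ (3 + k)) b ⟩
    2 * 2 ^ (3 + k) * (r * b)          ∎
    where
    open ≤-Reasoning
    r = pow⁻ (2 + k)
    p = 2 ^ suc k
    a = ∏q^ (suc k)
    b = ∏pow⁻ (suc k)
    eq₁ : ∀ r a p → suc r * a * (2 * p + 2) ≡ a * (2 * p * r + 2 * r + (2 * p + 2))
    eq₁ = solve-∀
    eq₂ : ∀ r a p → a * (2 * p * r + 2 * r + 2 * r) ≡ 2 * r * (a * (p + 2))
    eq₂ = solve-∀
    eq₃ : ∀ r x b → 2 * r * (x * b) ≡ 2 * x * (r * b)
    eq₃ = solve-∀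
    eq₄ : ∀ p → 2 * p + 4 ≡ (2 * p + 2) + 2
    eq₄ = solve-∀
    4≤2p : 4 ≤ 2 * p
    4≤2p = *-monoʳ-≤ 2 (*-monoʳ-≤ 2 (m^n>0 2 k))
    2p+2≤2r : 2 * p + 2 ≤ 2 * r
    2p+2≤2r = +-cancelʳ-≤ 2 _ _ (begin
      2 * p + 2 + 2  ≡⟨ sym (eq₄ p) ⟩
      2 * p + 4      ≤⟨ +-monoʳ-≤ (2 * p) 4≤2p ⟩
      2 * p + 2 * p  ≡⟨ sym (*-distribˡ-+ 2 p p) ⟩
      2 * (p + p)    ≡⟨ cong (λ x → 2 * (p + x)) (sym (+-identityʳ p)) ⟩
      2 * 2 ^ (2 + k) ≤⟨ *-monoʳ-≤ 2 (2^≤q^ (2 + k)) ⟩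
      2 * q ^ (2 + k) ≡⟨ cong (2 *_) (sym (suc-pow⁻ (2 + k))) ⟩
      2 * suc r      ≡⟨ *-distribˡ-+ 2 1 r ⟩
      2 + 2 * r      ≡⟨ +-comm 2 (2 * r) ⟩
      2 * r + 2      ∎)

  -- The bound 1/4 alone is not inductive, hence the extra term in `∏-bound`; here it is dropped and
  -- the powers of 2 cancel.
  ∏q^≤4∏pow⁻ : ∀ k → ∏q^ k ≤ 4 * ∏pow⁻ k
  ∏q^≤4∏pow⁻ zero    = s≤s z≤n
  ∏q^≤4∏pow⁻ (suc k) = *-cancelˡ-≤ (2 ^ suc k) {{>-nonZero (m^n>0 2 (suc k))}} (begin
    2 ^ suc k * ∏q^ (suc k)        ≡⟨ *-comm (2 ^ suc k) _ ⟩
    ∏q^ (suc k) * 2 ^ suc k        ≤⟨ *-monoʳ-≤ (∏q^ (suc k)) (m≤m+n _ 2) ⟩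
    ∏q^ (suc k) * (2 ^ suc k + 2)  ≤⟨ ∏-bound k ⟩
    2 ^ (3 + k) * ∏pow⁻ (suc k)    ≡⟨ eq (2 ^ k) _ ⟩
    2 ^ suc k * (4 * ∏pow⁻ (suc k)) ∎)
    where
    open ≤-Reasoning
    eq : ∀ x b → 2 * (2 * (2 * x)) * b ≡ 2 * x * (4 * b)
    eq = solve-∀

  cube : ℕ → ℕ
  cube x = x * x * x

  cube-mono : ∀ {x y} → x ≤ y → cube x ≤ cube y
  cube-mono x≤y = *-mono-≤ (*-mono-≤ x≤y x≤y) x≤y

  -- Division rounded up, together with its minimality: an integer that satisfies the real lower
  -- bound x / (y + 1) is at least `c`, so rounding up loses nothing.
  ⌈_÷_⌉ : ∀ x y → ∃ λ c → x ≤ c * suc y × (∀ t → x ≤ t * suc y → c ≤ t)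
  ⌈ zero ÷ y ⌉ = 0 , z≤n , λ _ _ → z≤n
  ⌈ suc x ÷ y ⌉ with ⌈ x ÷ y ⌉
  ... | c , x≤ , least with suc x ≤? c * suc y
  ...   | yes sx≤ = c , sx≤ , λ t sx≤t → least t (≤-trans (n≤1+n x) sx≤t)
  ...   | no ¬sx≤ = suc c , s≤s (≤-trans x≤ (m≤n+m _ y)) ,
                    λ t sx≤t → *-cancelʳ-< (suc y) c t (<-≤-trans (s≤s (s≤s⁻¹ (≰⇒> ¬sx≤))) sx≤t)

  -- A 64th of `M ^ d`, rounded up so that it stays positive. Here 64 = 4³, the cube of the factor
  -- in `∏q^≤4∏pow⁻`, and 63 is its predecessor.
  share : ℕ → ℕ → ℕ
  share M d = proj₁ ⌈ M ^ d ÷ 63 ⌉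

  share-large : ∀ M d → M ^ d ≤ share M d * 64
  share-large M d = proj₁ (proj₂ ⌈ M ^ d ÷ 63 ⌉)

  share>0 : ∀ {M} d → 0 < M → 0 < share M d
  share>0 {M} d 0<M with share M d | share-large M d
  ... | zero  | h = ⊥-elim (<⇒≱ (m^n>0 M {{>-nonZero 0<M}} d) h)
  ... | suc _ | _ = s≤s z≤n

  module _ {A : Set} {_~_ : A → A → Set} where

    -- `t` is at least M (1 - q⁻ᵏ)³. The exponent 3 fits the most demanding choice, that of a pair
    -- in `pair-step`: one factor for its argument and two for its value. The other choices lose
    -- less and are weakened to this form.
    ManyOf : ℕ → ℕ → (A → Set) → Set
    ManyOf M k P = ∃ λ t → AtLeast _~_ t P × M * cube (pow⁻ k) ≤ t * cube (q ^ k)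

    -- If a fraction (1 − q⁻ᵏ)³ of M choices is admissible whenever k choices remain, then at least 1/64 of
    -- the Mᵈ sequences are, because ∏ (1 − q⁻ᵏ) ≥ 1/4.
    module _ {M d : ℕ} (G : List A → Set) (start : G [])
      (step : ∀ xs k → G xs → suc k + length xs ≡ d → ManyOf M (suc k) (λ x → G (x ∷ xs))) where

      -- Of the product of (1 - q⁻ʲ)³ over j ≤ d, exactly the factors with j > k have been spent
      -- after `i` choices. The inequality is this quotient cleared of denominators.
      prefixes : ∀ i k → i + k ≡ d → ∃ λ T → AtLeast (Pointwise _~_) T (λ xs → length xs ≡ i × G xs) ×
        M ^ i * cube (∏pow⁻ d) * cube (∏q^ k) ≤ T * cube (∏q^ d) * cube (∏pow⁻ k)
      prefixes zero k refl = 1 , atLeast (λ _ → []) (λ _ → refl , start) (λ { zero zero _ → refl }) ,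
        ≤-reflexive (eq (cube (∏pow⁻ d)) (cube (∏q^ d)))
        where
        eq : ∀ x y → 1 * x * y ≡ 1 * y * x
        eq = solve-∀
      prefixes (suc i) k e =
        let T , many , bound = prefixes i (suc k) (trans (+-suc i k) e)
            -- Different prefixes may admit different numbers of continuations. `c` is the least
            -- number that the required proportion allows, so every prefix has at least `c`.
            c , c-large , c-least = ⌈ M * cube (pow⁻ (suc k)) ÷ (cube (q ^ suc k) ∸ 1) ⌉
            next : ∀ xs → length xs ≡ i × G xs → AtLeast _~_ c (λ x → G (x ∷ xs))
            next = λ { xs (lxs , gxs) →
              let t , t-many , t-bound = step xs k gxs (trans (cong (λ l → suc (k + l)) lxs) (trans (+-comm (suc k) i) (trans (+-suc i k) e)))
              in atLeast-≤ (c-least t (≤-trans t-bound (≤-reflexive (cong (t *_) (sym Q-suc))))) t-many }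
        in T * c ,
           atLeast-map (λ (xs , x) _ → x ∷ xs) (λ { (xs , x) ((lxs , _) , gx) → cong suc lxs , gx })
             (λ { _ _ _ _ (e ∷ es) → es , e }) (atLeast-Σ many next) ,
           arith (M ^ i) T c (cube (∏pow⁻ d)) (cube (∏q^ d)) (∏q^ k) (∏pow⁻ k) (q ^ suc k) (pow⁻ (suc k)) (q^>0 (suc k)) (1≤pow⁻ k)
             bound (≤-trans c-large (≤-reflexive (cong (c *_) Q-suc)))
        where
        Q-suc : suc (cube (q ^ suc k) ∸ 1) ≡ cube (q ^ suc k)
        Q-suc = m+[n∸m]≡n (*-mono-< (*-mono-< (q^>0 (suc k)) (q^>0 (suc k))) (q^>0 (suc k)))
        arith : ∀ Mi T c B A a b Q p → 0 < Q → 0 < p →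
          Mi * B * cube (Q * a) ≤ T * A * cube (p * b) → M * cube p ≤ c * cube Q →
          M * Mi * B * cube a ≤ T * c * A * cube b
        arith Mi T c B A a b Q p 0<Q 0<p h₁ h₂ = *-cancelʳ-≤ _ _ (cube Q * cube p)
          {{>-nonZero (*-mono-< (*-mono-< (*-mono-< 0<Q 0<Q) 0<Q) (*-mono-< (*-mono-< 0<p 0<p) 0<p))}} (begin
            M * Mi * B * cube a * (cube Q * cube p) ≡⟨ eq₁ M Mi B a Q p ⟩
            (Mi * B * cube (Q * a)) * (M * cube p)  ≤⟨ *-mono-≤ h₁ h₂ ⟩
            (T * A * cube (p * b)) * (c * cube Q)   ≡⟨ eq₂ T c A b Q p ⟩
            T * c * A * cube b * (cube Q * cube p)  ∎)
          where
          open ≤-Reasoning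
          eq₁ : ∀ M Mi B a Q p → M * Mi * B * (a * a * a) * (Q * Q * Q * (p * p * p)) ≡
                (Mi * B * (Q * a * (Q * a) * (Q * a))) * (M * (p * p * p))
          eq₁ = solve-∀
          eq₂ : ∀ T c A b Q p → (T * A * (p * b * (p * b) * (p * b))) * (c * (Q * Q * Q)) ≡
                T * c * A * (b * b * b) * (Q * Q * Q * (p * p * p))
          eq₂ = solve-∀

      sequences : AtLeast (Pointwise _~_) (share M d) (λ xs → length xs ≡ d × G xs)
      sequences = let T , many , bound = prefixes d 0 (+-identityʳ d) in
        atLeast-≤ (proj₂ (proj₂ ⌈ M ^ d ÷ 63 ⌉) T (*-cancelʳ-≤ _ _ (cube (∏q^ d))
            {{>-nonZero (*-mono-< (*-mono-< (∏q^>0 d) (∏q^>0 d)) (∏q^>0 d))}} (begin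
          M ^ d * cube (∏q^ d)             ≤⟨ *-monoʳ-≤ (M ^ d) (cube-mono (∏q^≤4∏pow⁻ d)) ⟩
          M ^ d * cube (4 * ∏pow⁻ d)       ≡⟨ eq₁ (M ^ d) (∏pow⁻ d) ⟩
          64 * (M ^ d * cube (∏pow⁻ d) * cube 1)  ≤⟨ *-monoʳ-≤ 64 bound ⟩
          64 * (T * cube (∏q^ d) * cube 1) ≡⟨ eq₂ T (cube (∏q^ d)) ⟩
          T * 64 * cube (∏q^ d)            ∎))) many
        where
        open ≤-Reasoning
        eq₁ : ∀ x b → x * (4 * b * (4 * b) * (4 * b)) ≡ 64 * (x * (b * b * b) * (1 * 1 * 1))
        eq₁ = solve-∀
        eq₂ : ∀ T x → 64 * (T * x * (1 * 1 * 1)) ≡ T * 64 * x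
        eq₂ = solve-∀

  -- Sizes of complements: S = qᵐ is the size of a subspace of a space of N = qⁿ points with k + m ≤ n.

  fraction¹ : ∀ {N S t} k → q ^ k * S ≤ N → N ≤ t + S → N * pow⁻ k ≤ t * q ^ k
  fraction¹ {N} {S} {t} k QS≤N N≤t+S = +-cancelʳ-≤ N _ _ (begin
    N * pow⁻ k + N      ≡⟨ eq N (pow⁻ k) ⟩
    N * suc (pow⁻ k)    ≡⟨ cong (N *_) (suc-pow⁻ k) ⟩
    N * q ^ k           ≤⟨ *-monoˡ-≤ (q ^ k) N≤t+S ⟩
    (t + S) * q ^ k     ≡⟨ *-distribʳ-+ (q ^ k) t S ⟩
    t * q ^ k + S * q ^ k ≡⟨ cong (t * q ^ k +_) (*-comm S (q ^ k)) ⟩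
    t * q ^ k + q ^ k * S ≤⟨ +-monoʳ-≤ (t * q ^ k) QS≤N ⟩
    t * q ^ k + N       ∎)
    where
    open ≤-Reasoning
    eq : ∀ N p → N * p + N ≡ N * suc p
    eq = solve-∀

  pow⁻≤q^ : ∀ k → pow⁻ k ≤ q ^ k
  pow⁻≤q^ k = m∸n≤m (q ^ k) 1

  fraction¹⇒³ : ∀ {N t} k → N * pow⁻ k ≤ t * q ^ k → N * cube (pow⁻ k) ≤ t * cube (q ^ k)
  fraction¹⇒³ {N} {t} k h = begin
    N * cube p          ≡⟨ eq N p ⟩
    N * p * (p * p)     ≤⟨ *-mono-≤ h (*-mono-≤ (pow⁻≤q^ k) (pow⁻≤q^ k)) ⟩
    t * Q * (Q * Q)     ≡⟨ sym (eq t Q) ⟩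
    t * cube Q          ∎
    where
    open ≤-Reasoning
    p = pow⁻ k
    Q = q ^ k
    eq : ∀ N p → N * (p * p * p) ≡ N * p * (p * p)
    eq = solve-∀

  fraction²⇒³ : ∀ {N t} k → N * (pow⁻ k * pow⁻ k) ≤ t * (q ^ k * q ^ k) → N * cube (pow⁻ k) ≤ t * cube (q ^ k)
  fraction²⇒³ {N} {t} k h = begin
    N * cube p          ≡⟨ sym (*-assoc N (p * p) p) ⟩
    N * (p * p) * p     ≤⟨ *-mono-≤ h (pow⁻≤q^ k) ⟩
    t * (Q * Q) * Q     ≡⟨ *-assoc t (Q * Q) Q ⟩
    t * cube Q          ∎
    where
    open ≤-Reasoning
    p = pow⁻ k
    Q = q ^ k

  -- The last hypothesis is (N - S)² ≤ t N, and N - S ≥ N (1 - 1/Q) with Q = qᵏ. In the proof `A` is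
  -- (N - S) Q, written without subtracting `S`.
  fraction² : ∀ {N S t} k → 0 < N → q ^ k * S ≤ N → N * N + S * S ≤ t * N + 2 * S * N →
    N * (pow⁻ k * pow⁻ k) ≤ t * (q ^ k * q ^ k)
  fraction² {N} {S} {t} k 0<N QS≤N h = *-cancelˡ-≤ N {{>-nonZero 0<N}} (+-cancelʳ-≤ (2 * B * (A + B)) _ _ (begin
      N * (N * (p * p)) + 2 * B * (A + B)       ≤⟨ +-monoˡ-≤ (2 * B * (A + B)) (≤-trans (≤-reflexive (eq₁ N p)) (*-mono-≤ Np≤A Np≤A)) ⟩
      A * A + 2 * B * (A + B)                   ≡⟨ eq₂ A B ⟩
      (A + B) * (A + B) + B * B                 ≡⟨ cong (λ x → x * x + B * B) A+B≡NQ ⟩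
      N * Q * (N * Q) + S * Q * (S * Q)         ≡⟨ eq₃ N S Q ⟩
      (N * N + S * S) * (Q * Q)                 ≤⟨ *-monoˡ-≤ (Q * Q) h ⟩
      (t * N + 2 * S * N) * (Q * Q)             ≡⟨ eq₄ t N S Q ⟩
      N * (t * (Q * Q)) + 2 * (S * Q) * (N * Q) ≡⟨ cong (λ x → N * (t * (Q * Q)) + 2 * (S * Q) * x) (sym A+B≡NQ) ⟩
      N * (t * (Q * Q)) + 2 * B * (A + B)       ∎))
    where
    open ≤-Reasoning
    Q = q ^ k
    p = pow⁻ k
    e = N ∸ Q * S
    A = N * p + e
    B = S * Q
    Np≤A : N * p ≤ A
    Np≤A = m≤m+n _ e
    A+B≡NQ : A + B ≡ N * Q
    A+B≡NQ = ≡R.begin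
      N * p + e + S * Q    ≡R.≡⟨ cong (N * p + e +_) (*-comm S Q) ⟩
      N * p + e + Q * S    ≡R.≡⟨ +-assoc (N * p) e (Q * S) ⟩
      N * p + (e + Q * S)  ≡R.≡⟨ cong (N * p +_) (m∸n+n≡m QS≤N) ⟩
      N * p + N            ≡R.≡⟨ eq₅ N p ⟩
      N * suc p            ≡R.≡⟨ cong (N *_) (suc-pow⁻ k) ⟩
      N * Q                ≡R.∎
      where module ≡R = ≡-Reasoning
            eq₅ : ∀ N p → N * p + N ≡ N * suc p
            eq₅ = solve-∀
    eq₁ : ∀ N p → N * (N * (p * p)) ≡ N * p * (N * p)
    eq₁ = solve-∀
    eq₂ : ∀ A B → A * A + 2 * B * (A + B) ≡ (A + B) * (A + B) + B * B
    eq₂ = solve-∀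
    eq₃ : ∀ N S Q → N * Q * (N * Q) + S * Q * (S * Q) ≡ (N * N + S * S) * (Q * Q)
    eq₃ = solve-∀
    eq₄ : ∀ t N S Q → (t * N + 2 * S * N) * (Q * Q) ≡ N * (t * (Q * Q)) + 2 * (S * Q) * (N * Q)
    eq₄ = solve-∀

  -- 1 - 1/Q - 1/Q² ≥ (1 - 1/Q)² as soon as Q ≥ 2. So beside a subspace of relative size 1/Q,
  -- further forbidden sets of relative size 1/Q² in total cost only one more factor.
  fraction²-slack : ∀ {N S R t} k → 1 ≤ pow⁻ k → q ^ k * S ≤ N → R * (q ^ k * q ^ k) ≤ N → N ≤ t + (S + R) →
    N * (pow⁻ k * pow⁻ k) ≤ t * (q ^ k * q ^ k)
  fraction²-slack {N} {S} {R} {t} k 1≤p QS≤N RQQ≤N h = +-cancelʳ-≤ (N * (2 * p + 1)) _ _ (begin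
    N * (p * p) + N * (2 * p + 1)         ≡⟨ eq₁ N p ⟩
    N * (suc p * suc p)                   ≡⟨ cong (λ x → N * (x * x)) (suc-pow⁻ k) ⟩
    N * (Q * Q)                           ≤⟨ *-monoˡ-≤ (Q * Q) h ⟩
    (t + (S + R)) * (Q * Q)               ≡⟨ eq₂ t S R Q ⟩
    t * (Q * Q) + (Q * S * Q + R * (Q * Q)) ≤⟨ +-monoʳ-≤ (t * (Q * Q)) (+-mono-≤ (*-monoˡ-≤ Q QS≤N) RQQ≤N) ⟩
    t * (Q * Q) + (N * Q + N)             ≡⟨ cong (λ x → t * (Q * Q) + (N * x + N)) (sym (suc-pow⁻ k)) ⟩
    t * (Q * Q) + (N * suc p + N)         ≡⟨ eq₃ (t * (Q * Q)) N p ⟩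
    t * (Q * Q) + N * (p + 1 + 1)         ≤⟨ +-monoʳ-≤ (t * (Q * Q)) (*-monoʳ-≤ N (+-monoˡ-≤ 1 (+-monoʳ-≤ p 1≤p))) ⟩
    t * (Q * Q) + N * (p + p + 1)         ≡⟨ cong (λ x → t * (Q * Q) + N * (p + x + 1)) (sym (+-identityʳ p)) ⟩
    t * (Q * Q) + N * (2 * p + 1)         ∎)
    where
    open ≤-Reasoning
    Q = q ^ k
    p = pow⁻ k
    eq₁ : ∀ N p → N * (p * p) + N * (2 * p + 1) ≡ N * (suc p * suc p)
    eq₁ = solve-∀
    eq₂ : ∀ t S R Q → (t + (S + R)) * (Q * Q) ≡ t * (Q * Q) + (Q * S * Q + R * (Q * Q))
    eq₂ = solve-∀
    eq₃ : ∀ x N p → x + (N * suc p + N) ≡ x + N * (p + 1 + 1)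
    eq₃ = solve-∀

  -- minSq s is the least value of a² + b² subject to a + b = s.
  minSq : ℕ → ℕ
  minSq zero          = 0
  minSq (suc zero)    = 1
  minSq (suc (suc s)) = minSq s + (s + s + 2)

  minSq≤sq : ∀ s → minSq s ≤ s * s
  minSq≤sq zero          = z≤n
  minSq≤sq (suc zero)    = ≤-refl
  minSq≤sq (suc (suc s)) = ≤-trans (+-monoˡ-≤ (s + s + 2) (minSq≤sq s)) (≤-trans (m≤m+n _ (s + s + 2)) (≤-reflexive (eq s)))
    where
    eq : ∀ s → s * s + (s + s + 2) + (s + s + 2) ≡ suc (suc s) * suc (suc s)
    eq = solve-∀

  sq≤2minSq : ∀ s → s * s ≤ minSq s + minSq s
  sq≤2minSq zero          = z≤n
  sq≤2minSq (suc zero)    = s≤s z≤n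
  sq≤2minSq (suc (suc s)) = ≤-trans (≤-reflexive (eq₁ s))
      (≤-trans (+-monoˡ-≤ (s + s + 2 + (s + s + 2)) (sq≤2minSq s)) (≤-reflexive (eq₂ (minSq s) s)))
    where
    eq₁ : ∀ s → suc (suc s) * suc (suc s) ≡ s * s + (s + s + 2 + (s + s + 2))
    eq₁ = solve-∀
    eq₂ : ∀ m s → m + m + (s + s + 2 + (s + s + 2)) ≡ m + (s + s + 2) + (m + (s + s + 2))
    eq₂ = solve-∀

  -- With `sq≤2minSq` this says that `minSq s` is s² / 2 rounded up. For odd s the rounding costs a
  -- factor q after squaring.
  2minSq≤sq+1 : ∀ s → minSq s + minSq s ≤ s * s + 1
  2minSq≤sq+1 zero          = z≤n
  2minSq≤sq+1 (suc zero)    = ≤-refl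
  2minSq≤sq+1 (suc (suc s)) = ≤-trans (≤-reflexive (eq₂ (minSq s) s))
      (≤-trans (+-monoˡ-≤ (s + s + 2 + (s + s + 2)) (2minSq≤sq+1 s)) (≤-reflexive (eq₁ s)))
    where
    eq₁ : ∀ s → s * s + 1 + (s + s + 2 + (s + s + 2)) ≡ suc (suc s) * suc (suc s) + 1
    eq₁ = solve-∀
    eq₂ : ∀ m s → m + (s + s + 2) + (m + (s + s + 2)) ≡ m + m + (s + s + 2 + (s + s + 2))
    eq₂ = solve-∀

  minSq-halves : ∀ s → ⌈ s /2⌉ * ⌈ s /2⌉ + ⌊ s /2⌋ * ⌊ s /2⌋ ≡ minSq s
  minSq-halves zero          = refl
  minSq-halves (suc zero)    = refl
  minSq-halves (suc (suc s)) = trans (eq ⌈ s /2⌉ ⌊ s /2⌋)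
      (cong₂ (λ x y → x + (y + y + 2)) (minSq-halves s) (trans (+-comm ⌈ s /2⌉ ⌊ s /2⌋) (⌊n/2⌋+⌈n/2⌉≡n s)))
    where
    eq : ∀ a b → suc a * suc a + suc b * suc b ≡ a * a + b * b + (a + b + (a + b) + 2)
    eq = solve-∀

  -- The terms q^(−a²−b²), a + b = s, decay geometrically away from the middle. Passing from s to s + 2 shifts the
  -- old range and adds the two end terms, which are at most D / 2^(s+2) after scaling.
  geometric-sum : ∀ s D Y → (∀ a b → a + b ≡ s → Y a * q ^ (a * a + b * b) ≤ D) →
    2 ^ s * (q ^ minSq s * sumTo Y s) + 4 * D ≤ 2 ^ s * (6 * D)
  geometric-sum zero D Y h = begin
    1 * (1 * Y 0) + 4 * D ≡⟨ cong (_+ 4 * D) (eq₁ (Y 0)) ⟩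
    Y 0 * 1 + 4 * D       ≤⟨ +-monoˡ-≤ (4 * D) (h 0 0 refl) ⟩
    D + 4 * D             ≤⟨ m≤m+n _ D ⟩
    D + 4 * D + D         ≡⟨ eq₂ D ⟩
    1 * (6 * D)           ∎
    where
    open ≤-Reasoning
    eq₁ : ∀ y → 1 * (1 * y) ≡ y * 1
    eq₁ = solve-∀
    eq₂ : ∀ D → D + 4 * D + D ≡ 1 * (6 * D)
    eq₂ = solve-∀
  geometric-sum (suc zero) D Y h = begin
    2 * (q ^ 1 * (Y 0 + Y 1)) + 4 * D            ≡⟨ eq₁ (Y 0) (Y 1) (q ^ 1) D ⟩
    2 * (Y 0 * q ^ 1 + Y 1 * q ^ 1) + 4 * D      ≤⟨ +-monoˡ-≤ (4 * D) (*-monoʳ-≤ 2 (+-mono-≤ (h 0 1 refl) (h 1 0 refl))) ⟩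
    2 * (D + D) + 4 * D                          ≤⟨ m≤m+n _ (4 * D) ⟩
    2 * (D + D) + 4 * D + 4 * D                  ≡⟨ eq₂ D ⟩
    2 * (6 * D)                                  ∎
    where
    open ≤-Reasoning
    eq₁ : ∀ x y Q D → 2 * (Q * (x + y)) + 4 * D ≡ 2 * (x * Q + y * Q) + 4 * D
    eq₁ = solve-∀
    eq₂ : ∀ D → 2 * (D + D) + 4 * D + 4 * D ≡ 2 * (6 * D)
    eq₂ = solve-∀
  geometric-sum (suc (suc s)) D Y h = begin
    2 ^ (2 + s) * (q ^ minSq (2 + s) * sumTo Y (2 + s)) + 4 * D
      ≡⟨ cong₂ (λ x y → 2 ^ (2 + s) * (x * y) + 4 * D) (^-distribˡ-+-* q (minSq s) (s + s + 2)) (cong (_+ Y (2 + s)) (sumTo-shift Y s)) ⟩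
    2 * (2 * P) * (M * R * (Y 0 + inner + Y (2 + s))) + 4 * D
      ≡⟨ eq₁ P M R (Y 0) inner (Y (2 + s)) D ⟩
    4 * (P * (M * (inner * R))) + (Y 0 * (2 * (2 * P) * (M * R)) + Y (2 + s) * (2 * (2 * P) * (M * R)) + 4 * D)
      ≤⟨ +-monoʳ-≤ (4 * (P * (M * (inner * R)))) (+-monoˡ-≤ (4 * D) (+-mono-≤
           (≤-trans (*-monoʳ-≤ (Y 0) (end ((2 + s) * (2 + s)) ≤-refl)) (h 0 (2 + s) refl))
           (≤-trans (*-monoʳ-≤ (Y (2 + s)) (end ((2 + s) * (2 + s) + 0) (m≤m+n _ 0))) (h (2 + s) 0 (+-identityʳ _))))) ⟩
    4 * (P * (M * (inner * R))) + (D + D + 4 * D)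
      -- The induction hypothesis leaves `4 * D`, which becomes `16 * D` here; the two end terms and
      -- the new `4 * D` take up only `6 * D` of it.
      ≤⟨ m≤m+n _ (10 * D) ⟩
    4 * (P * (M * (inner * R))) + (D + D + 4 * D) + 10 * D
      ≡⟨ eq₂ (P * (M * (inner * R))) D ⟩
    4 * (P * (M * (inner * R)) + 4 * D)
      ≡⟨ cong (λ x → 4 * (P * (M * x) + 4 * D)) (sym (sumTo-* (Y ∘ suc) R s)) ⟩
    4 * (P * (M * sumTo Y′ s) + 4 * D)
      ≤⟨ *-monoʳ-≤ 4 (geometric-sum s D Y′ h′) ⟩
    4 * (P * (6 * D))
      ≡⟨ eq₃ P D ⟩
    2 * (2 * P) * (6 * D) ∎
    where
    open ≤-Reasoning
    P = 2 ^ s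
    M = q ^ minSq s
    R = q ^ (s + s + 2)
    inner = sumTo (Y ∘ suc) s
    -- Raising both a and b by one raises a² + b² by 2 s + 2; the factor `R` absorbs this power.
    Y′ = λ a → Y (suc a) * R
    h′ : ∀ a b → a + b ≡ s → Y′ a * q ^ (a * a + b * b) ≤ D
    h′ a b refl = ≤-trans (≤-reflexive (trans (*-assoc (Y (suc a)) R _) (cong (Y (suc a) *_)
        (trans (sym (^-distribˡ-+-* q (a + b + (a + b) + 2) _)) (cong (q ^_) (eq a b))))))
      (h (suc a) (suc b) (cong suc (+-suc a b)))
      where
      eq : ∀ a b → a + b + (a + b) + 2 + (a * a + b * b) ≡ suc a * suc a + suc b * suc b
      eq = solve-∀
    end : ∀ e → (2 + s) * (2 + s) ≤ e → 2 * (2 * P) * (M * R) ≤ q ^ e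
    end e le = begin
      2 ^ (2 + s) * (M * R)                  ≤⟨ *-monoˡ-≤ (M * R) (2^≤q^ (2 + s)) ⟩
      q ^ (2 + s) * (M * R)                  ≡⟨ cong (q ^ (2 + s) *_) (sym (^-distribˡ-+-* q (minSq s) (s + s + 2))) ⟩
      q ^ (2 + s) * q ^ (minSq s + (s + s + 2)) ≡⟨ sym (^-distribˡ-+-* q (2 + s) _) ⟩
      q ^ (2 + s + (minSq s + (s + s + 2)))  ≤⟨ ^-monoʳ-≤ q {{>-nonZero (≤-trans (s≤s z≤n) 2≤q)}}
          (≤-trans (+-monoʳ-≤ (2 + s) (+-monoˡ-≤ (s + s + 2) (minSq≤sq s)))
            (≤-trans (m≤m+n _ s) (≤-trans (≤-reflexive (eq s)) le))) ⟩
      q ^ e                                  ∎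
      where
      eq : ∀ s → 2 + s + (s * s + (s + s + 2)) + s ≡ (2 + s) * (2 + s)
      eq = solve-∀
    eq₁ : ∀ P M R x y z D → 2 * (2 * P) * (M * R * (x + y + z)) + 4 * D ≡
          4 * (P * (M * (y * R))) + (x * (2 * (2 * P) * (M * R)) + z * (2 * (2 * P) * (M * R)) + 4 * D)
    eq₁ = solve-∀
    eq₂ : ∀ x D → 4 * x + (D + D + 4 * D) + 10 * D ≡ 4 * (x + 4 * D)
    eq₂ = solve-∀
    eq₃ : ∀ P D → 4 * (P * (6 * D)) ≡ 2 * (2 * P) * (6 * D)
    eq₃ = solve-∀

  sum-bound : ∀ s D Y → (∀ a b → a + b ≡ s → Y a * q ^ (a * a + b * b) ≤ D) → q ^ minSq s * sumTo Y s ≤ 6 * D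
  sum-bound s D Y h = *-cancelˡ-≤ (2 ^ s) {{>-nonZero (m^n>0 2 s)}} (≤-trans (m≤m+n _ (4 * D)) (geometric-sum s D Y h))

-- Spans and independent lists over a finite field, and their cardinalities.

module Spans {q : ℕ} (K : FiniteField q) where

  private module K = FiniteField K
  open K using (Carrier; _≈_; 0#; 1#) renaming (_+_ to _⊕_; _*_ to _⊛_; -_ to ⊖_; _≟_ to _≟ᴷ_)
  module Kₚ = Algebra.Properties.Ring K.ring
  module Solver = Algebra.Solver.Ring.NaturalCoefficients.Default K.commutativeSemiring
  open Solver using (solve; _:+_; _:*_; _:=_)

  exactK : Exact _≈_ q (λ _ → ⊤)
  exactK = subst (λ m → Exact _≈_ m (λ _ → ⊤)) K.size
    (list-exact K.sym K.elems K.distinct (All.universal (λ _ → tt) K.elems) (λ x _ → K.complete x))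

  2≤q : 2 ≤ q
  2≤q = atLeast≤cover K.isEquivalence (atLeast two (λ _ → tt) two-inj) (exact⇒cover exactK)
    where
    two : Fin 2 → Carrier
    two zero    = 0#
    two (suc _) = 1#
    two-inj : ∀ i j → two i ≈ two j → i ≡ j
    two-inj zero       zero       e = refl
    two-inj zero       (suc zero) e = ⊥-elim (K.0≉1 e)
    two-inj (suc zero) zero       e = ⊥-elim (K.0≉1 (K.sym e))
    two-inj (suc zero) (suc zero) e = refl

  open Sequences 2≤q public

  infix 4 _≈̇_
  infixl 6 _+̇_
  infixl 7 _•_
  _≈̇_ : {I : Set} → (I → Carrier) → (I → Carrier) → Set
  x ≈̇ y = ∀ i → x i ≈ y i

  ≈̇-isEquivalence : {I : Set} → IsEquivalence (_≈̇_ {I})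
  ≈̇-isEquivalence = record
    { refl = λ i → K.refl ; sym = λ e i → K.sym (e i) ; trans = λ e e′ i → K.trans (e i) (e′ i) }

  module ≈̇ {I : Set} = IsEquivalence (≈̇-isEquivalence {I})

  _+̇_ : {I : Set} → (I → Carrier) → (I → Carrier) → I → Carrier
  (x +̇ y) i = x i ⊕ y i
  _•_ : {I : Set} → Carrier → (I → Carrier) → I → Carrier
  (α • x) i = α ⊛ x i
  0̇ : {I : Set} → I → Carrier
  0̇ _ = 0#

  neg : {I : Set} → (I → Carrier) → I → Carrier
  neg x = (⊖ 1#) • x

  -1*x : ∀ x → (⊖ 1#) ⊛ x ≈ ⊖ x
  -1*x = Kₚ.-1*x≈-x

  x-x : ∀ x → x ⊕ (⊖ 1#) ⊛ x ≈ 0#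
  x-x x = K.trans (K.+-congˡ (-1*x x)) (K.-‿inverseʳ x)

  difference≈0 : ∀ x y → x ⊕ (⊖ 1#) ⊛ y ≈ 0# → x ≈ y
  difference≈0 x y e = Kₚ.x∙y⁻¹≈ε⇒x≈y x y (K.trans (K.+-congˡ (K.sym (-1*x y))) e)

  difference+ : ∀ x y → (x ⊕ (⊖ 1#) ⊛ y) ⊕ y ≈ x
  difference+ x y = K.trans (K.+-assoc _ _ _) (K.trans (K.+-congˡ (K.trans (K.+-comm _ _) (x-x y))) (K.+-identityʳ x))

  +difference : ∀ x y → (x ⊕ y) ⊕ (⊖ 1#) ⊛ y ≈ x
  +difference x y = K.trans (K.+-assoc _ _ _) (K.trans (K.+-congˡ (x-x y)) (K.+-identityʳ x))

  record Linear {I J : Set} (φ : (I → Carrier) → J → Carrier) : Set where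
    field
      cong-≈ : ∀ {x y} → x ≈̇ y → φ x ≈̇ φ y
      +-homo : ∀ x y → φ (x +̇ y) ≈̇ φ x +̇ φ y
      •-homo : ∀ α x → φ (α • x) ≈̇ α • φ x
    0-homo : φ 0̇ ≈̇ 0̇
    0-homo i = K.trans (cong-≈ {y = 0# • 0̇} (λ _ → K.sym (K.zeroˡ _)) i) (K.trans (•-homo 0# 0̇ i) (K.zeroˡ _))

  private variable
    I J : Set

  -- The index type is arbitrary, so that the same theory serves vectors (over `Fin n`) and points
  -- of graphs (over `Fin n ⊎ Fin n`).
  Span : List (I → Carrier) → (I → Carrier) → Set
  Span []       x = x ≈̇ 0̇
  Span (y ∷ ys) x = ∃ λ α → ∃ λ z → Span ys z × x ≈̇ α • y +̇ z

  -- Each vector lies outside the span of those after it. This is the form in which successive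
  -- choices at the head of the list produce independence.
  Indep : List (I → Carrier) → Set
  Indep []       = ⊤
  Indep (y ∷ ys) = ¬ Span ys y × Indep ys

  span-resp : (ys : List (I → Carrier)) {x x′ : I → Carrier} → x ≈̇ x′ → Span ys x → Span ys x′
  span-resp []       e s = ≈̇.trans (≈̇.sym e) s
  span-resp (y ∷ ys) e (α , z , s , e′) = α , z , s , ≈̇.trans (≈̇.sym e) e′

  span-0 : (ys : List (I → Carrier)) → Span ys 0̇
  span-0 []       = ≈̇.refl
  span-0 (y ∷ ys) = 0# , 0̇ , span-0 ys , λ i → K.sym (K.trans (K.+-identityʳ _) (K.zeroˡ _))

  span-+ : (ys : List (I → Carrier)) {x x′ : I → Carrier} → Span ys x → Span ys x′ → Span ys (x +̇ x′)
  span-+ []       e e′ i = K.trans (K.+-cong (e i) (e′ i)) (K.+-identityʳ _)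
  span-+ (y ∷ ys) (α , z , s , e) (α′ , z′ , s′ , e′) = α ⊕ α′ , z +̇ z′ , span-+ ys s s′ ,
    λ i → K.trans (K.+-cong (e i) (e′ i))
      (solve 5 (λ a a′ y z z′ → (a :* y :+ z) :+ (a′ :* y :+ z′) := (a :+ a′) :* y :+ (z :+ z′)) K.refl _ _ _ _ _)

  span-• : (ys : List (I → Carrier)) (β : Carrier) {x : I → Carrier} → Span ys x → Span ys (β • x)
  span-• []       β e i = K.trans (K.*-congˡ (e i)) (K.zeroʳ β)
  span-• (y ∷ ys) β (α , z , s , e) = β ⊛ α , β • z , span-• ys β s ,
    λ i → K.trans (K.*-congˡ (e i)) (solve 4 (λ b a y z → b :* (a :* y :+ z) := (b :* a) :* y :+ b :* z) K.refl _ _ _ _)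

  span-head : ∀ (y : I → Carrier) ys → Span (y ∷ ys) y
  span-head y ys = 1# , 0̇ , span-0 ys , λ i → K.sym (K.trans (K.+-identityʳ _) (K.*-identityˡ _))

  span-∷ : ∀ (y : I → Carrier) ys {x} → Span ys x → Span (y ∷ ys) x
  span-∷ y ys {x} s = 0# , x , s , λ i → K.sym (K.trans (K.+-congʳ (K.zeroˡ _)) (K.+-identityˡ _))

  span-members : (ys : List (I → Carrier)) → All (Span ys) ys
  span-members []       = []
  span-members (y ∷ ys) = span-head y ys ∷ All.map (span-∷ y ys) (span-members ys)

  span-++ʳ : ∀ (xs ys : List (I → Carrier)) {x} → Span ys x → Span (xs ++ ys) x
  span-++ʳ []       ys s = s
  span-++ʳ (x ∷ xs) ys s = span-∷ x (xs ++ ys) (span-++ʳ xs ys s)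

  span-++⁻ : ∀ (xs ys : List (I → Carrier)) {x} → Span (xs ++ ys) x →
    ∃ λ h → ∃ λ k → Span xs h × Span ys k × x ≈̇ h +̇ k
  span-++⁻ []       ys {x} s = 0̇ , x , ≈̇.refl , s , λ i → K.sym (K.+-identityˡ _)
  span-++⁻ (y ∷ xs) ys (α , z , s , e) =
    let h , k , sh , sk , e′ = span-++⁻ xs ys s
    in α • y +̇ h , k , (α , h , sh , ≈̇.refl) , sk ,
       λ i → K.trans (e i) (K.trans (K.+-congˡ (e′ i)) (K.sym (K.+-assoc _ _ _)))

  span-++⁺ˡ : ∀ (xs ys : List (I → Carrier)) {x} → Span xs x → Span (xs ++ ys) x
  span-++⁺ˡ []       ys e = span-resp ys (≈̇.sym e) (span-0 ys)
  span-++⁺ˡ (y ∷ xs) ys (α , z , s , e) = α , z , span-++⁺ˡ xs ys s , e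

  indep-++ʳ : ∀ (xs ys : List (I → Carrier)) → Indep (xs ++ ys) → Indep ys
  indep-++ʳ []       ys ind = ind
  indep-++ʳ (x ∷ xs) ys (_ , ind) = indep-++ʳ xs ys ind

  indep-++ˡ : ∀ (xs ys : List (I → Carrier)) → Indep (xs ++ ys) → Indep xs
  indep-++ˡ []       ys ind = tt
  indep-++ˡ (x ∷ xs) ys (¬s , ind) = (λ s → ¬s (span-++⁺ˡ xs ys s)) , indep-++ˡ xs ys ind

  indep-++-disjoint : ∀ (xs ys : List (I → Carrier)) → Indep (xs ++ ys) →
    ∀ {x} → Span xs x → Span ys x → x ≈̇ 0̇

  -- A nonzero α could be inverted, and y = - α⁻¹ z would lie in the span.
  cancel-coefficient : ∀ {y : I → Carrier} {ys} → ¬ Span ys y → ∀ α {z} → Span ys z → α • y +̇ z ≈̇ 0̇ → α ≈ 0#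
  cancel-coefficient {y = y} {ys} ¬s α {z} s e with α ≟ᴷ 0#
  ... | yes α≈0 = α≈0
  ... | no α≉0 = ⊥-elim (¬s (span-resp ys y≈ (span-• ys (⊖ β) s)))
    where
    β = proj₁ (K.inverse α α≉0)
    y≈ : (⊖ β) • z ≈̇ y
    y≈ i = begin
      (⊖ β) ⊛ z i                          ≈⟨ K.sym (K.+-identityʳ _) ⟩
      (⊖ β) ⊛ z i ⊕ 0#                     ≈⟨ K.+-congˡ (K.sym (K.trans (K.*-congˡ (e i)) (K.zeroʳ β))) ⟩
      (⊖ β) ⊛ z i ⊕ β ⊛ (α ⊛ y i ⊕ z i)    ≈⟨ solve 5 (λ c b a y z → c :* z :+ b :* (a :* y :+ z) := (a :* b) :* y :+ (b :+ c) :* z) K.refl (⊖ β) β α (y i) (z i) ⟩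
      (α ⊛ β) ⊛ y i ⊕ (β ⊕ ⊖ β) ⊛ z i      ≈⟨ K.+-cong (K.*-congʳ (proj₂ (K.inverse α α≉0))) (K.*-congʳ (K.-‿inverseʳ β)) ⟩
      1# ⊛ y i ⊕ 0# ⊛ z i                  ≈⟨ K.+-cong (K.*-identityˡ _) (K.zeroˡ _) ⟩
      y i ⊕ 0#                             ≈⟨ K.+-identityʳ _ ⟩
      y i                                  ∎
      where open import Relation.Binary.Reasoning.Setoid K.setoid

  indep-++-disjoint []       ys ind s t = s
  indep-++-disjoint (y ∷ xs) ys (¬s , ind) {x} (α , z , sz , e) t =
    ≈̇.trans x≈z (indep-++-disjoint xs ys ind sz (span-resp ys x≈z t))
    where
    α≈0 : α ≈ 0#
    α≈0 = cancel-coefficient ¬s α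
      (span-+ (xs ++ ys) (span-++⁺ˡ xs ys sz) (span-++ʳ xs ys (span-• ys (⊖ 1#) t)))
      λ i → K.trans (K.sym (K.+-assoc _ _ _)) (K.trans (K.+-congʳ (K.sym (e i))) (x-x (x i)))
    x≈z : x ≈̇ z
    x≈z i = K.trans (e i) (K.trans (K.+-congʳ (K.trans (K.*-congʳ α≈0) (K.zeroˡ _))) (K.+-identityˡ _))

  module _ {I J : Set} {φ : (I → Carrier) → J → Carrier} (lin : Linear φ) where
    private module φ = Linear lin

    span-map : ∀ ys {x} → Span ys x → Span (map φ ys) (φ x)
    span-map []       e = ≈̇.trans (φ.cong-≈ e) φ.0-homo
    span-map (y ∷ ys) (α , z , s , e) = α , φ z , span-map ys s ,
      λ i → K.trans (φ.cong-≈ e i) (K.trans (φ.+-homo _ _ i) (K.+-congʳ (φ.•-homo α y i)))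

    span-map⁻ : ∀ ys {x} → Span (map φ ys) x → ∃ λ z → Span ys z × x ≈̇ φ z
    span-map⁻ []       e = 0̇ , ≈̇.refl , ≈̇.trans e (≈̇.sym φ.0-homo)
    span-map⁻ (y ∷ ys) (α , z , s , e) =
      let w , sw , e′ = span-map⁻ ys s
      in α • y +̇ w , (α , w , sw , ≈̇.refl) ,
         λ i → K.trans (e i) (K.trans (K.+-cong (K.sym (φ.•-homo α y i)) (e′ i)) (K.sym (φ.+-homo _ _ i)))

    -- If φ kills a combination, the coefficient of the head vanishes because its image is outside
    -- the span of the other images; then induct on the tail.
    indep-map⇒injective : ∀ ys → Indep (map φ ys) → ∀ {x} → Span ys x → φ x ≈̇ 0̇ → x ≈̇ 0̇
    indep-map⇒injective []       ind s _ = s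
    indep-map⇒injective (y ∷ ys) (¬s , ind) {x} (α , z , s , e) φx≈0 =
      ≈̇.trans x≈z (indep-map⇒injective ys ind s (≈̇.trans (φ.cong-≈ (≈̇.sym x≈z)) φx≈0))
      where
      α≈0 : α ≈ 0#
      α≈0 = cancel-coefficient ¬s α (span-map ys s) λ i →
        K.trans (K.sym (K.trans (φ.+-homo _ _ i) (K.+-congʳ (φ.•-homo α y i))))
                (K.trans (φ.cong-≈ (≈̇.sym e) i) (φx≈0 i))
      x≈z : x ≈̇ z
      x≈z i = K.trans (e i) (K.trans (K.+-congʳ (K.trans (K.*-congʳ α≈0) (K.zeroˡ _))) (K.+-identityˡ _))

    indep-map : (∀ x → φ x ≈̇ 0̇ → x ≈̇ 0̇) → ∀ ys → Indep ys → Indep (map φ ys)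
    indep-map inj []       ind = tt
    indep-map inj (y ∷ ys) (¬s , ind) =
      (λ s → let z , sz , e = span-map⁻ ys s
             in ¬s (span-resp ys (λ i → K.sym (difference≈0 _ _ (inj (y +̇ neg z) (λ j →
                  K.trans (φ.+-homo _ _ j) (K.trans (K.+-cong (e j) (φ.•-homo _ z j)) (x-x _))) i))) sz)) ,
      indep-map inj ys ind

  linear-agree : {φ ψ : (I → Carrier) → J → Carrier} → Linear φ → Linear ψ →
    ∀ ys → All (λ y → φ y ≈̇ ψ y) ys → ∀ {x} → Span ys x → φ x ≈̇ ψ x
  linear-agree lin lin′ [] [] e =
    ≈̇.trans (≈̇.trans (Linear.cong-≈ lin e) (Linear.0-homo lin)) (≈̇.sym (≈̇.trans (Linear.cong-≈ lin′ e) (Linear.0-homo lin′)))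
  linear-agree {φ = φ} {ψ} lin lin′ (y ∷ ys) (φy≈ψy ∷ agree) (α , z , s , e) i =
    K.trans (expand lin) (K.trans (K.+-cong (K.*-congˡ (φy≈ψy i)) (linear-agree lin lin′ ys agree s i)) (K.sym (expand lin′)))
    where
    expand : ∀ {χ} → Linear χ → χ _ i ≈ α ⊛ χ y i ⊕ χ z i
    expand lin = K.trans (Linear.cong-≈ lin e i) (K.trans (Linear.+-homo lin _ _ i) (K.+-congʳ (Linear.•-homo lin α y i)))

  span-cover : (ys : List (I → Carrier)) → Cover _≈̇_ (q ^ length ys) (Span ys)
  span-cover []       = cover (λ _ → 0̇) λ x e → zero , e
  span-cover (y ∷ ys) = cover-map (λ (α , z) → α • y +̇ z)
    (λ (e , e′) i → K.+-cong (K.*-congʳ e) (e′ i)) ≈̇.trans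
    (λ x (α , z , s , e) → (α , z) , (tt , s) , e)
    (cover-Σ ≈̇.trans (λ _ s → s) (exact⇒cover exactK) (λ _ → span-cover ys))

  span-atLeast : (ys : List (I → Carrier)) → Indep ys → AtLeast _≈̇_ (q ^ length ys) (Span ys)
  span-atLeast []       ind = atLeast (λ _ → 0̇) (λ _ → ≈̇.refl) λ { zero zero _ → refl }
  span-atLeast (y ∷ ys) (¬s , ind) = atLeast-map (λ (α , z) _ → α • y +̇ z)
    (λ (α , z) (_ , s) → α , z , s , ≈̇.refl)
    (λ (α , z) (β , w) (_ , s) (_ , t) e →
      let e′ : (α ⊕ ⊖ β) • y +̇ (z +̇ neg w) ≈̇ 0̇
          e′ i = begin
            (α ⊕ ⊖ β) ⊛ y i ⊕ (z i ⊕ (⊖ 1#) ⊛ w i)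
              ≈⟨ K.+-congʳ (K.*-congʳ (K.+-congˡ (K.sym (-1*x β)))) ⟩
            (α ⊕ (⊖ 1#) ⊛ β) ⊛ y i ⊕ (z i ⊕ (⊖ 1#) ⊛ w i)
              ≈⟨ solve 6 (λ c a b y z w → (a :+ c :* b) :* y :+ (z :+ c :* w) := (a :* y :+ z) :+ c :* (b :* y :+ w)) K.refl (⊖ 1#) α β (y i) (z i) (w i) ⟩
            (α ⊛ y i ⊕ z i) ⊕ (⊖ 1#) ⊛ (β ⊛ y i ⊕ w i)
              ≈⟨ K.+-congʳ (e i) ⟩
            (β ⊛ y i ⊕ w i) ⊕ (⊖ 1#) ⊛ (β ⊛ y i ⊕ w i)
              ≈⟨ x-x _ ⟩
            0# ∎
          α≈β : α ≈ β
          α≈β = Kₚ.x∙y⁻¹≈ε⇒x≈y _ _ (cancel-coefficient ¬s _ (span-+ ys s (span-• ys _ t)) e′)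
      in α≈β , λ i → difference≈0 _ _ (begin
            z i ⊕ (⊖ 1#) ⊛ w i  ≈⟨ K.sym (K.trans (K.+-congʳ (K.trans (K.*-congʳ (K.trans (K.+-congʳ α≈β) (K.-‿inverseʳ β))) (K.zeroˡ _))) (K.+-identityˡ _)) ⟩
            (α ⊕ ⊖ β) ⊛ y i ⊕ (z i ⊕ (⊖ 1#) ⊛ w i) ≈⟨ e′ i ⟩
            0# ∎))
    (atLeast-Σ (exact⇒atLeast exactK) (λ _ _ → span-atLeast ys ind))
    where open import Relation.Binary.Reasoning.Setoid K.setoid

  module _ {n : ℕ} where

    exactV : Exact _≈̇_ (q ^ n) (λ (_ : Fin n → Carrier) → ⊤)
    exactV = subst (λ m → Exact _≈̇_ m (λ _ → ⊤))
      (trans (allFuns-length K.elems n) (cong (_^ n) K.size))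
      (list-exact ≈̇.sym (allFuns K.elems n) (allFuns-distinct K.elems K.distinct n) (All.universal (λ _ → tt) _)
        (λ x _ → allFuns-complete {P = λ _ → ⊤} K.elems (λ x _ → K.complete x) n x (λ _ → tt)))

    -- Decided by trying every coefficient of the head. Counting the complement of a span relies on
    -- this.
    span? : (ys : List (Fin n → Carrier)) → ∀ x → Dec (Span ys x)
    span? []       x = all? (λ i → x i ≟ᴷ 0#)
    span? (y ∷ ys) x = map′
      (λ (i , s) → κ i , x +̇ neg (κ i • y) , s , λ j → K.sym (K.trans (K.+-comm _ _) (difference+ (x j) (κ i ⊛ y j))))
      (λ (α , z , s , e) → let i , α≈ = Exact.covers exactK α tt in i , span-resp ys
        (λ j → K.sym (K.trans (K.+-congˡ (K.*-congˡ (K.*-congʳ (K.sym α≈))))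
          (K.trans (K.+-congʳ (K.trans (e j) (K.+-comm _ _))) (+difference (z j) _)))) s)
      (any? (λ i → span? ys (x +̇ neg (κ i • y))))
      where κ = Exact.element exactK

    -- By counting: a vector outside would give n + 1 independent ones, whose span has more than q ^
    -- n elements.
    full-span : (ys : List (Fin n → Carrier)) → Indep ys → length ys ≡ n → ∀ x → Span ys x
    full-span ys ind len x with span? ys x
    ... | yes s = s
    ... | no ¬s = ⊥-elim (<⇒≱ (*-monoˡ-< (q ^ length ys) {{>-nonZero (q^>0 (length ys))}} {1} {q} 2≤q)
            (≤-trans (atLeast≤cover ≈̇-isEquivalence (atLeast-⊆ (λ _ _ → tt) (span-atLeast (x ∷ ys) (¬s , ind))) (exact⇒cover exactV))
                     (≤-reflexive (trans (cong (q ^_) (sym len)) (sym (*-identityˡ _))))))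

    -- The fibres of the subtraction P × Q → V are translates of P ∩ Q, so |P||Q| ≤ |V||P ∩ Q|; this makes
    -- the events x ∉ P and x ∉ Q positively correlated.
    module _ (xs ys : List (Fin n → Carrier)) {m : ℕ} (indˣ : Indep xs) (indʸ : Indep ys)
      (lenˣ : length xs ≡ m) (lenʸ : length ys ≡ m) where

      private
        P = Span xs
        Q = Span ys

        Pair : Set
        Pair = (Fin n → Carrier) × (Fin n → Carrier)

        _≈²_ : Pair → Pair → Set
        _≈²_ = _⊗~_ {_~_ = _≈̇_} {_≋_ = _≈̇_}

        ≈²-isEquivalence : IsEquivalence _≈²_
        ≈²-isEquivalence = record
          { refl = ≈̇.refl , ≈̇.refl
          ; sym = λ (e , e′) → ≈̇.sym e , ≈̇.sym e′
          ; trans = λ (e , e′) (f , f′) → ≈̇.trans e f , ≈̇.trans e′ f′ }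

        size : ∀ {p} (zs : List (Fin n → Carrier)) → Indep zs → length zs ≡ m →
          Exact _≈̇_ p (λ x → ⊤ × Span zs x) → p ≡ q ^ m
        size zs ind len E = trans (≤-antisym
          (atLeast≤cover ≈̇-isEquivalence (exact⇒atLeast E) (cover-⊆ (λ _ → proj₂) (span-cover zs)))
          (atLeast≤cover ≈̇-isEquivalence (span-atLeast zs ind) (cover-⊆ (λ _ s → tt , s) (exact⇒cover E))))
          (cong (q ^_) len)

        fibre : ∀ {p r i} → Exact _≈̇_ p (λ x → ⊤ × P x) → Exact _≈̇_ r (λ x → ⊤ × Q x) →
          Cover _≈̇_ i (λ x → P x × Q x) → ∀ z →
          Cover _≈²_ i (λ (x , y) → (P x × Q y) × z ≈̇ x +̇ neg y)
        fibre {i = i} (exact g g∈ _ g-cov) (exact h h∈ _ h-cov) c z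
          -- A search decides whether `z` is a difference at all. If not, its fibre is empty and any
          -- `i` pairs cover it. If it is, every solution arises from the one found by adding the
          -- same d ∈ P ∩ Q to both components.
          with any? (λ a → any? (λ b → all? (λ j → z j ≟ᴷ (g a +̇ neg (h b)) j)))
        ... | no ¬e = cover (λ _ → 0̇ , 0̇) λ (x , y) ((px , qy) , e) →
          let a , x≈ = g-cov x (tt , px)
              b , y≈ = h-cov y (tt , qy)
          in ⊥-elim (¬e (a , b , λ j → K.trans (e j) (K.+-cong (x≈ j) (K.*-congˡ (y≈ j)))))
        ... | yes (a , b , e₀) = cover-map (λ d → g a +̇ d , h b +̇ d)
          (λ e → (λ j → K.+-congˡ (e j)) , (λ j → K.+-congˡ (e j)))
          (IsEquivalence.trans ≈²-isEquivalence)
          (λ (x , y) ((px , qy) , e) →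
            let d = x +̇ neg (g a)
                d≈ : d ≈̇ y +̇ neg (h b)
                d≈ j = K.trans
                  (K.+-congʳ (K.trans (K.sym (difference+ (x j) (y j))) (K.+-congʳ (K.trans (K.sym (e j)) (e₀ j)))))
                  (K.trans (solve 4 (λ c u v w → ((u :+ c :* v) :+ w) :+ c :* u := (w :+ c :* v) :+ (u :+ c :* u)) K.refl (⊖ 1#) (g a j) (h b j) (y j))
                           (K.trans (K.+-congˡ (x-x _)) (K.+-identityʳ _)))
            in d , (span-+ xs px (span-• xs _ (proj₂ (g∈ a))) ,
                    span-resp ys (≈̇.sym d≈) (span-+ ys qy (span-• ys _ (proj₂ (h∈ b))))) ,
               (λ j → K.sym (K.trans (K.+-comm _ _) (difference+ (x j) (g a j)))) ,
               (λ j → K.sym (K.trans (K.+-congˡ (d≈ j)) (K.trans (K.+-comm _ _) (difference+ (y j) (h b j))))))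
          c

      outside-both : ∃ λ t → AtLeast _≈̇_ t (λ x → ¬ P x × ¬ Q x) ×
        q ^ n * q ^ n + q ^ m * q ^ m ≤ t * q ^ n + 2 * q ^ m * q ^ n
      outside-both =
        let p , _ , p+p′≡ , Eᴾ , E⁻ᴾ = exact-split ≈̇-isEquivalence (span? xs) (span-resp xs) exactV
            r , _ , _ , Eᵠ , _ = exact-split ≈̇-isEquivalence (span? ys) (span-resp ys) exactV
            i , _ , _ , Eᴾᵠ , _ = exact-split ≈̇-isEquivalence (span? ys) (span-resp ys) Eᴾ
            s , t , s+t≡ , E⁻ᴾᵠ , Eᵗ = exact-split ≈̇-isEquivalence (span? ys) (span-resp ys) E⁻ᴾ
            p≡ = size xs indˣ lenˣ Eᴾ
            r≡ = size ys indʸ lenʸ Eᵠ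
            i+s≤r = atLeast≤cover ≈̇-isEquivalence
              (atLeast-⊆ {P′ = λ x → ⊤ × Q x} (λ { _ (inj₁ (_ , s)) → tt , s ; _ (inj₂ (_ , s)) → tt , s })
                (atLeast-∪ ≈̇.sym (λ { x y ((_ , px) , _) ((_ , ¬py) , _) e → ¬py (span-resp xs e px) })
                  (exact⇒atLeast Eᴾᵠ) (exact⇒atLeast E⁻ᴾᵠ)))
              (exact⇒cover Eᵠ)
            pr≤Ni : p * r ≤ q ^ n * i
            pr≤Ni = atLeast≤cover ≈²-isEquivalence
              (atLeast-⊆ {P′ = λ (x , y) → P x × Q y} (λ _ ((_ , px) , (_ , qy)) → px , qy)
                (atLeast-Σ (exact⇒atLeast Eᴾ) (λ _ _ → exact⇒atLeast Eᵠ)))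
              (cover-map proj₂ proj₂ (IsEquivalence.trans ≈²-isEquivalence)
                (λ (x , y) pq → (x +̇ neg y , (x , y)) , (tt , pq , ≈̇.refl) , (≈̇.refl , ≈̇.refl))
                (cover-Σ {R = λ z (x , y) → (P x × Q y) × z ≈̇ x +̇ neg y} (IsEquivalence.trans ≈²-isEquivalence) (λ z≈ (pq , e) → pq , ≈̇.trans (≈̇.sym z≈) e)
                  (exact⇒cover exactV)
                  (λ _ → fibre Eᴾ Eᵠ (cover-⊆ (λ _ (px , qx) → (tt , px) , qx) (exact⇒cover Eᴾᵠ)) _)))
        in t , atLeast-⊆ (λ _ ((_ , ¬p) , ¬q) → ¬p , ¬q) (exact⇒atLeast Eᵗ) ,
           arith (trans (sym p+p′≡) (cong₂ _+_ p≡ (sym s+t≡))) (≤-trans i+s≤r (≤-reflexive r≡))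
             (≤-trans (≤-reflexive (cong₂ _*_ (sym p≡) (sym r≡))) pr≤Ni)
        where
        -- Inclusion and exclusion, with i = |P ∩ Q| and s the number of points of Q outside P: t ≥
        -- N - 2 S + i, and N i ≥ S² turns this into t N ≥ (N - S)².
        arith : ∀ {N S s t i} → N ≡ S + (s + t) → i + s ≤ S → S * S ≤ N * i → N * N + S * S ≤ t * N + 2 * S * N
        arith {N} {S} {s} {t} {i} e h₁ h₂ = begin
          N * N + S * S              ≤⟨ +-monoʳ-≤ (N * N) h₂ ⟩
          N * N + N * i              ≡⟨ sym (*-distribˡ-+ N N i) ⟩
          N * (N + i)                ≡⟨ cong (λ x → N * (x + i)) e ⟩
          N * (S + (s + t) + i)      ≡⟨ eq₁ N S s t i ⟩
          N * (S + (i + s) + t)      ≤⟨ *-monoʳ-≤ N (+-monoˡ-≤ t (+-monoʳ-≤ S h₁)) ⟩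
          N * (S + S + t)            ≡⟨ eq₂ N S t ⟩
          t * N + 2 * S * N          ∎
          where
          open ≤-Reasoning
          eq₁ : ∀ N S s t i → N * (S + (s + t) + i) ≡ N * (S + (i + s) + t)
          eq₁ = solve-∀
          eq₂ : ∀ N S t → N * (S + S + t) ≡ t * N + 2 * S * N
          eq₂ = solve-∀

  indep-++ : ∀ {I : Set} (xs ys : List (I → Carrier)) → Indep xs → Indep ys →
    (∀ {x} → Span xs x → Span ys x → x ≈̇ 0̇) → Indep (xs ++ ys)
  indep-++ []       ys indˣ indʸ disjoint = indʸ
  indep-++ (x ∷ xs) ys (¬s , indˣ) indʸ disjoint =
    (λ s → let h , k , sh , sk , e = span-++⁻ xs ys s
               k≈0 = disjoint (span-+ (x ∷ xs) (span-head x xs) (span-• (x ∷ xs) (⊖ 1#) (span-∷ x xs sh)))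
                 (span-resp ys (λ i → K.sym (K.trans (K.+-congʳ (K.trans (e i) (K.+-comm _ _))) (+difference (k i) (h i)))) sk)
           in ¬s (span-resp xs (λ i → K.sym (difference≈0 _ _ (k≈0 i))) sh)) ,
    indep-++ xs ys indˣ indʸ (λ s t → disjoint (span-∷ x xs s) t)

-- Matrices as linear maps, and their construction from graphs.

module Matrices {q : ℕ} (K : FiniteField q) where

  private module K = FiniteField K
  open K using (Carrier; _≈_; 0#; 1#) renaming (_+_ to _⊕_; _*_ to _⊛_; -_ to ⊖_)
  open Spans K
  open Solver using (solve; _:+_; _:*_; _:=_)
  open LinAlg K

  Σ-cong : ∀ {n} {f g : Vec n} → f ≈̇ g → Σ[ f ] ≈ Σ[ g ]
  Σ-cong {zero}  e = K.refl
  Σ-cong {suc n} e = K.+-cong (e zero) (Σ-cong (λ i → e (suc i)))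

  Σ-0 : ∀ {n} {f : Vec n} → f ≈̇ 0̇ → Σ[ f ] ≈ 0#
  Σ-0 {zero}  e = K.refl
  Σ-0 {suc n} e = K.trans (K.+-cong (e zero) (Σ-0 (λ i → e (suc i)))) (K.+-identityʳ _)

  Σ-+ : ∀ {n} (f g : Vec n) → Σ[ f +̇ g ] ≈ Σ[ f ] ⊕ Σ[ g ]
  Σ-+ {zero}  f g = K.sym (K.+-identityʳ _)
  Σ-+ {suc n} f g = K.trans (K.+-congˡ (Σ-+ (f ∘ suc) (g ∘ suc)))
    (solve 4 (λ a b c d → (a :+ b) :+ (c :+ d) := (a :+ c) :+ (b :+ d)) K.refl _ _ _ _)

  Σ-• : ∀ {n} α (f : Vec n) → Σ[ α • f ] ≈ α ⊛ Σ[ f ]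
  Σ-• {zero}  α f = K.sym (K.zeroʳ α)
  Σ-• {suc n} α f = K.trans (K.+-congˡ (Σ-• α (f ∘ suc))) (K.sym (K.distribˡ α _ _))

  Σ-swap : ∀ {m n} (f : Fin m → Fin n → Carrier) → Σ[ (λ i → Σ[ f i ]) ] ≈ Σ[ (λ j → Σ[ (λ i → f i j) ]) ]
  Σ-swap {zero}  {n} f = K.sym (Σ-0 {n} (λ _ → K.refl))
  Σ-swap {suc m} {n} f = K.trans (K.+-congˡ (Σ-swap {m} {n} (λ i → f (suc i)))) (K.sym (Σ-+ {n} (f zero) _))

  Σ-I : ∀ {n} (f : Vec n) i → Σ[ (λ k → I i k ⊛ f k) ] ≈ f i
  Σ-I {suc n} f zero    = K.trans (K.+-cong (K.*-identityˡ _) (Σ-0 {n} (λ _ → K.zeroˡ _))) (K.+-identityʳ _)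
  Σ-I f (suc i) = K.trans (K.+-cong (K.zeroˡ _) (Σ-I (f ∘ suc) i)) (K.+-identityˡ _)

  I-sym : ∀ {n} (i k : Fin n) → I i k ≈ I k i
  I-sym zero    zero    = K.refl
  I-sym zero    (suc k) = K.refl
  I-sym (suc i) zero    = K.refl
  I-sym (suc i) (suc k) = I-sym i k

  mul-linear : ∀ {n} (A : Mat n) → Linear (A ·ᵥ_)
  mul-linear {n} A = record
    { cong-≈ = λ e i → Σ-cong {n} (λ k → K.*-congˡ (e k))
    ; +-homo = λ x y i → K.trans (Σ-cong {n} (λ k → K.distribˡ _ _ _)) (Σ-+ {n} _ _)
    ; •-homo = λ α x i → K.trans
        (Σ-cong {n} (λ k → solve 3 (λ a b c → b :* (a :* c) := a :* (b :* c)) K.refl α (A i k) (x k))) (Σ-• {n} α _) }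

  id-linear : ∀ {I : Set} → Linear {I} {I} id
  id-linear = record { cong-≈ = id ; +-homo = λ _ _ → ≈̇.refl ; •-homo = λ _ _ → ≈̇.refl }

  ∘-linear : ∀ {I J L : Set} {φ : (J → Carrier) → L → Carrier} {ψ : (I → Carrier) → J → Carrier} →
    Linear φ → Linear ψ → Linear (φ ∘ ψ)
  ∘-linear lin lin′ = record
    { cong-≈ = λ e → Linear.cong-≈ lin (Linear.cong-≈ lin′ e)
    ; +-homo = λ x y → ≈̇.trans (Linear.cong-≈ lin (Linear.+-homo lin′ x y)) (Linear.+-homo lin _ _)
    ; •-homo = λ α x → ≈̇.trans (Linear.cong-≈ lin (Linear.•-homo lin′ α x)) (Linear.•-homo lin α _) }

  sub-linear : ∀ {I J : Set} {φ ψ : (I → Carrier) → J → Carrier} →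
    Linear φ → Linear ψ → Linear (λ x → φ x +̇ neg (ψ x))
  sub-linear lin lin′ = record
    { cong-≈ = λ e i → K.+-cong (Linear.cong-≈ lin e i) (K.*-congˡ (Linear.cong-≈ lin′ e i))
    ; +-homo = λ x y i → K.trans (K.+-cong (Linear.+-homo lin x y i) (K.*-congˡ (Linear.+-homo lin′ x y i)))
        (solve 5 (λ c a b a′ b′ → (a :+ b) :+ c :* (a′ :+ b′) := (a :+ c :* a′) :+ (b :+ c :* b′)) K.refl _ _ _ _ _)
    ; •-homo = λ α x i → K.trans (K.+-cong (Linear.•-homo lin α x i) (K.*-congˡ (Linear.•-homo lin′ α x i)))
        (solve 4 (λ c α a b → α :* a :+ c :* (α :* b) := α :* (a :+ c :* b)) K.refl _ _ _ _) }

  0-linear : ∀ {I J : Set} → Linear {I} {J} (λ _ → 0̇)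
  0-linear = record
    { cong-≈ = λ _ → ≈̇.refl ; +-homo = λ _ _ i → K.sym (K.+-identityʳ _) ; •-homo = λ α _ i → K.sym (K.zeroʳ α) }

  I·x : ∀ {n} (x : Vec n) → I ·ᵥ x ≈̇ x
  I·x x i = Σ-I x i

  ·-assoc : ∀ {n} (A B : Mat n) x → (A ⊗ B) ·ᵥ x ≈̇ A ·ᵥ (B ·ᵥ x)
  ·-assoc {n} A B x i = begin
    Σ[ (λ k → Σ[ (λ l → A i l ⊛ B l k) ] ⊛ x k) ]
      ≈⟨ Σ-cong {n} (λ k → K.trans (K.*-comm _ _) (K.sym (Σ-• {n} (x k) _))) ⟩
    Σ[ (λ k → Σ[ (λ l → x k ⊛ (A i l ⊛ B l k)) ]) ]
      ≈⟨ Σ-swap {n} {n} _ ⟩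
    Σ[ (λ l → Σ[ (λ k → x k ⊛ (A i l ⊛ B l k)) ]) ]
      ≈⟨ Σ-cong {n} (λ l → K.trans (Σ-cong {n} (λ k → solve 3 (λ x a b → x :* (a :* b) := a :* (b :* x)) K.refl (x k) (A i l) (B l k))) (Σ-• {n} (A i l) _)) ⟩
    Σ[ (λ l → A i l ⊛ Σ[ (λ k → B l k ⊛ x k) ]) ] ∎
    where open import Relation.Binary.Reasoning.Setoid K.setoid

  ·-congʳ : ∀ {n} {A B : Mat n} → A ≈ₘ B → ∀ x → A ·ᵥ x ≈̇ B ·ᵥ x
  ·-congʳ {n} e x i = Σ-cong {n} (λ k → K.*-congʳ (e i k))

  matrix-ext : ∀ {n} {A B : Mat n} → (∀ x → A ·ᵥ x ≈̇ B ·ᵥ x) → A ≈ₘ B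
  matrix-ext {n} {A = A} {B} e i j = K.trans (K.sym (column A)) (K.trans (e (λ k → I j k) i) (column B))
    where
    column : ∀ A → (A ·ᵥ (λ k → I j k)) i ≈ A i j
    column A = K.trans (Σ-cong {n} (λ k → K.*-comm _ _)) (Σ-I (A i) j)

  ≈ₘ-isEquivalence : ∀ {n} → IsEquivalence (_≈ₘ_ {n})
  ≈ₘ-isEquivalence = record
    { refl = λ i j → K.refl ; sym = λ e i j → K.sym (e i j) ; trans = λ e e′ i j → K.trans (e i j) (e′ i j) }

  module ≈ₘ {n} = IsEquivalence (≈ₘ-isEquivalence {n})

  −I-fixed : ∀ {n} (A : Mat n) x → (A −I) ·ᵥ x ≈̇ A ·ᵥ x +̇ neg x
  −I-fixed {n} A x i = K.trans
    (Σ-cong {n} (λ k → K.trans (K.*-congʳ (K.+-congˡ (K.sym (-1*x (I i k)))))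
      (solve 4 (λ c a b x → (a :+ c :* b) :* x := a :* x :+ c :* (b :* x)) K.refl (⊖ 1#) (A i k) (I i k) (x k))))
    (K.trans (Σ-+ {n} _ _) (K.+-congˡ (K.trans (Σ-• {n} _ _) (K.*-congˡ (Σ-I x i)))))

  span-Σ : ∀ {J : Set} (ys : List (J → Carrier)) {n} (h : Fin n → J → Carrier) →
    (∀ k → Span ys (h k)) → Span ys (λ j → Σ[ (λ k → h k j) ])
  span-Σ ys {zero}  h s = span-0 ys
  span-Σ ys {suc n} h s = span-+ ys (s zero) (span-Σ ys (h ∘ suc) (s ∘ suc))

  -- A linear map as the span of a list of pairs (argument, value).

  module _ {n : ℕ} where

    Pair : Set
    Pair = Fin n ⊎ Fin n → Carrier

    ⟨_,_⟩ : Vec n → Vec n → Pair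
    ⟨ x , y ⟩ = [ x , y ]

    π₁ π₂ : Pair → Vec n
    π₁ g = g ∘ inj₁
    π₂ g = g ∘ inj₂

    π₁-linear : Linear π₁
    π₁-linear = record { cong-≈ = λ e i → e _ ; +-homo = λ _ _ _ → K.refl ; •-homo = λ _ _ _ → K.refl }

    π₂-linear : Linear π₂
    π₂-linear = record { cong-≈ = λ e i → e _ ; +-homo = λ _ _ _ → K.refl ; •-homo = λ _ _ _ → K.refl }

    -- The first components form a basis, so some point of the span lies above each unit vector, and
    -- its second component is taken as a column. Injectivity of `π₁` on the span makes the graph
    -- single-valued.
    linear-from-graph : (G : List Pair) → Indep (map π₁ G) → length G ≡ n →
      ∃ λ A → (∀ x → Span G ⟨ x , A ·ᵥ x ⟩) × (∀ {g} → Span G g → A ·ᵥ π₁ g ≈̇ π₂ g)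
    linear-from-graph G ind len = A , on-graph , value
      where
      at : ∀ j → ∃ λ g → Span G g × I j ≈̇ π₁ g
      at j = span-map⁻ π₁-linear G (full-span (map π₁ G) ind (trans (length-map π₁ G) len) (I j))
      A : Mat n
      A i j = π₂ (proj₁ (at j)) i
      on-graph : ∀ x → Span G ⟨ x , A ·ᵥ x ⟩
      on-graph x = span-resp G
        (λ { (inj₁ i) → K.trans (Σ-cong {n} (λ k → K.trans (K.*-comm _ _)
                          (K.*-congʳ (K.trans (K.sym (proj₂ (proj₂ (at k)) i)) (I-sym k i))))) (Σ-I x i)
           ; (inj₂ i) → Σ-cong {n} (λ k → K.*-comm _ _) })
        (span-Σ G (λ k → x k • proj₁ (at k)) (λ k → span-• G (x k) (proj₁ (proj₂ (at k)))))
      value : ∀ {g} → Span G g → A ·ᵥ π₁ g ≈̇ π₂ g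
      value {g} s i = difference≈0 _ _ (indep-map⇒injective π₁-linear G ind
        (span-+ G (on-graph (π₁ g)) (span-• G (⊖ 1#) s)) (λ i → x-x _) (inj₂ i))

    Injective : Mat n → Set
    Injective A = ∀ x → A ·ᵥ x ≈̇ 0̇ → x ≈̇ 0̇

    graph-injective : (G : List Pair) → Indep (map π₂ G) → ∀ {A} → (∀ x → Span G ⟨ x , A ·ᵥ x ⟩) → Injective A
    graph-injective G ind on-graph x Ax≈0 i =
      indep-map⇒injective π₂-linear G ind (on-graph x) Ax≈0 (inj₁ i)

    -- The inverse has the graph of `A` with its components exchanged. The basis `ys` is a parameter
    -- because bases are obtained later, by counting.
    injective⇒inverse : ∀ {A} → Injective A → ∀ ys → Indep ys → length ys ≡ n →
      ∃ λ B → (∀ x → A ·ᵥ (B ·ᵥ x) ≈̇ x) × (∀ x → B ·ᵥ (A ·ᵥ x) ≈̇ x)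
    injective⇒inverse {A} inj ys ind len = B , AB , BA
      where
      graph : Vec n → Pair
      graph y = ⟨ A ·ᵥ y , y ⟩
      G = map graph ys
      graph-linear : Linear graph
      graph-linear = record
        { cong-≈ = λ { e (inj₁ i) → A.cong-≈ e i ; e (inj₂ i) → e i }
        ; +-homo = λ { x y (inj₁ i) → A.+-homo x y i ; x y (inj₂ i) → K.refl }
        ; •-homo = λ { α x (inj₁ i) → A.•-homo α x i ; α x (inj₂ i) → K.refl } }
        where module A = Linear (mul-linear A)
      Aind : Indep (map (A ·ᵥ_) ys)
      Aind = indep-map (mul-linear A) inj ys ind
      inverse = linear-from-graph G (subst Indep (map-∘ ys) Aind) (trans (length-map graph ys) len)
      B = proj₁ inverse
      BA : ∀ x → B ·ᵥ (A ·ᵥ x) ≈̇ x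
      BA x = proj₂ (proj₂ inverse) (span-map graph-linear ys (full-span ys ind len x))
      AB : ∀ x → A ·ᵥ (B ·ᵥ x) ≈̇ x
      AB x =
        let z , _ , x≈Az = span-map⁻ (mul-linear A) ys (full-span (map (A ·ᵥ_) ys) Aind (trans (length-map (A ·ᵥ_) ys) len) x)
        in ≈̇.trans (Linear.cong-≈ (mul-linear A) (≈̇.trans (Linear.cong-≈ (mul-linear B) x≈Az) (BA z))) (≈̇.sym x≈Az)

-- Bases, invertibility, kernel dimensions and the order of GL.

module Kernels {q : ℕ} (K : FiniteField q) where

  private module K = FiniteField K
  open K using (_≈_; 0#; 1#) renaming (_*_ to _⊛_; -_ to ⊖_)
  open Spans K
  open Matrices K
  open LinAlg K

  _≋_ : ∀ {n} → List (Vec n) → List (Vec n) → Set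
  _≋_ = Pointwise _≈̇_

  ≋-isEquivalence : ∀ {n} → IsEquivalence (_≋_ {n})
  ≋-isEquivalence = pointwise-isEquivalence ≈̇-isEquivalence

  lists-cover : ∀ {n} d → Cover (_≋_ {n}) ((q ^ n) ^ d) (λ xs → length xs ≡ d)
  lists-cover d = cover-⊆ {P = λ xs → length xs ≡ d × All (λ _ → ⊤) xs} (λ xs e → e , All.universal (λ _ → tt) xs)
    (cover-lists (exact⇒cover exactV) d)

  -- When k choices remain, the vectors already present span at most a q⁻ᵏ part of the `q ^ m`
  -- candidates, so each choice loses at most 1 - q⁻ᵏ. It is applied with `P` a kernel or the whole
  -- space.
  extensions : ∀ {n m d} {P : Vec n → Set} zs → AtLeast _≈̇_ (q ^ m) P → Indep zs → d + length zs ≤ m →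
    AtLeast _≋_ (share (q ^ m) d) (λ xs → length xs ≡ d × All P xs × Indep (xs ++ zs))
  extensions {n} {m} {d} {P} zs many ind fits =
    sequences {_~_ = _≈̇_} (λ xs → All P xs × Indep (xs ++ zs)) ([] , ind) step
    where
    step : ∀ xs k → All P xs × Indep (xs ++ zs) → suc k + length xs ≡ d →
      ManyOf (q ^ m) (suc k) (λ x → All P (x ∷ xs) × Indep (x ∷ xs ++ zs))
    step xs k (Pxs , ind) refl =
      let t , good , large = atLeast-∖ ≈̇-isEquivalence (span? (xs ++ zs)) many (span-cover (xs ++ zs))
      in t , atLeast-⊆ (λ _ (px , ¬s) → px ∷ Pxs , ¬s , ind) good ,
         fraction¹⇒³ {q ^ m} {t} (suc k) (fraction¹ {q ^ m} {q ^ length (xs ++ zs)} {t} (suc k) (≤-trans (≤-reflexive (sym (^-distribˡ-+-* q (suc k) _)))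
           (^-monoʳ-≤ q {{>-nonZero (≤-trans (s≤s z≤n) 2≤q)}} (≤-trans (≤-reflexive
             (trans (cong (suc k +_) (length-++ xs)) (sym (+-assoc (suc k) (length xs) (length zs))))) fits))) large)

  first : ∀ {A : Set} {_~_ : A → A → Set} {T} {P : A → Set} → 0 < T → AtLeast _~_ T P → ∃ P
  first {T = suc T} _ (atLeast f f∈ _) = f zero , f∈ zero

  -- The number of independent n-tuples is positive, so there is one.
  basis : ∀ n → ∃ λ (ys : List (Vec n)) → Indep ys × length ys ≡ n
  basis n =
    let ys , len , _ , ind = first (share>0 n (q^>0 n))
          (extensions {n} {n} {n} [] (exact⇒atLeast exactV) tt (≤-reflexive (+-identityʳ n)))
    in ys , indep-++ˡ ys [] ind , len

  length≤ : ∀ {n} (ys : List (Vec n)) → Indep ys → length ys ≤ n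
  length≤ {n} ys ind = q^-reflects-≤ (atLeast≤cover ≈̇-isEquivalence (span-atLeast ys ind)
      (cover-⊆ (λ _ _ → tt) (exact⇒cover exactV)))
    where
    q^-reflects-≤ : ∀ {a b} → q ^ a ≤ q ^ b → a ≤ b
    q^-reflects-≤ {a} {b} h with a ≤? b
    ... | yes a≤b = a≤b
    ... | no a≰b  = ⊥-elim (<⇒≱ (^-monoʳ-< q 2≤q (≰⇒> a≰b)) h)

  vector-listed : ∀ {n} (x : Vec n) → Any (x ≈̇_) (allVecs n)
  vector-listed {n} x = allFuns-complete {P = λ _ → ⊤} K.elems (λ x _ → K.complete x) n x (λ _ → tt)

  matrix-listed : ∀ {n} (A : Mat n) → Any (A ≈ₘ_) (allMats n)
  matrix-listed {n} A = allFuns-complete {P = λ _ → ⊤} (allVecs n) (λ x _ → vector-listed x) n A (λ _ → tt)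

  matrices-distinct : ∀ n → AllPairs (λ A B → ¬ (A ≈ₘ B)) (allMats n)
  matrices-distinct n = allFuns-distinct (allVecs n) (allFuns-distinct K.elems K.distinct n) n

  matrices-length : ∀ n → length (allMats n) ≡ (q ^ n) ^ n
  matrices-length n = trans (allFuns-length (allVecs n) n)
    (cong (_^ n) (trans (allFuns-length K.elems n) (cong (_^ n) K.size)))

  invertible⇒injective : ∀ {n} {A : Mat n} → Invertible A → Injective A
  invertible⇒injective {A = A} inv x Ax≈0 =
    let B , _ , BA≈I = Any.satisfied inv
    in ≈̇.trans (≈̇.sym (I·x x)) (≈̇.trans (≈̇.sym (·-congʳ BA≈I x)) (≈̇.trans (·-assoc B A x)
         (≈̇.trans (Linear.cong-≈ (mul-linear B) Ax≈0) (Linear.0-homo (mul-linear B)))))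

  inverse-of : ∀ {n} {A : Mat n} → Injective A →
    ∃ λ B → (∀ x → A ·ᵥ (B ·ᵥ x) ≈̇ x) × (∀ x → B ·ᵥ (A ·ᵥ x) ≈̇ x)
  inverse-of {n} inj = let ys , ind , len = basis n in injective⇒inverse inj ys ind len

  injective⇒invertible : ∀ {n} {A : Mat n} → Injective A → Invertible A
  injective⇒invertible {A = A} inj =
    let B , AB , BA = inverse-of inj
    in Any.map (λ {C} B≈C →
         matrix-ext (λ x → ≈̇.trans (·-assoc A C x) (≈̇.trans (Linear.cong-≈ (mul-linear A) (≈̇.sym (·-congʳ B≈C x)))
           (≈̇.trans (AB x) (≈̇.sym (I·x x))))) ,
         matrix-ext (λ x → ≈̇.trans (·-assoc C A x) (≈̇.trans (≈̇.sym (·-congʳ B≈C _)) (≈̇.trans (BA x) (≈̇.sym (I·x x))))))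
       (matrix-listed B)

  Ker : ∀ {n} → Mat n → Vec n → Set
  Ker A x = A ·ᵥ x ≈̇ 0̇

  ker-resp : ∀ {n} (A : Mat n) {x y} → x ≈̇ y → Ker A x → Ker A y
  ker-resp A e Ax≈0 = ≈̇.trans (Linear.cong-≈ (mul-linear A) (≈̇.sym e)) Ax≈0

  span-tabulate⁻ : ∀ {n d} (f : Fin d → Vec n) {x} → Span (tabulate f) x → ∃ λ a → lincomb a f ≈̇ x
  span-tabulate⁻ {d = zero}  f e = (λ ()) , ≈̇.sym e
  span-tabulate⁻ {d = suc d} f (α , z , s , e) =
    let a , e′ = span-tabulate⁻ (f ∘ suc) s
    in α ∷ᶠ a , λ i → K.trans (K.+-congˡ (e′ i)) (K.sym (e i))

  tabulate-indep : ∀ {n d} (f : Fin d → Vec n) → (∀ a → lincomb a f ≈̇ 0̇ → a ≈̇ 0̇) → Indep (tabulate f)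
  tabulate-indep {d = zero}  f ind = tt
  tabulate-indep {d = suc d} f ind =
    (λ s → let a , e = span-tabulate⁻ (f ∘ suc) s in K.0≉1 (K.sym (ind (1# ∷ᶠ (λ k → (⊖ 1#) ⊛ a k))
      (λ i → K.trans (K.+-cong (K.*-identityˡ _) (K.trans (Σ-cong {d} (λ k → K.*-assoc _ _ _)) (K.trans (Σ-• {d} (⊖ 1#) _) (K.*-congˡ (e i))))) (x-x _)) zero))) ,
    tabulate-indep (f ∘ suc) (λ a e i → ind (0# ∷ᶠ a)
      (λ j → K.trans (K.+-cong (K.zeroˡ _) (e j)) (K.+-identityˡ _)) (suc i))

  -- Passes from lists to the indexed families and coefficient vectors in which `Independent` is
  -- phrased. The equation with `tabulate` lets the list be read off again.
  family : ∀ {n d} {P : Vec n → Set} (ys : List (Vec n)) → Indep ys → length ys ≡ d → All P ys →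
    ∃ λ (f : Fin d → Vec n) → (∀ a → lincomb a f ≈̇ 0̇ → a ≈̇ 0̇) × (∀ k → P (f k)) × (∀ a → Span ys (lincomb a f)) × tabulate f ≡ ys
  family [] ind refl [] = (λ ()) , (λ _ _ ()) , (λ ()) , (λ _ → ≈̇.refl) , refl
  family {P = P} (y ∷ ys) (¬s , ind) refl (py ∷ pys) =
    let f , f-ind , Pf , f-span , f≡ = family ys ind refl pys
        head≈0 : ∀ a → lincomb a (y ∷ᶠ f) ≈̇ 0̇ → a zero ≈ 0#
        head≈0 = λ a e → cancel-coefficient ¬s (a zero) (f-span (a ∘ suc)) e
    in y ∷ᶠ f ,
       (λ a e → λ { zero → head≈0 a e
                  ; (suc i) → f-ind (a ∘ suc) (λ j → K.trans (K.sym (K.trans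
                      (K.+-congʳ (K.trans (K.*-congʳ (head≈0 a e)) (K.zeroˡ _))) (K.+-identityˡ _))) (e j)) i }) ,
       (λ { zero → py ; (suc k) → Pf k }) ,
       (λ a → a zero , lincomb (a ∘ suc) f , f-span (a ∘ suc) , ≈̇.refl) ,
       cong (y ∷_) f≡

  KerBasis : ∀ {n} → Mat n → ℕ → Set
  KerBasis {n} A d = ∃ λ (ys : List (Vec n)) → Indep ys × length ys ≡ d × All (Ker A) ys

  kerList-sound : ∀ {n} (A : Mat n) → All (Ker A) (kerList A)
  kerList-sound {n} A = Allₚ.all-filter _ (allVecs n)

  hasIndep⇒kerBasis : ∀ {n} {A : Mat n} {d} → HasIndep A d → KerBasis A d
  hasIndep⇒kerBasis {n} {A} {d} has =
    let (f∈ , f-ind) = All.lookupAny (allFuns-sat (kerList A) (kerList-sound A) d) has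
        f = Any.lookup has
    in tabulate f , tabulate-indep f (λ a e → let (h , a≈) = All.lookupAny f-ind (vector-listed a)
                                              in ≈̇.trans a≈ (h (λ i → K.trans (Σ-cong {d} (λ k → K.*-congʳ (K.sym (a≈ k)))) (e i)))) ,
       length-tabulate f , Allₚ.tabulate⁺ f∈

  kerBasis⇒hasIndep : ∀ {n} {A : Mat n} {d} → KerBasis A d → HasIndep A d
  kerBasis⇒hasIndep {n} {A} {d} (ys , ind , len , ker) =
    let f , f-ind , f∈ , _ = family {P = Ker A} ys ind len ker
    in Any.map (λ {g} f≈g → All.universal (λ a e → f-ind a (λ i → K.trans (Σ-cong {d} (λ k → K.*-congˡ (f≈g k i))) (e i))) (allVecs d))
         (allFuns-complete {P = Ker A} (kerList A)
           (λ x x∈ → filter-complete (λ x → (A ·ᵥ x) ≈ᵥ? 0ᵥ) (ker-resp A) x∈ (vector-listed x)) d f f∈)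

  -- The search loop of dimKer is local to its definition; the metavariable searchDim is solved by it, once
  -- the dimension and the loop counter have been abstracted into distinct variables.
  mutual
    searchDim : (n : ℕ) → Mat n → ℕ → ℕ
    searchDim = _

    solve-searchDim : ∀ n (A : Mat (suc n)) →
      if does (hasIndep? A (suc n)) then ⊤ else (dimKer A ≡ searchDim (suc n) A n)
    solve-searchDim n A with does (hasIndep? A (suc n))
    ... | true  = tt
    ... | false with suc n | A
    ...   | m | B = refl

  -- The loop descends from `d`, so its first hit is the largest size up to `d` of an independent
  -- family in the kernel.
  searchDim-maximal : ∀ {n} (A : Mat n) d →
    KerBasis A (searchDim n A d) × (∀ e → searchDim n A d < e → e ≤ d → ¬ KerBasis A e)
  searchDim-maximal A zero    = ([] , tt , refl , []) , λ e lt le → ⊥-elim (<⇒≱ lt le)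
  searchDim-maximal A (suc d) with hasIndep? A (suc d)
  ... | yes has = hasIndep⇒kerBasis has , λ e lt le → ⊥-elim (<⇒≱ lt le)
  ... | no ¬has = let b , max = searchDim-maximal A d in b , λ e lt le b′ →
    [ (λ e<1+d → max e lt (s≤s⁻¹ e<1+d) b′) , (λ { refl → ¬has (kerBasis⇒hasIndep b′) }) ] (m≤n⇒m<n∨m≡n le)

  -- A kernel vector outside the span would lengthen an independent family whose length is already
  -- maximal; `length≤` keeps the longer one within the range of the search.
  kernel-basis : ∀ {n} (A : Mat n) → ∃ λ ys → Indep ys × length ys ≡ dimKer A × All (Ker A) ys × (∀ x → Ker A x → Span ys x)
  kernel-basis {n} A =
    let (ys , ind , len , ker) , max = searchDim-maximal A n
    in ys , ind , len , ker , λ x x∈ → decidable-stable (span? ys x) λ ¬s →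
         max (suc (dimKer A)) ≤-refl (≤-trans (≤-reflexive (cong suc (sym len))) (length≤ (x ∷ ys) (¬s , ind)))
           (x ∷ ys , (¬s , ind) , cong suc len , x∈ ∷ ker)

  span⊆ker : ∀ {n} (A : Mat n) ys → All (Ker A) ys → ∀ {x} → Span ys x → Ker A x
  span⊆ker A ys ker s = linear-agree (mul-linear A) 0-linear ys ker s

  kernel-atLeast : ∀ {n} (A : Mat n) → AtLeast _≈̇_ (q ^ dimKer A) (Ker A)
  kernel-atLeast A = let ys , ind , len , ker , _ = kernel-basis A in
    subst (λ d → AtLeast _≈̇_ (q ^ d) (Ker A)) len (atLeast-⊆ (λ _ → span⊆ker A ys ker) (span-atLeast ys ind))

  kernel-cover : ∀ {n} (A : Mat n) → Cover _≈̇_ (q ^ dimKer A) (Ker A)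
  kernel-cover A = let ys , ind , len , _ , spans = kernel-basis A in
    subst (λ d → Cover _≈̇_ (q ^ d) (Ker A)) len (cover-⊆ spans (span-cover ys))

  -- The kernel has q^dim elements and powers of q are distinct. Dimensions can thus be computed and
  -- transported by counting, without reference to the search.
  dimKer-unique : ∀ {n} (A : Mat n) {d} → AtLeast _≈̇_ (q ^ d) (Ker A) → Cover _≈̇_ (q ^ d) (Ker A) → dimKer A ≡ d
  dimKer-unique A {d} many few = ^-injective (≤-antisym
    (atLeast≤cover ≈̇-isEquivalence (kernel-atLeast A) few)
    (atLeast≤cover ≈̇-isEquivalence many (kernel-cover A)))
    where
    ^-injective : ∀ {a b} → q ^ a ≡ q ^ b → a ≡ b
    ^-injective {a} {b} e with <-cmp a b
    ... | tri< lt _ _ = ⊥-elim (<⇒≢ (^-monoʳ-< q 2≤q lt) e)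
    ... | tri≈ _ eq _ = eq
    ... | tri> _ _ gt = ⊥-elim (<⇒≢ (^-monoʳ-< q 2≤q gt) (sym e))

  dimKer-cong : ∀ {n} {A B : Mat n} → A ≈ₘ B → dimKer A ≡ dimKer B
  dimKer-cong {A = A} {B} e = dimKer-unique A
    (atLeast-⊆ (λ x Bx≈0 → ≈̇.trans (·-congʳ e x) Bx≈0) (kernel-atLeast B))
    (cover-⊆ (λ x Ax≈0 → ≈̇.trans (≈̇.sym (·-congʳ e x)) Ax≈0) (kernel-cover B))

  injective-resp : ∀ {n} {A B : Mat n} → A ≈ₘ B → Injective A → Injective B
  injective-resp e inj x Bx≈0 = inj x (≈̇.trans (·-congʳ e x) Bx≈0)

  ∣GL∣-upper : ∀ g → ∣GL∣ g ≤ (q ^ g) ^ g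
  ∣GL∣-upper g = ≤-trans (length-filter invertible? (allMats g)) (≤-reflexive (matrices-length g))

  -- Independent g-tuples, read as columns, are invertible matrices.
  ∣GL∣-lower : ∀ g → (q ^ g) ^ g ≤ ∣GL∣ g * 64
  ∣GL∣-lower g = ≤-trans (share-large (q ^ g) g) (*-monoˡ-≤ 64 (atLeast≤cover ≈ₘ-isEquivalence
    (atLeast-map {Q = Invertible}
      (λ ys (len , _ , ind) → matrix ys len ind)
      (λ ys (len , _ , ind) → injective⇒invertible (λ x e → proj₁ (proj₂ (fam ys len ind)) x
        (λ i → K.trans (Σ-cong {g} (λ k → K.*-comm _ _)) (e i))))
      (λ ys ys′ (len , _ , ind) (len′ , _ , ind′) e →
        subst (_≋ ys′) (tabulate≡ ys len ind) (subst (tabulate (proj₁ (fam ys len ind)) ≋_) (tabulate≡ ys′ len′ ind′)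
          (Pointwise.tabulate⁺ (λ k i → e i k))))
      (extensions {g} {g} {g} [] (exact⇒atLeast exactV) tt (≤-reflexive (+-identityʳ g))))
    (list-cover (filter invertible? (allMats g)) (λ A inv → filter-complete invertible?
      (λ e inv → injective⇒invertible (injective-resp e (invertible⇒injective inv))) inv (matrix-listed A)))))
    where
    fam : ∀ (ys : List (Vec g)) → length ys ≡ g → Indep (ys ++ []) → _
    fam ys len ind = family {P = λ _ → ⊤} ys (indep-++ˡ ys [] ind) len (All.universal (λ _ → tt) ys)
    tabulate≡ : ∀ ys len ind → tabulate (proj₁ (fam ys len ind)) ≡ ys
    tabulate≡ ys len ind = proj₂ (proj₂ (proj₂ (proj₂ (fam ys len ind))))
    matrix : ∀ (ys : List (Vec g)) → length ys ≡ g → Indep (ys ++ []) → Mat g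
    matrix ys len ind i k = proj₁ (fam ys len ind) k i

-- Regular elliptic elements have no eigenvectors over the base field.

module Elliptic {q : ℕ} (K : FiniteField q) {n : ℕ} (c : LinAlg.Mat K n) (elliptic : RegularElliptic K n c) (2≤n : 2 ≤ n) where

  open RegularElliptic elliptic
  private
    module K = FiniteField K
    module L = FiniteField L
    module SK = Spans K
    module SL = Spans L
    module ML = Matrices L
  open SK using (_≈̇_; _•_; 0̇; module ≈̇)
  open LinAlg K using (Vec; _·ᵥ_) renaming (Σ[_] to Σᴷ)
  open LinAlg L using () renaming (Σ[_] to Σᴸ)

  comb : Vec n → L.Carrier
  comb a = combL K L ι a b

  comb-cong : ∀ {x y} → x ≈̇ y → comb x L.≈ comb y
  comb-cong e = ML.Σ-cong {n} (λ i → L.*-congʳ (ι-cong (e i)))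

  ι-Σ : ∀ {m} (f : Vec m) → ι (Σᴷ f) L.≈ Σᴸ (λ i → ι (f i))
  ι-Σ {zero}  f = ι-0
  ι-Σ {suc m} f = L.trans (ι-+ _ _) (L.+-congˡ (ι-Σ (f ∘ suc)))

  comb-• : ∀ s x → comb (s • x) L.≈ ι s L.* comb x
  comb-• s x = L.trans (ML.Σ-cong {n} (λ i → L.trans (L.*-congʳ (ι-* s (x i))) (L.*-assoc _ _ _))) (ML.Σ-• {n} (ι s) _)

  -- By linearity from the basis, where it is `c-matrix`: under `comb` the matrix acts as
  -- multiplication by σ.
  σ-acts : ∀ x → comb (c ·ᵥ x) L.≈ σ L.* comb x
  σ-acts x = begin
    Σᴸ (λ i → ι (Σᴷ (λ j → c i j K.* x j)) L.* b i)
      ≈⟨ ML.Σ-cong {n} (λ i → L.trans (L.*-congʳ (ι-Σ (λ j → c i j K.* x j))) (L.trans (L.*-comm _ _) (L.sym (ML.Σ-• {n} (b i) _)))) ⟩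
    Σᴸ (λ i → Σᴸ (λ j → b i L.* ι (c i j K.* x j)))
      ≈⟨ ML.Σ-swap {n} {n} _ ⟩
    Σᴸ (λ j → Σᴸ (λ i → b i L.* ι (c i j K.* x j)))
      ≈⟨ ML.Σ-cong {n} (λ j → L.trans (ML.Σ-cong {n} (λ i → L.trans (L.*-congˡ (ι-* _ _))
           (SL.Solver.solve 3 (λ b c x → b SL.Solver.:* (c SL.Solver.:* x) SL.Solver.:= x SL.Solver.:* (c SL.Solver.:* b)) L.refl (b i) (ι (c i j)) (ι (x j)))))
           (ML.Σ-• {n} (ι (x j)) _)) ⟩
    Σᴸ (λ j → ι (x j) L.* comb (λ i → c i j))
      ≈⟨ ML.Σ-cong {n} (λ j → L.trans (L.*-congˡ (L.sym (c-matrix j)))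
           (SL.Solver.solve 3 (λ x s b → x SL.Solver.:* (s SL.Solver.:* b) SL.Solver.:= s SL.Solver.:* (x SL.Solver.:* b)) L.refl (ι (x j)) σ (b j))) ⟩
    Σᴸ (λ j → σ L.* (ι (x j) L.* b j))
      ≈⟨ ML.Σ-• {n} σ _ ⟩
    σ L.* comb x ∎
    where open import Relation.Binary.Reasoning.Setoid L.setoid

  -- Otherwise every polynomial in σ takes its value in the image of ι, and the field with q ^ n
  -- elements has at most q. This is where n ≥ 2 enters.
  σ∉ι : ∀ s → ¬ (σ L.≈ ι s)
  σ∉ι s σ≈ιs = <⇒≱ (subst (_< q ^ n) (^-identityʳ q) (^-monoʳ-< q SK.2≤q 2≤n))
    (atLeast≤cover L.isEquivalence (exact⇒atLeast SL.exactK)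
      (cover-map ι ι-cong L.trans
        (λ y _ → let p , e = σ-generates y
                     k , e′ = eval p
                 in k , tt , L.trans (L.sym e) e′)
        (exact⇒cover SK.exactK)))
    where
    eval : ∀ p → ∃ λ k → evalPoly K L ι p σ L.≈ ι k
    eval []      = K.0# , L.sym ι-0
    eval (a ∷ p) = let k , e = eval p in a K.+ s K.* k ,
      L.trans (L.+-congˡ (L.trans (L.*-cong σ≈ιs e) (L.sym (ι-* s k)))) (L.sym (ι-+ a _))

  -- An eigenvector would be annihilated by σ - ι s, which is invertible in the extension field.
  no-eigenvector : ∀ s x → c ·ᵥ x ≈̇ s • x → x ≈̇ 0̇
  no-eigenvector s x cx≈sx = b-indep x (begin
      comb x                        ≈⟨ L.sym (L.*-identityˡ _) ⟩
      L.1# L.* comb x               ≈⟨ L.*-congʳ (L.sym (proj₂ inv)) ⟩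
      (δ L.* proj₁ inv) L.* comb x  ≈⟨ SL.Solver.solve 3 (λ d i y → (d SL.Solver.:* i) SL.Solver.:* y SL.Solver.:= i SL.Solver.:* (d SL.Solver.:* y)) L.refl δ (proj₁ inv) (comb x) ⟩
      proj₁ inv L.* (δ L.* comb x)  ≈⟨ L.*-congˡ δy≈0 ⟩
      proj₁ inv L.* L.0#            ≈⟨ L.zeroʳ _ ⟩
      L.0#                          ∎)
    where
    open import Relation.Binary.Reasoning.Setoid L.setoid
    δ : L.Carrier
    δ = σ L.+ (L.- L.1#) L.* ι s
    inv : ∃ λ y → (δ L.* y) L.≈ L.1#
    inv = L.inverse δ (λ e → σ∉ι s (SL.difference≈0 σ (ι s) e))
    δy≈0 : δ L.* comb x L.≈ L.0#
    δy≈0 = begin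
      δ L.* comb x
        ≈⟨ SL.Solver.solve 4 (λ σ m s y → (σ SL.Solver.:+ m SL.Solver.:* s) SL.Solver.:* y SL.Solver.:= σ SL.Solver.:* y SL.Solver.:+ m SL.Solver.:* (s SL.Solver.:* y)) L.refl σ (L.- L.1#) (ι s) (comb x) ⟩
      σ L.* comb x L.+ (L.- L.1#) L.* (ι s L.* comb x)
        ≈⟨ L.+-congʳ (L.trans (L.sym (σ-acts x)) (L.trans (comb-cong cx≈sx) (comb-• s x))) ⟩
      ι s L.* comb x L.+ (L.- L.1#) L.* (ι s L.* comb x)
        ≈⟨ SL.x-x _ ⟩
      L.0# ∎

  c-injective : Matrices.Injective K c
  c-injective x cx≈0 = no-eigenvector K.0# x (λ i → K.trans (cx≈0 i) (K.sym (K.zeroˡ _)))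

  c-fixed-free : ∀ x → c ·ᵥ x ≈̇ x → x ≈̇ 0̇
  c-fixed-free x cx≈x = no-eigenvector K.1# x (λ i → K.trans (cx≈x i) (K.sym (K.*-identityˡ _)))

-- The upper bound for the number of factorizations.

module Factorizations {q : ℕ} (K : FiniteField q) {n : ℕ} (c : LinAlg.Mat K n)
  (c-fixed-free : ∀ x → Spans._≈̇_ K (LinAlg._·ᵥ_ K c x) x → Spans._≈̇_ K x (LinAlg.0ᵥ K)) where

  private module K = FiniteField K
  open Spans K
  open Matrices K
  open Kernels K
  open LinAlg K

  Factorization : ℕ → Mat n × Mat n → Set
  Factorization g p = (Invertible (proj₁ p) × Invertible (proj₂ p)) ×
    ((proj₁ p ⊗ proj₂ p) ≈ₘ c × GenusCond g (proj₁ p) (proj₂ p))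

  Fix : Mat n → Vec n → Set
  Fix v x = v ·ᵥ x ≈̇ x

  Agree : Mat n → Vec n → Set
  Agree v x = v ·ᵥ x ≈̇ c ·ᵥ x

  fix⇒ker : ∀ v x → Fix v x → Ker (v −I) x
  fix⇒ker v x e = ≈̇.trans (−I-fixed v x) (λ i → K.trans (K.+-congʳ (e i)) (x-x (x i)))

  ker⇒fix : ∀ v x → Ker (v −I) x → Fix v x
  ker⇒fix v x e i = difference≈0 _ _ (K.trans (K.sym (−I-fixed v x i)) (e i))

  _≈ₚ_ : Mat n × Mat n → Mat n × Mat n → Set
  (u , v) ≈ₚ (u′ , v′) = u ≈ₘ u′ × v ≈ₘ v′

  ≈ₚ-isEquivalence : IsEquivalence _≈ₚ_
  ≈ₚ-isEquivalence = record
    { refl = ≈ₘ.refl , ≈ₘ.refl ; sym = λ (e , e′) → ≈ₘ.sym e , ≈ₘ.sym e′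
    ; trans = λ (e , e′) (f , f′) → ≈ₘ.trans e f , ≈ₘ.trans e′ f′ }

  -- v agrees with c on x exactly when u = c v⁻¹ fixes v x.
  agree-of-fix : ∀ {u v} → Injective v → (u ⊗ v) ≈ₘ c → ∀ {m} → AtLeast _≈̇_ m (Fix u) → AtLeast _≈̇_ m (Agree v)
  agree-of-fix {u} {v} v-inj uv≈c =
    let B , vB , _ = inverse-of v-inj
    in atLeast-map (λ y _ → B ·ᵥ y)
         (λ y uy≈y → ≈̇.trans (vB y) (≈̇.trans (≈̇.sym uy≈y) (≈̇.trans (≈̇.sym (Linear.cong-≈ (mul-linear u) (vB y)))
           (≈̇.trans (≈̇.sym (·-assoc u v (B ·ᵥ y))) (·-congʳ uv≈c (B ·ᵥ y))))))
         (λ y z _ _ e → ≈̇.trans (≈̇.sym (vB y)) (≈̇.trans (Linear.cong-≈ (mul-linear v) e) (vB z)))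

  -- A common vector satisfies c x = v x = x.
  agree-fix-disjoint : ∀ {v} ws ws′ → All (Fix v) ws → All (Agree v) ws′ →
    ∀ {x} → Span ws x → Span ws′ x → x ≈̇ 0̇
  agree-fix-disjoint {v} ws ws′ fix agree {x} s s′ = c-fixed-free x (≈̇.trans
    (≈̇.sym (linear-agree (mul-linear v) (mul-linear c) ws′ agree s′))
    (linear-agree (mul-linear v) id-linear ws fix s))

  _≋₃_ : List (Vec n) × List (Vec n) × List (Vec n) × List (Vec n) →
         List (Vec n) × List (Vec n) × List (Vec n) × List (Vec n) → Set
  _≋₃_ = _⊗~_ {_~_ = _≋_} {_≋_ = _⊗~_ {_~_ = _≋_} {_≋_ = _⊗~_ {_~_ = _≋_} {_≋_ = _≋_}}}

  -- This and the next two lemmas serve the injectivity of the encoding: `v` is the identity on one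
  -- list, equals `c` on the second, and its values on the third are recorded, so equal codes force
  -- equal values on a basis.
  fix-agree : ∀ {v v′ : Mat n} {ws ws′} → ws ≋ ws′ → All (Fix v) ws → All (Fix v′) ws′ → All (λ w → v ·ᵥ w ≈̇ v′ ·ᵥ w) ws
  fix-agree [] [] [] = []
  fix-agree {v} {v′} (e ∷ es) (f ∷ fs) (f′ ∷ fs′) =
    ≈̇.trans f (≈̇.trans e (≈̇.trans (≈̇.sym f′) (Linear.cong-≈ (mul-linear v′) (≈̇.sym e)))) ∷ fix-agree es fs fs′

  agree-agree : ∀ {v v′ : Mat n} {ws ws′} → ws ≋ ws′ → All (Agree v) ws → All (Agree v′) ws′ → All (λ w → v ·ᵥ w ≈̇ v′ ·ᵥ w) ws
  agree-agree [] [] [] = []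
  agree-agree {v} {v′} (e ∷ es) (f ∷ fs) (f′ ∷ fs′) =
    ≈̇.trans f (≈̇.trans (Linear.cong-≈ (mul-linear c) e) (≈̇.trans (≈̇.sym f′) (Linear.cong-≈ (mul-linear v′) (≈̇.sym e)))) ∷ agree-agree es fs fs′

  images-agree : ∀ {v v′ : Mat n} {es es′} → es ≋ es′ → map (v ·ᵥ_) es ≋ map (v′ ·ᵥ_) es′ → All (λ w → v ·ᵥ w ≈̇ v′ ·ᵥ w) es
  images-agree [] [] = []
  images-agree {v} {v′} (e ∷ es) (f ∷ fs) =
    ≈̇.trans f (Linear.cong-≈ (mul-linear v′) (≈̇.sym e)) ∷ images-agree es fs

  left-factor-unique : ∀ {u v u′ v′} → Injective v → (u ⊗ v) ≈ₘ c → (u′ ⊗ v′) ≈ₘ c → v ≈ₘ v′ → u ≈ₘ u′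
  left-factor-unique {u} {v} {u′} {v′} v-inj e e′ v≈v′ =
    let B , vB , _ = inverse-of v-inj
    in matrix-ext λ x → ≈̇.trans (Linear.cong-≈ (mul-linear u) (≈̇.sym (vB x))) (≈̇.trans (≈̇.sym (·-assoc u v _))
         (≈̇.trans (·-congʳ e _) (≈̇.trans (≈̇.sym (·-congʳ e′ _)) (≈̇.trans (·-assoc u′ v′ _)
         (Linear.cong-≈ (mul-linear u′) (≈̇.trans (≈̇.sym (·-congʳ v≈v′ _)) (vB x)))))))

  module _ {a b g : ℕ} (a+b+g≡n : a + b + g ≡ n) where

    WithKernels : Mat n × Mat n → Set
    WithKernels (u , v) = Injective v × (u ⊗ v) ≈ₘ c × AtLeast _≈̇_ (q ^ a) (Fix v) × AtLeast _≈̇_ (q ^ b) (Fix u)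

    private
      fixed : ∀ p → WithKernels p → AtLeast _≋_ (share (q ^ a) a) (λ ws → length ws ≡ a × All (Fix (proj₂ p)) ws × Indep (ws ++ []))
      fixed (u , v) (_ , _ , fix-v , _) = extensions [] fix-v tt (≤-reflexive (+-identityʳ a))

      agreeing : ∀ p → WithKernels p → AtLeast _≋_ (share (q ^ b) b) (λ ws → length ws ≡ b × All (Agree (proj₂ p)) ws × Indep (ws ++ []))
      agreeing (u , v) (v-inj , uv≈c , _ , fix-u) =
        extensions [] (agree-of-fix {u} v-inj uv≈c fix-u) tt (≤-reflexive (+-identityʳ b))

      Config : Set
      Config = ((Mat n × Mat n) × (List (Vec n) × List (Vec n))) × List (Vec n)

      _≈ᶜ_ : Config → Config → Set
      _≈ᶜ_ = _⊗~_ {_~_ = _⊗~_ {_~_ = _≈ₚ_} {_≋_ = _⊗~_ {_~_ = _≋_} {_≋_ = _≋_}}} {_≋_ = _≋_}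

      IsConfig : Config → Set
      IsConfig (((u , v) , (ws , ws′)) , es) = WithKernels (u , v) ×
        (length ws ≡ a × All (Fix v) ws) × (length ws′ ≡ b × All (Agree v) ws′) ×
        length es ≡ g × Indep (es ++ ws ++ ws′)

      -- The two kernel bases are jointly independent by `agree-fix-disjoint`, and a + b + g = n
      -- leaves room for g further vectors.
      configs : ∀ {Y} → AtLeast _≈ₚ_ Y WithKernels →
        AtLeast _≈ᶜ_ (Y * (share (q ^ a) a * share (q ^ b) b) * share (q ^ n) g) IsConfig
      configs many = atLeast-⊆
        (λ { ((p , (ws , ws′)) , es) ((Wp , ((lw , fw , _) , (lw′ , aw′ , _))) , (le , _ , ind)) → Wp , (lw , fw) , (lw′ , aw′) , le , ind })
        (atLeast-Σ (atLeast-Σ many λ p Wp → atLeast-Σ (fixed p Wp) (λ _ _ → agreeing p Wp))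
          λ { (p , (ws , ws′)) (Wp , ((lw , fw , iw) , (lw′ , aw′ , iw′))) →
            extensions {n} {n} {g} (ws ++ ws′) (exact⇒atLeast exactV)
              (indep-++ ws ws′ (indep-++ˡ ws [] iw) (indep-++ˡ ws′ [] iw′) (agree-fix-disjoint ws ws′ fw aw′))
              (≤-reflexive (trans (cong (g +_) (trans (length-++ ws) (cong₂ _+_ lw lw′))) (trans (+-comm g (a + b)) a+b+g≡n))) })

      shapes : Cover _≋₃_ ((q ^ n) ^ a * ((q ^ n) ^ b * ((q ^ n) ^ g * (q ^ n) ^ g)))
        (λ (ws , ws′ , es , fs) → length ws ≡ a × length ws′ ≡ b × length es ≡ g × length fs ≡ g)
      shapes = cover-× (⊗-isEquivalence ≋-isEquivalence (⊗-isEquivalence ≋-isEquivalence ≋-isEquivalence)) (lists-cover a)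
        (cover-× (⊗-isEquivalence ≋-isEquivalence ≋-isEquivalence) (lists-cover b)
        (cover-× ≋-isEquivalence (lists-cover g) (lists-cover g)))

    -- Each factorization contributes q^(a² + b² + n g) configurations up to 64³, one 64 for each of
    -- the three lists. They inject into (qⁿ)^(a + b + 2 g) = (qⁿ)^(n + g) tuples, and (qⁿ)^g
    -- cancels.
    upper-bound-at : ∀ {Y} → AtLeast _≈ₚ_ Y WithKernels → Y * ((q ^ a) ^ a * (q ^ b) ^ b) ≤ loss * (q ^ n) ^ n
    upper-bound-at {Y} many = arith _ _ (share (q ^ a) a) (share (q ^ b) b) (share (q ^ n) g) (share-large (q ^ a) a) (share-large (q ^ b) b) (share-large (q ^ n) g)
      (atLeast≤cover ≋₃-isEquivalence (atLeast-map encode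
          (λ { (((u , v) , (ws , ws′)) , es) (_ , (lw , _) , (lw′ , _) , le , _) → lw , lw′ , le , trans (length-map (v ·ᵥ_) es) le })
          encode-injective (configs many)) shapes)
      where
      ≋₃-isEquivalence : IsEquivalence _≋₃_
      ≋₃-isEquivalence = ⊗-isEquivalence ≋-isEquivalence (⊗-isEquivalence ≋-isEquivalence (⊗-isEquivalence ≋-isEquivalence ≋-isEquivalence))
      encode : ∀ x → IsConfig x → List (Vec n) × List (Vec n) × List (Vec n) × List (Vec n)
      encode (((u , v) , (ws , ws′)) , es) _ = ws , ws′ , es , map (v ·ᵥ_) es
      encode-injective : ∀ x y x∈ y∈ → encode x x∈ ≋₃ encode y y∈ → x ≈ᶜ y
      encode-injective (((u , v) , (ws , ws′)) , es) (((u₂ , v₂) , (ws₂ , ws₂′)) , es₂)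
        ((v-inj , uv≈c , _) , (lw , fw) , (lw′ , aw) , le , ind) ((v₂-inj , uv₂≈c , _) , (_ , fw₂) , (_ , aw₂) , _ , _)
        (ws~ , ws′~ , es~ , fs~) = ((left-factor-unique v-inj uv≈c uv₂≈c v≈v₂ , v≈v₂) , (ws~ , ws′~)) , es~
        where
        v≈v₂ : v ≈ₘ v₂
        v≈v₂ = matrix-ext λ x → linear-agree (mul-linear v) (mul-linear v₂) (es ++ ws ++ ws′)
          (Allₚ.++⁺ (images-agree es~ fs~) (Allₚ.++⁺ (fix-agree ws~ fw fw₂) (agree-agree ws′~ aw aw₂)))
          (full-span (es ++ ws ++ ws′) ind
            (trans (length-++ es) (trans (cong₂ _+_ le (trans (length-++ ws) (cong₂ _+_ lw lw′))) (trans (+-comm g (a + b)) a+b+g≡n))) x)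
      arith : ∀ A B A′ B′ G′ → A ≤ A′ * 64 → B ≤ B′ * 64 → (q ^ n) ^ g ≤ G′ * 64 →
        Y * (A′ * B′) * G′ ≤ (q ^ n) ^ a * ((q ^ n) ^ b * ((q ^ n) ^ g * (q ^ n) ^ g)) →
        Y * (A * B) ≤ loss * (q ^ n) ^ n
      arith A B A′ B′ G′ hA hB hG h = *-cancelʳ-≤ _ _ G {{>-nonZero (m^n>0 X {{>-nonZero (q^>0 n)}} g)}} (begin
        Y * (A * B) * G                        ≤⟨ *-mono-≤ (*-monoʳ-≤ Y (*-mono-≤ hA hB)) hG ⟩
        Y * (A′ * 64 * (B′ * 64)) * (G′ * 64)  ≡⟨ trans (eq₁ 64 Y A′ B′ G′) (loss-* (Y * (A′ * B′) * G′)) ⟩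
        loss * (Y * (A′ * B′) * G′)            ≤⟨ *-monoʳ-≤ loss h ⟩
        loss * (X ^ a * (X ^ b * (G * G)))     ≡⟨ eq₂ loss (X ^ a) (X ^ b) G ⟩
        loss * (X ^ a * X ^ b * G) * G         ≡⟨ cong (λ x → loss * x * G) power ⟩
        loss * X ^ n * G                       ∎)
        where
        open ≤-Reasoning
        X = q ^ n
        G = X ^ g
        power : X ^ a * X ^ b * X ^ g ≡ X ^ n
        power = trans (cong (_* X ^ g) (sym (^-distribˡ-+-* X a b)))
                  (trans (sym (^-distribˡ-+-* X (a + b) g)) (cong (X ^_) a+b+g≡n))
        eq₁ : ∀ k Y A B G → Y * (A * k * (B * k)) * (G * k) ≡ k * k * k * (Y * (A * B) * G)
        eq₁ = solve-∀
        eq₂ : ∀ c A B G → c * (A * (B * (G * G))) ≡ c * (A * B * G) * G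
        eq₂ = solve-∀

  powers : ∀ x y → (q ^ x) ^ x * (q ^ y) ^ y ≡ q ^ (x * x + y * y)
  powers x y = trans (cong₂ _*_ (^-*-assoc q x x) (^-*-assoc q y y)) (sym (^-distribˡ-+-* q (x * x) (y * y)))

  module _ {g s : ℕ} (s+g≡n : s + g ≡ n) (P? : ∀ p → Dec (Factorization g p)) where

    private
      factorizations : List (Mat n × Mat n)
      factorizations = filter P? (cartesianProduct (allMats n) (allMats n))

      key : Mat n × Mat n → ℕ
      key (_ , v) = dimKer (v −I)

      genus : ∀ {p} → Factorization g p → dimKer (proj₁ p −I) + key p ≡ s
      genus {u , v} (_ , _ , e) = +-cancelˡ-≡ g _ _
        (trans (sym (+-assoc g (dimKer (u −I)) (dimKer (v −I)))) (trans e (trans (sym s+g≡n) (+-comm s g))))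

      withKernels : ∀ {p a b} (a+b≡s : a + b ≡ s) → Factorization g p × key p ≡ a →
        WithKernels {a} {b} {g} (trans (cong (_+ g) a+b≡s) s+g≡n) p
      withKernels {u , v} {b = b} a+b≡s (fac@((_ , inv-v) , uv≈c , _) , refl) =
        invertible⇒injective inv-v , uv≈c , atLeast-⊆ (ker⇒fix v) (kernel-atLeast (v −I)) ,
        subst (λ d → AtLeast _≈̇_ (q ^ d) (Fix u))
          (+-cancelʳ-≡ (key (u , v)) (dimKer (u −I)) b (trans (genus fac) (trans (sym a+b≡s) (+-comm (key (u , v)) b))))
          (atLeast-⊆ (ker⇒fix u) (kernel-atLeast (u −I)))

      all-factorizations : All (Factorization g) factorizations
      all-factorizations = Allₚ.all-filter P? (cartesianProduct (allMats n) (allMats n))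

      factorizations-distinct : AllPairs (λ p p′ → ¬ (p ≈ₚ p′)) factorizations
      factorizations-distinct = AllPairsₚ.filter⁺ P?
        (cartesianProduct-distinct (allMats n) (allMats n) (matrices-distinct n) (matrices-distinct n))

      at-key : ∀ a b → (a+b≡s : a + b ≡ s) →
        AtLeast _≈ₚ_ (length (withKey key a factorizations)) (WithKernels {a} {b} {g} (trans (cong (_+ g) a+b≡s) s+g≡n))
      at-key a b a+b≡s = list-atLeast (IsEquivalence.sym ≈ₚ-isEquivalence) (withKey key a factorizations)
        (AllPairsₚ.filter⁺ (λ p → key p ℕₚ.≟ a) factorizations-distinct)
        (All.map (withKernels a+b≡s) (All.zip (Allₚ.filter⁺ (λ p → key p ℕₚ.≟ a) all-factorizations ,
          Allₚ.all-filter (λ p → key p ℕₚ.≟ a) factorizations)))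

      term-bound : ∀ a b → a + b ≡ s →
        length (withKey key a factorizations) * q ^ (a * a + b * b) ≤ loss * (q ^ n) ^ n
      term-bound a b a+b≡s = subst (λ x → length (withKey key a factorizations) * x ≤ loss * (q ^ n) ^ n) (powers a b)
        (upper-bound-at {a} {b} {g} (trans (cong (_+ g) a+b≡s) s+g≡n) (at-key a b a+b≡s))

      by-key : length factorizations ≤ sumTo (λ a → length (withKey key a factorizations)) s
      by-key = length-by-key key {s} factorizations
        (All.map (λ {p} fac → ≤-trans (m≤n+m (key p) (dimKer (proj₁ p −I))) (≤-reflexive (genus fac))) all-factorizations)

    -- Factorizations are sorted by a = dim ker (v - 1); the genus condition then forces dim ker (u
    -- - 1) = s - a.
    upper-bound : q ^ minSq s * length factorizations ≤ 6 * (loss * (q ^ n) ^ n)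
    upper-bound = ≤-trans
      (*-monoʳ-≤ (q ^ minSq s) by-key)
      (sum-bound s (loss * (q ^ n) ^ n) (λ a → length (withKey key a factorizations)) term-bound)

-- The lower bound for the number of factorizations.

module LowerBound {q : ℕ} (K : FiniteField q) {n : ℕ} (c : LinAlg.Mat K n)
  (c-injective : Matrices.Injective K c)
  (c-fixed-free : ∀ x → Spans._≈̇_ K (LinAlg._·ᵥ_ K c x) x → Spans._≈̇_ K x (LinAlg.0ᵥ K)) where

  private module K = FiniteField K
  open Spans K
  open Matrices K
  open Kernels K
  open Factorizations K c c-fixed-free
  open LinAlg K

  -- At a point (x , v x) of the graph these are (v - 1) x and (v - c) x.
  δ₁ δᶜ : Pair {n} → Vec n
  δ₁ p = π₂ p +̇ neg (π₁ p)
  δᶜ p = π₂ p +̇ neg (c ·ᵥ π₁ p)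

  δ₁-linear : Linear δ₁
  δ₁-linear = sub-linear π₂-linear π₁-linear

  δᶜ-linear : Linear δᶜ
  δᶜ-linear = sub-linear π₂-linear (∘-linear (mul-linear c) π₁-linear)

  fixᵍ agreeᵍ : List (Vec n) → List (Pair {n})
  fixᵍ   = map (λ w → ⟨ w , w ⟩)
  agreeᵍ = map (λ z → ⟨ z , c ·ᵥ z ⟩)

  -- The pairs in ps, (w , w) and (z , c z) are to span the graph of v. The first two conditions make v a
  -- bijection; the last two say that v − 1 and v − c have no kernel beyond the spans of ws and zs.
  record Good (zs ws : List (Vec n)) (ps : List (Pair {n})) : Set where
    field
      indep₁ : Indep (map π₁ (ps ++ fixᵍ ws ++ agreeᵍ zs))
      indep₂ : Indep (map π₂ (ps ++ fixᵍ ws ++ agreeᵍ zs))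
      indepᶠ : Indep (map δ₁ (ps ++ agreeᵍ zs))
      indepᵃ : Indep (map δᶜ (ps ++ fixᵍ ws))

  -- On the pairs (z , c z) the map `δ₁` is c - 1, and on the pairs (w , w) the map `δᶜ` is 1 - c;
  -- both are injective, so independence is inherited.
  good-start : ∀ zs ws → Indep (ws ++ zs) → Indep (ws ++ map (c ·ᵥ_) zs) → Good zs ws []
  good-start zs ws ind ind′ = record
    { indep₁ = subst Indep (sym (trans (map-++ π₁ (fixᵍ ws) (agreeᵍ zs)) (cong₂ _++_ (diag ws) (trans (sym (map-∘ zs)) (map-id zs))))) ind
    ; indep₂ = subst Indep (sym (trans (map-++ π₂ (fixᵍ ws) (agreeᵍ zs)) (cong₂ _++_ (diag′ ws) (sym (map-∘ zs))))) ind′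
    ; indepᶠ = subst Indep (map-∘ zs) (indep-map (sub-linear (mul-linear c) id-linear)
        (λ x e → c-fixed-free x (λ i → difference≈0 _ _ (e i))) zs (indep-++ʳ ws zs ind))
    ; indepᵃ = subst Indep (map-∘ ws) (indep-map (sub-linear id-linear (mul-linear c))
        (λ x e → c-fixed-free x (λ i → K.sym (difference≈0 _ _ (e i)))) ws (indep-++ˡ ws zs ind)) }
    where
    diag : ∀ ws → map π₁ (fixᵍ ws) ≡ ws
    diag ws = trans (sym (map-∘ ws)) (map-id ws)
    diag′ : ∀ ws → map π₂ (fixᵍ ws) ≡ ws
    diag′ ws = trans (sym (map-∘ ws)) (map-id ws)

  q^-fits : ∀ k {m l} → k + m ≤ l → q ^ k * q ^ m ≤ q ^ l
  q^-fits k {m} h = ≤-trans (≤-reflexive (sym (^-distribˡ-+-* q k m))) (^-monoʳ-≤ q {{>-nonZero (≤-trans (s≤s z≤n) 2≤q)}} h)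

  module _ {a b g : ℕ} (a+b+g≡n : a + b + g ≡ n) (roomᵃ : a + (g + g) + 1 ≤ n) (roomᵇ : b + (g + g) + 1 ≤ n) where

    -- Both forbidden subspaces are hyperplanes for g = 0 and the last vector, where a union bound
    -- is vacuous if q = 2. Hence the appeal to `outside-both`.
    fixing-step : ∀ zs → length zs ≡ b → ∀ ws k →
      Indep (ws ++ zs) × Indep (ws ++ map (c ·ᵥ_) zs) → suc k + length ws ≡ a →
      ManyOf {_~_ = _≈̇_} (q ^ n) (suc k) (λ w → Indep (w ∷ ws ++ zs) × Indep (w ∷ ws ++ map (c ·ᵥ_) zs))
    fixing-step zs len ws k (ind , ind′) e =
      let t , many , large = outside-both (ws ++ zs) (ws ++ map (c ·ᵥ_) zs) {length ws + b} ind ind′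
            (trans (length-++ ws) (cong (length ws +_) len))
            (trans (length-++ ws) (cong (length ws +_) (trans (length-map (c ·ᵥ_) zs) len)))
      in t , atLeast-⊆ (λ _ (¬s , ¬s′) → (¬s , ind) , (¬s′ , ind′)) many ,
         fraction²⇒³ {q ^ n} {t} (suc k) (fraction² {q ^ n} {q ^ (length ws + b)} {t} (suc k) (q^>0 n)
           (q^-fits (suc k) (≤-trans (≤-reflexive (trans (sym (+-assoc (suc k) (length ws) b)) (cong (_+ b) e)))
              (≤-trans (m≤m+n (a + b) g) (≤-reflexive a+b+g≡n)))) large)

    Bad : List (Vec n) → List (Vec n) → List (Vec n) → Vec n → Vec n → Set
    Bad ys ys₁ ysᶜ e f = Span ys f ⊎ (Span ys₁ (f +̇ neg e) ⊎ Span ysᶜ (f +̇ neg (c ·ᵥ e)))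

    translate-cover : ∀ ys (e : Vec n) → Cover _≈̇_ (q ^ length ys) (λ f → Span ys (f +̇ neg e))
    translate-cover ys e = cover-map (_+̇ e) (λ h i → K.+-congʳ (h i)) ≈̇.trans
      (λ f s → f +̇ neg e , s , λ i → K.sym (difference+ (f i) (e i))) (span-cover ys)

    bad? : ∀ ys ys₁ ysᶜ e f → Dec (Bad ys ys₁ ysᶜ e f)
    bad? ys ys₁ ysᶜ e f = span? ys f ⊎-dec (span? ys₁ (f +̇ neg e) ⊎-dec span? ysᶜ (f +̇ neg (c ·ᵥ e)))

    bad-cover : ∀ ys ys₁ ysᶜ e →
      Cover _≈̇_ (q ^ length ys + (q ^ length ys₁ + q ^ length ysᶜ)) (Bad ys ys₁ ysᶜ e)
    bad-cover ys ys₁ ysᶜ e = cover-∪ (span-cover ys) (cover-∪ (translate-cover ys₁ e) (translate-cover ysᶜ (c ·ᵥ e)))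

    -- With Q = q^(k + 1), the argument has to leave one subspace, a loss of 1 - 1/Q. The value has
    -- to leave a subspace of relative size at most 1/Q and two affine subspaces of total relative
    -- size at most 1/Q², a loss of (1 - 1/Q)².
    pair-step : ∀ zs ws → length zs ≡ b → length ws ≡ a → ∀ ps k → Good zs ws ps → suc k + length ps ≡ g →
      ManyOf {_~_ = _≈̇_} (q ^ n * q ^ n) (suc k) (λ p → Good zs ws (p ∷ ps))
    pair-step zs ws lz lw ps k good e =
      tₑ * t_f ,
      atLeast-map (λ (x , y) _ → ⟨ x , y ⟩)
        (λ { (x , y) ((_ , ¬s) , (_ , ¬bad)) → record
          { indep₁ = ¬s , Good.indep₁ good ; indep₂ = ¬bad ∘ inj₁ , Good.indep₂ good
          ; indepᶠ = ¬bad ∘ inj₂ ∘ inj₁ , Good.indepᶠ good ; indepᵃ = ¬bad ∘ inj₂ ∘ inj₂ , Good.indepᵃ good } })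
        (λ _ _ _ _ h → (λ i → h (inj₁ i)) , (λ i → h (inj₂ i)))
        (atLeast-Σ (atLeast-∸ ≈̇-isEquivalence (span? L₁) (exact⇒atLeast exactV) (span-cover L₁))
          (λ x _ → atLeast-∸ ≈̇-isEquivalence (bad? L₂ Lᶠ Lᵃ x) (exact⇒atLeast exactV) (bad-cover L₂ Lᶠ Lᵃ x))) ,
      arith (q ^ n) tₑ t_f (pow⁻ (suc k)) (q ^ suc k)
        (fraction¹ {q ^ n} {q ^ length L₁} {tₑ} (suc k) (fits L₁ (length-G π₁)) (≤-trans (m≤n+m∸n (q ^ n) (q ^ length L₁)) (≤-reflexive (+-comm _ tₑ))))
        (fraction²-slack {q ^ n} {q ^ length L₂} {q ^ length Lᶠ + q ^ length Lᵃ} {t_f} (suc k) (1≤pow⁻ k)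
          (fits L₂ (length-G π₂)) slack
          (≤-trans (m≤n+m∸n (q ^ n) (q ^ length L₂ + (q ^ length Lᶠ + q ^ length Lᵃ))) (≤-reflexive (+-comm _ t_f))))
      where
      G = ps ++ fixᵍ ws ++ agreeᵍ zs
      L₁ = map π₁ G
      L₂ = map π₂ G
      Lᶠ = map δ₁ (ps ++ agreeᵍ zs)
      Lᵃ = map δᶜ (ps ++ fixᵍ ws)
      tₑ = q ^ n ∸ q ^ length L₁
      t_f = q ^ n ∸ (q ^ length L₂ + (q ^ length Lᶠ + q ^ length Lᵃ))
      length-G : (φ : Pair → Vec n) → length (map φ G) ≡ length ps + (a + b)
      length-G φ = trans (length-map φ G) (trans (length-++ ps) (cong (length ps +_)
        (trans (length-++ (fixᵍ ws)) (cong₂ _+_ (trans (length-map _ ws) lw) (trans (length-map _ zs) lz)))))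
      fits : ∀ (L : List (Vec n)) → length L ≡ length ps + (a + b) → q ^ suc k * q ^ length L ≤ q ^ n
      fits L len = q^-fits (suc k) (≤-reflexive (trans (cong (suc k +_) len) (trans (sym (+-assoc (suc k) (length ps) (a + b)))
        (trans (cong (_+ (a + b)) e) (trans (+-comm g (a + b)) a+b+g≡n)))))
      -- From suc k + length ps = g follows length L + 2 (k + 1) ≤ d + 2 g. The remaining `+ 1` in
      -- the room supplies a factor q ≥ 2, so that two such lists together still fit.
      half : ∀ {d} (L : List (Vec n)) → length L ≡ length ps + d → d + (g + g) + 1 ≤ n →
        2 * (q ^ length L * (q ^ suc k * q ^ suc k)) ≤ q ^ n
      half {d} L len room = begin
        2 * (q ^ length L * (q ^ suc k * q ^ suc k))   ≤⟨ *-monoˡ-≤ _ 2≤q ⟩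
        q * (q ^ length L * (q ^ suc k * q ^ suc k))   ≡⟨ cong (λ x → q * (q ^ length L * x)) (sym (^-distribˡ-+-* q (suc k) (suc k))) ⟩
        q * (q ^ length L * q ^ (suc k + suc k))       ≡⟨ cong (q *_) (sym (^-distribˡ-+-* q (length L) (suc k + suc k))) ⟩
        q ^ suc (length L + (suc k + suc k))           ≡⟨ cong (λ l → q ^ suc (l + (suc k + suc k))) len ⟩
        q ^ suc (length ps + d + (suc k + suc k))      ≡⟨ cong (q ^_) (eq (length ps) d (suc k)) ⟩
        q ^ (d + (suc k + length ps + suc k) + 1)      ≤⟨ ^-monoʳ-≤ q {{>-nonZero (≤-trans (s≤s z≤n) 2≤q)}}
            (≤-trans (+-monoˡ-≤ 1 (+-monoʳ-≤ d (+-mono-≤ (≤-reflexive e) (≤-trans (m≤m+n (suc k) (length ps)) (≤-reflexive e))))) room) ⟩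
        q ^ n                                          ∎
        where
        open ≤-Reasoning
        eq : ∀ l d k → suc (l + d + (k + k)) ≡ d + (k + l + k) + 1
        eq = solve-∀
      slack : (q ^ length Lᶠ + q ^ length Lᵃ) * (q ^ suc k * q ^ suc k) ≤ q ^ n
      slack = *-cancelˡ-≤ 2 (begin
        2 * ((q ^ length Lᶠ + q ^ length Lᵃ) * QQ)   ≡⟨ eq (q ^ length Lᶠ) (q ^ length Lᵃ) QQ ⟩
        2 * (q ^ length Lᶠ * QQ) + 2 * (q ^ length Lᵃ * QQ)
          ≤⟨ +-mono-≤
               (half Lᶠ (trans (length-map δ₁ (ps ++ agreeᵍ zs)) (trans (length-++ ps) (cong (length ps +_) (trans (length-map _ zs) lz)))) roomᵇ)
               (half Lᵃ (trans (length-map δᶜ (ps ++ fixᵍ ws)) (trans (length-++ ps) (cong (length ps +_) (trans (length-map _ ws) lw)))) roomᵃ) ⟩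
        q ^ n + q ^ n                                ≡⟨ cong (q ^ n +_) (sym (+-identityʳ (q ^ n))) ⟩
        2 * q ^ n                                    ∎)
        where
        open ≤-Reasoning
        QQ = q ^ suc k * q ^ suc k
        eq : ∀ x y z → 2 * ((x + y) * z) ≡ 2 * (x * z) + 2 * (y * z)
        eq = solve-∀
      arith : ∀ N s t p Q → N * p ≤ s * Q → N * (p * p) ≤ t * (Q * Q) → N * N * cube p ≤ s * t * cube Q
      arith N s t p Q h h′ = ≤-trans (≤-reflexive (eq N p)) (≤-trans (*-mono-≤ h h′) (≤-reflexive (eq′ s t Q)))
        where
        eq : ∀ N p → N * N * (p * p * p) ≡ N * p * (N * (p * p))
        eq = solve-∀
        eq′ : ∀ s t Q → s * Q * (t * (Q * Q)) ≡ s * t * (Q * Q * Q)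
        eq′ = solve-∀

    Tuple : Set
    Tuple = List (Vec n) × (List (Vec n) × List (Pair {n}))

    _≈ᵗ_ : Tuple → Tuple → Set
    _≈ᵗ_ = _⊗~_ {_~_ = _≋_} {_≋_ = _⊗~_ {_~_ = _≋_} {_≋_ = Pointwise _≈̇_}}

    GoodTuple : Tuple → Set
    GoodTuple (zs , (ws , ps)) = length zs ≡ b × length ws ≡ a × length ps ≡ g × Good zs ws ps

    -- `zs` comes first because the subspaces that `ws` has to avoid are built on `zs` and its image
    -- under `c`.
    good-tuples : AtLeast _≈ᵗ_ (share (q ^ n) b * (share (q ^ n) a * share (q ^ n * q ^ n) g)) GoodTuple
    good-tuples = atLeast-⊆ (λ (zs , (ws , ps)) ((lz , _) , ((lw , _) , (lp , good))) → lz , lw , lp , good)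
      (atLeast-Σ {P = λ zs → length zs ≡ b × All (λ _ → ⊤) zs × Indep (zs ++ [])}
        (extensions {n} {n} {b} [] (exact⇒atLeast exactV) tt
          (≤-trans (≤-reflexive (+-identityʳ b)) (≤-trans (m≤n+m b a) (≤-trans (m≤m+n (a + b) g) (≤-reflexive a+b+g≡n)))))
        λ zs (lz , _ , ind) → atLeast-Σ
          {P = λ ws → length ws ≡ a × Indep (ws ++ zs) × Indep (ws ++ map (c ·ᵥ_) zs)}
          {R = λ ws ps → length ps ≡ g × Good zs ws ps}
          (sequences (λ ws → Indep (ws ++ zs) × Indep (ws ++ map (c ·ᵥ_) zs))
            (indep-++ˡ zs [] ind , indep-map (mul-linear c) c-injective zs (indep-++ˡ zs [] ind)) (fixing-step zs lz))
          λ ws (lw , ind₁ , ind₂) → sequences (Good zs ws) (good-start zs ws ind₁ ind₂) (pair-step zs ws lz lw))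

    module Recover (zs ws : List (Vec n)) (ps : List (Pair {n}))
      (lz : length zs ≡ b) (lw : length ws ≡ a) (lp : length ps ≡ g) (good : Good zs ws ps) where

      open Good good

      G : List (Pair {n})
      G = ps ++ fixᵍ ws ++ agreeᵍ zs

      length-G : length G ≡ n
      length-G = trans (length-++ ps) (trans (cong₂ _+_ lp (trans (length-++ (fixᵍ ws))
        (cong₂ _+_ (trans (length-map _ ws) lw) (trans (length-map _ zs) lz)))) (trans (+-comm g (a + b)) a+b+g≡n))

      v : Mat n
      v = proj₁ (linear-from-graph G indep₁ length-G)

      on-graph : ∀ x → Span G ⟨ x , v ·ᵥ x ⟩
      on-graph = proj₁ (proj₂ (linear-from-graph G indep₁ length-G))

      value : All (λ p → v ·ᵥ π₁ p ≈̇ π₂ p) G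
      value = All.map (λ {p} s → proj₂ (proj₂ (linear-from-graph G indep₁ length-G)) s) (span-members G)

      v-injective : Injective v
      v-injective = graph-injective G indep₂ on-graph

      v⁻ : Mat n
      v⁻ = proj₁ (inverse-of v-injective)

      v-v⁻ : ∀ x → v ·ᵥ (v⁻ ·ᵥ x) ≈̇ x
      v-v⁻ = proj₁ (proj₂ (inverse-of v-injective))

      v⁻-v : ∀ x → v⁻ ·ᵥ (v ·ᵥ x) ≈̇ x
      v⁻-v = proj₂ (proj₂ (inverse-of v-injective))

      u : Mat n
      u = c ⊗ v⁻

      u-v : ∀ x → u ·ᵥ (v ·ᵥ x) ≈̇ c ·ᵥ x
      u-v x = ≈̇.trans (·-assoc c v⁻ (v ·ᵥ x)) (Linear.cong-≈ (mul-linear c) (v⁻-v x))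

      uv≈c : (u ⊗ v) ≈ₘ c
      uv≈c = matrix-ext λ x → ≈̇.trans (·-assoc u v x) (u-v x)

      u-injective : Injective u
      u-injective x ux≈0 = ≈̇.trans (≈̇.sym (v-v⁻ x)) (≈̇.trans (Linear.cong-≈ (mul-linear v)
        (c-injective (v⁻ ·ᵥ x) (≈̇.trans (≈̇.sym (·-assoc c v⁻ x)) ux≈0))) (Linear.0-homo (mul-linear v)))

      -- φ vanishes on `B` and is injective on the span of `A ++ C`, so the part of a kernel element
      -- outside `B` is zero.
      confined : ∀ {φ : Pair → Vec n} → Linear φ → ∀ (A B C : List (Pair {n})) → All (λ p → φ p ≈̇ 0̇) B →
        Indep (map φ (A ++ C)) → ∀ {p} → Span (A ++ B ++ C) p → φ p ≈̇ 0̇ → Span B p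
      confined lin A B C zero-B ind {p} s φp≈0 =
        let h , r , sh , sr , e = span-++⁻ A (B ++ C) s
            k , l , sk , sl , e′ = span-++⁻ B C sr
            φk≈0 = linear-agree lin 0-linear B zero-B sk
            p≈ : p ≈̇ (h +̇ l) +̇ k
            p≈ i = K.trans (e i) (K.trans (K.+-congˡ (K.trans (e′ i) (K.+-comm _ _))) (K.sym (K.+-assoc _ _ _)))
            φ-outer≈0 = λ j → K.trans (K.sym (K.trans (Linear.cong-≈ lin p≈ j)
              (K.trans (Linear.+-homo lin (h +̇ l) k j) (K.trans (K.+-congˡ (φk≈0 j)) (K.+-identityʳ _))))) (φp≈0 j)
            outer≈0 = indep-map⇒injective lin (A ++ C) ind
              (span-+ (A ++ C) (span-++⁺ˡ A C sh) (span-++ʳ A C sl)) φ-outer≈0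
        in span-resp B (λ i → K.sym (K.trans (p≈ i) (K.trans (K.+-congʳ (outer≈0 i)) (K.+-identityˡ _)))) sk

      values-of : (xs : List (Vec n)) (φ : Vec n → Vec n) →
        All (λ p → v ·ᵥ π₁ p ≈̇ π₂ p) (map (λ x → ⟨ x , φ x ⟩) xs) → All (λ x → v ·ᵥ x ≈̇ φ x) xs
      values-of xs φ = Allₚ.map⁻

      ws-fixed : All (Fix v) ws
      ws-fixed = values-of ws id (Allₚ.++⁻ˡ (fixᵍ ws) (Allₚ.++⁻ʳ ps value))

      zs-agree : All (Agree v) zs
      zs-agree = values-of zs (c ·ᵥ_) (Allₚ.++⁻ʳ (fixᵍ ws) (Allₚ.++⁻ʳ ps value))

      fixed-span : ∀ x → Fix v x → Span ws x
      fixed-span x vx≈x = subst (λ L → Span L x) (trans (sym (map-∘ ws)) (map-id ws)) (span-map π₁-linear (fixᵍ ws)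
        (confined δ₁-linear ps (fixᵍ ws) (agreeᵍ zs) (Allₚ.map⁺ (All.universal (λ w i → x-x (w i)) ws)) indepᶠ
          (on-graph x) (λ i → K.trans (K.+-congʳ (vx≈x i)) (x-x (x i)))))

      agree-span : ∀ x → Agree v x → Span zs x
      agree-span x vx≈cx = subst (λ L → Span L x) (trans (sym (map-∘ zs)) (map-id zs)) (span-map π₁-linear (agreeᵍ zs)
        (confined δᶜ-linear (ps ++ fixᵍ ws) (agreeᵍ zs) [] (Allₚ.map⁺ (All.universal (λ z i → x-x _) zs))
          (subst (λ L → Indep (map δᶜ L)) (sym (++-identityʳ (ps ++ fixᵍ ws))) indepᵃ)
          (subst (λ L → Span L ⟨ x , v ·ᵥ x ⟩) (trans (sym (++-assoc ps (fixᵍ ws) (agreeᵍ zs)))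
            (cong ((ps ++ fixᵍ ws) ++_) (sym (++-identityʳ (agreeᵍ zs))))) (on-graph x))
          (λ i → K.trans (K.+-congʳ (vx≈cx i)) (x-x _))))

      ind : Indep (ws ++ zs)
      ind = subst Indep (trans (map-++ π₁ (fixᵍ ws) (agreeᵍ zs))
          (cong₂ _++_ (trans (sym (map-∘ ws)) (map-id ws)) (trans (sym (map-∘ zs)) (map-id zs))))
        (indep-++ʳ (map π₁ ps) _ (subst Indep (map-++ π₁ ps (fixᵍ ws ++ agreeᵍ zs)) indep₁))

      dim-v : dimKer (v −I) ≡ a
      dim-v = dimKer-unique (v −I)
        (subst (λ d → AtLeast _≈̇_ (q ^ d) (Ker (v −I))) lw (atLeast-⊆
          (λ x s → fix⇒ker v x (linear-agree (mul-linear v) id-linear ws ws-fixed s)) (span-atLeast ws (indep-++ˡ ws zs ind))))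
        (subst (λ d → Cover _≈̇_ (q ^ d) (Ker (v −I))) lw (cover-⊆ (λ x s → fixed-span x (ker⇒fix v x s)) (span-cover ws)))

      fix-of-agree : ∀ x → Agree v x → Fix u (v ·ᵥ x)
      fix-of-agree x vx≈cx = ≈̇.trans (u-v x) (≈̇.sym vx≈cx)

      agree-of-fix′ : ∀ y → Fix u y → Agree v (v⁻ ·ᵥ y)
      agree-of-fix′ y uy≈y = ≈̇.trans (v-v⁻ y) (≈̇.trans (≈̇.sym uy≈y) (·-assoc c v⁻ y))

      -- `v` maps the space where v agrees with c bijectively onto the fixed space of u, and the
      -- former is the span of `zs`.
      dim-u : dimKer (u −I) ≡ b
      dim-u = dimKer-unique (u −I)
        (subst (λ d → AtLeast _≈̇_ (q ^ d) (Ker (u −I))) lz (atLeast-map (λ x _ → v ·ᵥ x)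
          (λ x s → fix⇒ker u (v ·ᵥ x) (fix-of-agree x (linear-agree (mul-linear v) (mul-linear c) zs zs-agree s)))
          (λ x y _ _ e → ≈̇.trans (≈̇.sym (v⁻-v x)) (≈̇.trans (Linear.cong-≈ (mul-linear v⁻) e) (v⁻-v y)))
          (span-atLeast zs (indep-++ʳ ws zs ind))))
        (subst (λ d → Cover _≈̇_ (q ^ d) (Ker (u −I))) lz (cover-map (v ·ᵥ_) (Linear.cong-≈ (mul-linear v)) ≈̇.trans
          (λ y s → v⁻ ·ᵥ y , agree-span (v⁻ ·ᵥ y) (agree-of-fix′ y (ker⇒fix u y s)) , ≈̇.sym (v-v⁻ y))
          (span-cover zs)))

      factorization : Factorization g (u , v)
      factorization = (injective⇒invertible u-injective , injective⇒invertible v-injective) , uv≈c ,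
        trans (cong₂ (λ x y → g + x + y) dim-u dim-v) (trans (eq a b g) a+b+g≡n)
        where
        eq : ∀ a b g → g + b + a ≡ a + b + g
        eq = solve-∀

    module _ (P? : ∀ p → Dec (Factorization g p)) where

      private
        factorizations : List (Mat n × Mat n)
        factorizations = filter P? (cartesianProduct (allMats n) (allMats n))

      factorization-resp : ∀ {p p′} → p ≈ₚ p′ → Factorization g p → Factorization g p′
      factorization-resp (u≈ , v≈) ((inv-u , inv-v) , uv≈c , e) =
        (injective⇒invertible (injective-resp u≈ (invertible⇒injective inv-u)) ,
         injective⇒invertible (injective-resp v≈ (invertible⇒injective inv-v))) ,
        ≈ₘ.trans (λ i j → Σ-cong {n} (λ k → K.*-cong (K.sym (u≈ i k)) (K.sym (v≈ k j)))) uv≈c ,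
        trans (cong₂ (λ x y → g + x + y) (dimKer-cong (λ i j → K.+-congʳ (K.sym (u≈ i j))))
                                         (dimKer-cong (λ i j → K.+-congʳ (K.sym (v≈ i j))))) e

      factorizations-cover : Cover _≈ₚ_ (length factorizations) (Factorization g)
      factorizations-cover = list-cover factorizations λ p fac → filter-complete P? factorization-resp fac
        (Anyₚ.cartesianProduct⁺ {P = λ u → proj₁ p ≈ₘ u} {Q = λ v → proj₂ p ≈ₘ v} (matrix-listed (proj₁ p)) (matrix-listed (proj₂ p)))

      Lists : Set
      Lists = List (Vec n) × (List (Vec n) × List (Vec n))

      _≋³_ : Lists → Lists → Set
      _≋³_ = _⊗~_ {_~_ = _≋_} {_≋_ = _⊗~_ {_~_ = _≋_} {_≋_ = _≋_}}

      ≋³-isEquivalence : IsEquivalence _≋³_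
      ≋³-isEquivalence = ⊗-isEquivalence ≋-isEquivalence (⊗-isEquivalence ≋-isEquivalence ≋-isEquivalence)

      Carries : Mat n × Mat n → Lists → Set
      Carries (u , v) (zs , (ws , es)) = (Factorization g (u , v) × dimKer (v −I) ≡ a × dimKer (u −I) ≡ b) ×
        ((length zs ≡ b × All (Agree v) zs) × ((length ws ≡ a × All (Fix v) ws) × length es ≡ g))

      carries-resp : ∀ {p p′ x} → p ≈ₚ p′ → Carries p x → Carries p′ x
      carries-resp {u , v} {u′ , v′} (u≈ , v≈) ((fac , dv , du) , ((lz , az) , ((lw , fw) , le))) =
        (factorization-resp (u≈ , v≈) fac , trans (dimKer-cong (λ i j → K.+-congʳ (K.sym (v≈ i j)))) dv ,
          trans (dimKer-cong (λ i j → K.+-congʳ (K.sym (u≈ i j)))) du) ,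
        ((lz , All.map (λ {z} e → ≈̇.trans (≈̇.sym (·-congʳ v≈ z)) e) az) ,
         ((lw , All.map (λ {w} e → ≈̇.trans (≈̇.sym (·-congʳ v≈ w)) e) fw) , le))

      agree-cover : ∀ {u v m} → Injective v → (u ⊗ v) ≈ₘ c → Cover _≈̇_ m (Fix u) → Cover _≈̇_ m (Agree v)
      agree-cover {u} {v} v-inj uv≈c =
        let B , _ , Bv = inverse-of v-inj
        in cover-map (B ·ᵥ_) (Linear.cong-≈ (mul-linear B)) ≈̇.trans
             (λ x e → v ·ᵥ x , ≈̇.trans (≈̇.sym (·-assoc u v x)) (≈̇.trans (·-congʳ uv≈c x) (≈̇.sym e)) , ≈̇.sym (Bv x))

      carried : ∀ p → Cover _≋³_ ((q ^ b) ^ b * ((q ^ a) ^ a * (q ^ n) ^ g)) (Carries p)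
      carried (u , v) with P? (u , v) ×-dec ((dimKer (v −I) ℕₚ.≟ a) ×-dec (dimKer (u −I) ℕₚ.≟ b))
      -- A pair without the required properties carries nothing, so any family of the right size
      -- covers its fibre.
      ... | no ¬h = cover (λ _ → [] , ([] , [])) λ _ (h , _) → ⊥-elim (¬h h)
      ... | yes (((_ , inv-v) , uv≈c , _) , dv , du) = cover-⊆ (λ _ → proj₂)
        (cover-× (⊗-isEquivalence ≋-isEquivalence ≋-isEquivalence)
          (cover-lists (agree-cover {u} (invertible⇒injective inv-v) uv≈c (subst (λ d → Cover _≈̇_ (q ^ d) (Fix u)) du
            (cover-⊆ (fix⇒ker u) (kernel-cover (u −I))))) b)
          (cover-× ≋-isEquivalence
            (cover-lists (subst (λ d → Cover _≈̇_ (q ^ d) (Fix v)) dv (cover-⊆ (fix⇒ker v) (kernel-cover (v −I)))) a)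
            (lists-cover g)))

      pairs-determined : ∀ {v v′ : Mat n} {ps ps′} → v ≈ₘ v′ → All (λ p → v ·ᵥ π₁ p ≈̇ π₂ p) ps → All (λ p → v′ ·ᵥ π₁ p ≈̇ π₂ p) ps′ →
        map π₁ ps ≋ map π₁ ps′ → Pointwise _≈̇_ ps ps′
      pairs-determined {ps = []}    {[]}      v≈ [] [] [] = []
      pairs-determined {v} {v′} {p ∷ ps} {p′ ∷ ps′} v≈ (e ∷ es) (e′ ∷ es′) (h ∷ hs) =
        (λ { (inj₁ i) → h i
           ; (inj₂ i) → K.trans (K.sym (e i)) (K.trans (Linear.cong-≈ (mul-linear v) h i) (K.trans (·-congʳ v≈ (π₁ p′) i) (e′ i))) })
        ∷ pairs-determined v≈ es es′ hs

      -- The second components of `ps` are values of `v` and are dropped; this saves a factor (qⁿ)^g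
      -- in the number of lists that one factorization can carry.
      encode : ∀ x → GoodTuple x → (Mat n × Mat n) × Lists
      encode (zs , (ws , ps)) (lz , lw , lp , good) = (R.u , R.v) , (zs , (ws , map π₁ ps))
        where module R = Recover zs ws ps lz lw lp good

      encode-carries : ∀ x x∈ → Factorization g (proj₁ (encode x x∈)) × Carries (proj₁ (encode x x∈)) (proj₂ (encode x x∈))
      encode-carries (zs , (ws , ps)) (lz , lw , lp , good) =
        R.factorization , (R.factorization , R.dim-v , R.dim-u) , ((lz , R.zs-agree) , ((lw , R.ws-fixed) , trans (length-map π₁ ps) lp))
        where module R = Recover zs ws ps lz lw lp good

      encode-injective : ∀ x y x∈ y∈ → (_⊗~_ {_~_ = _≈ₚ_} {_≋_ = _≋³_}) (encode x x∈) (encode y y∈) → x ≈ᵗ y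
      encode-injective (zs , (ws , ps)) (zs′ , (ws′ , ps′)) (lz , lw , lp , good) (lz′ , lw′ , lp′ , good′)
        ((u≈ , v≈) , (zs≈ , (ws≈ , es≈))) =
        zs≈ , (ws≈ , pairs-determined v≈ (Allₚ.++⁻ˡ ps R.value) (Allₚ.++⁻ˡ ps′ R′.value) es≈)
        where module R = Recover zs ws ps lz lw lp good
              module R′ = Recover zs′ ws′ ps′ lz′ lw′ lp′ good′

      tuples≤ : share (q ^ n) b * (share (q ^ n) a * share (q ^ n * q ^ n) g) ≤
        length factorizations * ((q ^ b) ^ b * ((q ^ a) ^ a * (q ^ n) ^ g))
      tuples≤ = atLeast≤cover (⊗-isEquivalence ≈ₚ-isEquivalence ≋³-isEquivalence)
        (atLeast-map {P = GoodTuple} {Q = λ (p , x) → Factorization g p × Carries p x} encode encode-carries encode-injective good-tuples)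
        (cover-Σ {R = Carries} (IsEquivalence.trans ≋³-isEquivalence) (λ {_} {_} {x} → carries-resp {x = x}) factorizations-cover (λ i → carried _))

      -- There are (qⁿ)^(a + b + 2 g) = (qⁿ)^(n + g) tuples up to 64³, and each factorization
      -- accounts for at most q^(a² + b²) (qⁿ)^g of them.
      lower-bound : (q ^ n) ^ n ≤ loss * (length factorizations * q ^ (a * a + b * b))
      lower-bound = subst (λ x → (q ^ n) ^ n ≤ loss * (length factorizations * x)) (powers a b)
        (arith (share X b) (share X a) (share (X * X) g) ((q ^ a) ^ a) ((q ^ b) ^ b) (length factorizations)
          (share-large X b) (share-large X a) (share-large (X * X) g) tuples≤)
        where
        X = q ^ n
        arith : ∀ B′ A′ G′ A B F → X ^ b ≤ B′ * 64 → X ^ a ≤ A′ * 64 → (X * X) ^ g ≤ G′ * 64 →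
          B′ * (A′ * G′) ≤ F * (B * (A * X ^ g)) → X ^ n ≤ loss * (F * (A * B))
        arith B′ A′ G′ A B F hB hA hG h = *-cancelʳ-≤ _ _ (X ^ g) {{>-nonZero (m^n>0 X {{>-nonZero (q^>0 n)}} g)}} (begin
          X ^ n * X ^ g                        ≡⟨ cong (_* X ^ g) (sym power) ⟩
          X ^ a * X ^ b * X ^ g * X ^ g        ≡⟨ eq₁ (X ^ a) (X ^ b) (X ^ g) ⟩
          X ^ b * (X ^ a * (X ^ g * X ^ g))    ≡⟨ cong (λ x → X ^ b * (X ^ a * x)) (sym (square-^ X g)) ⟩
          X ^ b * (X ^ a * (X * X) ^ g)        ≤⟨ *-mono-≤ hB (*-mono-≤ hA hG) ⟩
          B′ * 64 * (A′ * 64 * (G′ * 64))      ≡⟨ trans (eq₂ 64 A′ B′ G′) (loss-* (B′ * (A′ * G′))) ⟩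
          loss * (B′ * (A′ * G′))              ≤⟨ *-monoʳ-≤ loss h ⟩
          loss * (F * (B * (A * X ^ g)))       ≡⟨ eq₃ loss F A B (X ^ g) ⟩
          loss * (F * (A * B)) * X ^ g         ∎)
          where
          open ≤-Reasoning
          power : X ^ a * X ^ b * X ^ g ≡ X ^ n
          power = trans (cong (_* X ^ g) (sym (^-distribˡ-+-* X a b)))
                    (trans (sym (^-distribˡ-+-* X (a + b) g)) (cong (X ^_) a+b+g≡n))
          eq₁ : ∀ x y z → x * y * z * z ≡ y * (x * (z * z))
          eq₁ = solve-∀
          eq₂ : ∀ k A B G → B * k * (A * k * (G * k)) ≡ k * k * k * (B * (A * G))
          eq₂ = solve-∀
          eq₃ : ∀ c F A B z → c * (F * (B * (A * z))) ≡ c * (F * (A * B)) * z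
          eq₃ = solve-∀

-- Exponent arithmetic and the squared estimates.

module Asymptotics {q : ℕ} (2≤q : 2 ≤ q) where

  open Sequences 2≤q

  -- The parallelogram identity 2 n² + 2 g² = (n + g)² + (n - g)², with s = n - g.
  exponents : ∀ {n s} g → s + g ≡ n →
    ((q ^ n) ^ n * (q ^ n) ^ n) * ((q ^ g) ^ g * (q ^ g) ^ g) ≡ q ^ ((n + g) * (n + g)) * q ^ (s * s)
  exponents {s = s} g refl = begin
    (q ^ (s + g)) ^ (s + g) * (q ^ (s + g)) ^ (s + g) * ((q ^ g) ^ g * (q ^ g) ^ g)
      ≡⟨ cong₂ (λ x y → x * x * (y * y)) (^-*-assoc q (s + g) (s + g)) (^-*-assoc q g g) ⟩
    q ^ ((s + g) * (s + g)) * q ^ ((s + g) * (s + g)) * (q ^ (g * g) * q ^ (g * g))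
      ≡⟨ cong₂ _*_ (sym (^-distribˡ-+-* q ((s + g) * (s + g)) ((s + g) * (s + g)))) (sym (^-distribˡ-+-* q (g * g) (g * g))) ⟩
    q ^ ((s + g) * (s + g) + (s + g) * (s + g)) * q ^ (g * g + g * g)
      ≡⟨ sym (^-distribˡ-+-* q ((s + g) * (s + g) + (s + g) * (s + g)) (g * g + g * g)) ⟩
    q ^ ((s + g) * (s + g) + (s + g) * (s + g) + (g * g + g * g))
      ≡⟨ cong (q ^_) (eq s g) ⟩
    q ^ ((s + g + g) * (s + g + g) + s * s)
      ≡⟨ ^-distribˡ-+-* q ((s + g + g) * (s + g + g)) (s * s) ⟩
    q ^ ((s + g + g) * (s + g + g)) * q ^ (s * s) ∎
    where
    open ≡-Reasoning
    eq : ∀ s g → (s + g) * (s + g) + (s + g) * (s + g) + (g * g + g * g) ≡ (s + g + g) * (s + g + g) + s * s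
    eq = solve-∀

  squared-upper : ∀ {n s g N L} C → s + g ≡ n → q ^ minSq s * N ≤ C * (q ^ n) ^ n → L ≤ (q ^ g) ^ g →
    (1 * 1) * ((N * N) * (L * L)) ≤ (C * C) * q ^ ((n + g) * (n + g))
  squared-upper {n} {s} {g} {N} {L} C s+g≡n hN hL = *-cancelʳ-≤ _ _ (q ^ (s * s)) {{>-nonZero (q^>0 (s * s))}} (begin
    1 * 1 * (N * N * (L * L)) * q ^ (s * s)     ≤⟨ *-monoʳ-≤ (1 * 1 * (N * N * (L * L)))
        (^-monoʳ-≤ q {{>-nonZero (≤-trans (s≤s z≤n) 2≤q)}} (sq≤2minSq s)) ⟩
    1 * 1 * (N * N * (L * L)) * q ^ (m + m)     ≡⟨ cong (1 * 1 * (N * N * (L * L)) *_) (^-distribˡ-+-* q m m) ⟩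
    1 * 1 * (N * N * (L * L)) * (q ^ m * q ^ m) ≡⟨ eq₁ N L (q ^ m) ⟩
    q ^ m * N * (q ^ m * N) * (L * L)           ≤⟨ *-mono-≤ (*-mono-≤ hN hN) (*-mono-≤ hL hL) ⟩
    C * X * (C * X) * (G * G)                   ≡⟨ eq₂ C X G ⟩
    C * C * (X * X * (G * G))                   ≡⟨ cong (C * C *_) (exponents g s+g≡n) ⟩
    C * C * (q ^ ((n + g) * (n + g)) * q ^ (s * s)) ≡⟨ sym (*-assoc (C * C) _ _) ⟩
    C * C * q ^ ((n + g) * (n + g)) * q ^ (s * s) ∎)
    where
    open ≤-Reasoning
    m = minSq s
    X = (q ^ n) ^ n
    G = (q ^ g) ^ g
    eq₁ : ∀ N L M → 1 * 1 * (N * N * (L * L)) * (M * M) ≡ M * N * (M * N) * (L * L)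
    eq₁ = solve-∀
    eq₂ : ∀ C X G → C * X * (C * X) * (G * G) ≡ C * C * (X * X * (G * G))
    eq₂ = solve-∀

  squared-lower : ∀ {n s g N L} C D → s + g ≡ n → (q ^ n) ^ n ≤ C * (N * q ^ minSq s) → (q ^ g) ^ g ≤ L * D →
    (1 * 1) * q ^ ((n + g) * (n + g)) ≤ (C * D * q * (C * D * q)) * ((N * N) * (L * L))
  squared-lower {n} {s} {g} {N} {L} C D s+g≡n hN hL = *-cancelʳ-≤ _ _ (q ^ (s * s)) {{>-nonZero (q^>0 (s * s))}} (begin
    1 * 1 * q ^ ((n + g) * (n + g)) * q ^ (s * s) ≡⟨ cong (_* q ^ (s * s)) (*-identityˡ (q ^ ((n + g) * (n + g)))) ⟩
    q ^ ((n + g) * (n + g)) * q ^ (s * s)         ≡⟨ sym (exponents g s+g≡n) ⟩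
    X * X * (G * G)                               ≤⟨ *-mono-≤ (*-mono-≤ hN hN) (*-mono-≤ hL hL) ⟩
    C * (N * M) * (C * (N * M)) * (L * D * (L * D)) ≡⟨ eq₁ C D N L M ⟩
    C * D * (C * D) * (N * N * (L * L)) * (M * M) ≤⟨ *-monoʳ-≤ (C * D * (C * D) * (N * N * (L * L))) M²≤ ⟩
    C * D * (C * D) * (N * N * (L * L)) * (q ^ (s * s) * (q * q)) ≡⟨ eq₂ C D N L q (q ^ (s * s)) ⟩
    C * D * q * (C * D * q) * (N * N * (L * L)) * q ^ (s * s) ∎)
    where
    open ≤-Reasoning
    M = q ^ minSq s
    X = (q ^ n) ^ n
    G = (q ^ g) ^ g
    M²≤ : M * M ≤ q ^ (s * s) * (q * q)
    M²≤ = begin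
      M * M                      ≡⟨ sym (^-distribˡ-+-* q (minSq s) (minSq s)) ⟩
      q ^ (minSq s + minSq s)    ≤⟨ ^-monoʳ-≤ q {{>-nonZero (≤-trans (s≤s z≤n) 2≤q)}} (2minSq≤sq+1 s) ⟩
      q ^ (s * s + 1)            ≡⟨ ^-distribˡ-+-* q (s * s) 1 ⟩
      q ^ (s * s) * q ^ 1        ≡⟨ cong (q ^ (s * s) *_) (^-identityʳ q) ⟩
      -- The rounding in `minSq` costs one factor q; the second makes the constant a perfect square.
      q ^ (s * s) * q            ≤⟨ *-monoʳ-≤ (q ^ (s * s)) (m≤m*n q q {{>-nonZero (≤-trans (s≤s z≤n) 2≤q)}}) ⟩
      q ^ (s * s) * (q * q)      ∎
    eq₁ : ∀ C D N L M → C * (N * M) * (C * (N * M)) * (L * D * (L * D)) ≡ C * D * (C * D) * (N * N * (L * L)) * (M * M)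
    eq₁ = solve-∀
    eq₂ : ∀ C D N L q S → C * D * (C * D) * (N * N * (L * L)) * (S * (q * q)) ≡ C * D * q * (C * D * q) * (N * N * (L * L)) * S
    eq₂ = solve-∀

  -- The origin of the threshold 3 g + 3: it is exactly what is missing when `h` is as large as (s +
  -- 1) / 2.
  half-room : ∀ {n s} g → s + g ≡ n → 3 * g + 3 ≤ n → ∀ {h} → h + h ≤ s + 1 → h + (g + g) + 1 ≤ n
  half-room {n} {s} g s+g≡n large {h} h+h≤ = *-cancelˡ-≤ 2 (begin
    2 * (h + (g + g) + 1)      ≡⟨ eq₁ h g ⟩
    h + h + (4 * g + 2)        ≤⟨ +-monoˡ-≤ (4 * g + 2) h+h≤ ⟩
    s + 1 + (4 * g + 2)        ≡⟨ eq₃ s g ⟩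
    s + g + (3 * g + 3)        ≤⟨ +-mono-≤ (≤-reflexive s+g≡n) large ⟩
    n + n                      ≡⟨ cong (n +_) (sym (+-identityʳ n)) ⟩
    2 * n                      ∎)
    where
    open ≤-Reasoning
    eq₁ : ∀ h g → 2 * (h + (g + g) + 1) ≡ h + h + (4 * g + 2)
    eq₁ = solve-∀
    eq₃ : ∀ s g → s + 1 + (4 * g + 2) ≡ s + g + (3 * g + 3)
    eq₃ = solve-∀

-- Squaring N |GL_g| keeps q^((n + g)² / 2) among the integers; the implicit constants are a₁ / b₁
-- and a₂ / b₂, chosen before g.
theorem5p1 : (q : ℕ) (K : FiniteField q) →
    Σ ℕ λ a₁ → Σ ℕ λ b₁ → Σ ℕ λ a₂ → Σ ℕ λ b₂ →
    0 < a₁ × 0 < b₁ × 0 < a₂ × 0 < b₂ ×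
    ((g : ℕ) → Σ ℕ λ n₀ → (n : ℕ) → 1 ≤ n → n₀ ≤ n →
    (c : LinAlg.Mat K n) → RegularElliptic K n c →
    (a₁ * a₁) * q ^ ((n + g) * (n + g))
    ≤ (b₁ * b₁) * ((LinAlg.N K g c * LinAlg.N K g c) * (LinAlg.∣GL∣ K g * LinAlg.∣GL∣ K g))
    × (b₂ * b₂) * ((LinAlg.N K g c * LinAlg.N K g c) * (LinAlg.∣GL∣ K g * LinAlg.∣GL∣ K g))
    ≤ (a₂ * a₂) * q ^ ((n + g) * (n + g)))
theorem5p1 q K =
  -- Below: `loss` from `lower-bound`, 64 from the order of GL, q from rounding s² / 2. Above: 6
  -- from the sum over a + b = s, `loss` from a single term.
  1 , loss * 64 * q , 6 * loss , 1 ,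
  s≤s z≤n , *-mono-< (*-mono-< loss>0 (s≤s z≤n)) (≤-trans (s≤s z≤n) 2≤q) , *-mono-< {0} {6} (s≤s z≤n) loss>0 , s≤s z≤n ,
  λ g → 3 * g + 3 , λ n _ n₀≤n c elliptic → bounds g n n₀≤n c elliptic
  where
  open Spans K using (2≤q)
  open Asymptotics 2≤q
  open Sequences 2≤q using (minSq; minSq-halves)
  open Kernels K using (∣GL∣-upper; ∣GL∣-lower)

  module _ (g n : ℕ) (n₀≤n : 3 * g + 3 ≤ n) (c : LinAlg.Mat K n) (elliptic : RegularElliptic K n c) where

    open Elliptic K c elliptic (≤-trans (≤-trans (n≤1+n 2) (m≤n+m 3 (3 * g))) n₀≤n) using (c-injective; c-fixed-free)

    s a b : ℕ
    s = n ∸ g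
    a = ⌈ s /2⌉
    b = ⌊ s /2⌋

    s+g≡n : s + g ≡ n
    s+g≡n = m∸n+n≡m (≤-trans (≤-trans (m≤n*m g 3) (m≤m+n (3 * g) 3)) n₀≤n)

    a+b≡s : a + b ≡ s
    a+b≡s = trans (+-comm a b) (⌊n/2⌋+⌈n/2⌉≡n s)

    a+a≤s+1 : a + a ≤ s + 1
    a+a≤s+1 = ≤-trans (+-monoʳ-≤ a (⌊n/2⌋≤⌈n/2⌉ (suc s))) (≤-reflexive (trans (⌊n/2⌋+⌈n/2⌉≡n (suc s)) (+-comm 1 s)))

    b+b≤s+1 : b + b ≤ s + 1
    b+b≤s+1 = ≤-trans (+-mono-≤ (⌊n/2⌋≤⌈n/2⌉ s) (⌊n/2⌋≤⌈n/2⌉ s)) a+a≤s+1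

    upper : q ^ minSq s * LinAlg.N K g c ≤ 6 * (loss * (q ^ n) ^ n)
    -- The final underscore is the decision procedure local to `N`, found by unification; for this
    -- purpose the bounds are stated for an arbitrary one.
    upper = Factorizations.upper-bound K c c-fixed-free {g = g} {s = s} s+g≡n _

    lower : (q ^ n) ^ n ≤ loss * (LinAlg.N K g c * q ^ (a * a + b * b))
    lower = LowerBound.lower-bound K c c-injective c-fixed-free {a = a} {b = b} {g = g} (trans (cong (_+ g) a+b≡s) s+g≡n)
      (half-room g s+g≡n n₀≤n {h = a} a+a≤s+1) (half-room g s+g≡n n₀≤n {h = b} b+b≤s+1) _

    bounds : (1 * 1) * q ^ ((n + g) * (n + g))
      ≤ (loss * 64 * q * (loss * 64 * q)) * ((LinAlg.N K g c * LinAlg.N K g c) * (LinAlg.∣GL∣ K g * LinAlg.∣GL∣ K g))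
      × (1 * 1) * ((LinAlg.N K g c * LinAlg.N K g c) * (LinAlg.∣GL∣ K g * LinAlg.∣GL∣ K g))
      ≤ (6 * loss * (6 * loss)) * q ^ ((n + g) * (n + g))
    bounds =
      squared-lower {n} {s} {g} {LinAlg.N K g c} {LinAlg.∣GL∣ K g} loss 64 s+g≡n
        (subst (λ e → (q ^ n) ^ n ≤ loss * (LinAlg.N K g c * q ^ e)) (minSq-halves s) lower) (∣GL∣-lower g) ,
      squared-upper {n} {s} {g} {LinAlg.N K g c} {LinAlg.∣GL∣ K g} (6 * loss) s+g≡n
        (≤-trans upper (≤-reflexive (sym (*-assoc 6 loss ((q ^ n) ^ n))))) (∣GL∣-upper g)
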